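{- Let $n\ge1$, let $\lambda\in\mathbb{Z}^n$ with $\lambda_1\ge\cdots\ge\lambda_n$, and let $\rho=(n-1,n-2,\ldots,1,0)$. Then $$P_\lambda=\frac{t^{\frac12\ell(w_0)}}{W_\lambda(t)}\,\mathbf{1}_0E_\lambda\qquad\text{and}\qquad A_{\lambda+\rho}=t^{\frac12\ell(w_0)}\,\varepsilon_0E_{\lambda+\rho},$$ where $W_\lambda(t)$ is the normalizing constant which makes the coefficient of $x^\lambda$ in $P_\lambda$ equal to $1$.
   Context: Let $q,t^{1/2}$ be independent indeterminates over $\mathbb{C}$, $t=(t^{1/2})^2$, $K=\mathbb{C}(q,t^{1/2})$, $K[X]=K[x_1^{\pm1},\ldots,x_n^{\pm1}]$. $S_n$ acts on $K[X]$ by permuting variables and on $\mathbb{Z}^n$ by $(w\mu)_{w(i)}=\mu_i$; $s_i=(i,i+1)$; $\ell$ is the length; $w_0$ the longest element; $x^\mu=x_1^{\mu_1}\cdots x_n^{\mu_n}$; $\partial_if=\frac{f-s_if}{x_i-x_{i+1}}$. For $\mu\in\mathbb{Z}^n$, $v_\mu\in S_n$ is the minimal length permutation such that $v_\mu\mu$ is weakly increasing; explicitly $v_\mu(r)=1+\#\{r'<r:\mu_{r'}\le\mu_r\}+\#\{r'>r:\mu_{r'}<\mu_r\}$. The electronic (nonsymmetric) Macdonald polynomials $E_\mu\in K[X]$ are determined by: (E0) $E_{(0,\ldots,0)}=1$; (E1) $E_{(\mu_n+1,\mu_1,\ldots,\mu_{n-1})}=q^{\mu_n}x_1E_\mu(x_2,\ldots,x_n,q^{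 -1}x_1)$; (E2) if $\mu\in\mathbb{Z}_{\ge0}^n$ and $\mu_i>\mu_{i+1}$ then $E_{s_i\mu}=\partial_i(x_iE_\mu)-tx_i\partial_iE_\mu+\frac{(1-t)a}{1-a}E_\mu$ with $a=q^{\mu_i-\mu_{i+1}}t^{v_\mu(i)-v_\mu(i+1)}$; (E3) $E_{(\mu_1-1,\ldots,\mu_n-1)}=x_1^{ -1}\cdots x_n^{ -1}E_\mu$. The bosonic and fermionic Macdonald polynomials are defined by $$P_\lambda=\frac1{W_\lambda(t)}\sum_{w\in S_n}w\Big(E_\lambda\prod_{i<j}\frac{x_i-tx_j}{x_i-x_j}\Big),\qquad A_{\lambda+\rho}=\Big(\prod_{i<j}\frac{x_j-tx_i}{x_i-x_j}\Big)\sum_{w\in S_n}(-1)^{\ell(w)}wE_{\lambda+\rho},$$ with $W_\lambda(t)$ as in the claim. The Hecke operators on $K[X]$ are $T_if=-t^{ -\frac12}f+(1+s_i)\Big(\frac{t^{ -\frac12}-t^{\frac12}x_i^{ -1}x_{i+1}}{1-x_i^{ -1}x_{i+1}}f\Big)$, $1\le i\le n-1$; $T_w=T_{i_1}\cdots T_{i_\ell}$ for a reduced word $w=s_{i_1}\cdots s_{i_\ell}$; and $$\mathbf{1}_0=\sum_{w\in S_n}(t^{\frac12})^{\ell(w)-\ell(w_0)}T_w,\qquad\varepsilon_0=\sum_{w\in S_n}(-t^{ -\frac12})^{\ell(w)-\ell(w_0)}T_w.$$ -}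

module Defs where

open import Level using (_⊔_)
open import Algebra.Bundles using (CommutativeRing; CommutativeSemiring)
open import Algebra.Structures using (IsCommutativeRing)
open import Algebra.Apartness.Bundles using (HeytingField; HeytingCommutativeRing)
import Algebra.Definitions.RawMonoid
import Algebra.Definitions.RawSemiring
import Algebra.Properties.Ring
open import Data.Bool.Base using (true; false; if_then_else_)
open import Data.Fin.Base using (Fin; zero; suc; toℕ; inject₁; _<_)
open import Data.Fin.Properties using (_<?_; ¬∀⟶∃¬)
import Data.Fin.Properties as Fin
open import Data.Fin.Permutation
  using (Permutation′; _⟨$⟩ʳ_; _⟨$⟩ˡ_; _∘ₚ_; transpose; insert; flip; inverseʳ)
  renaming (_≈_ to _≈ₚ_; id to idₚ)
open import Data.Integer.Base as ℤ using (ℤ; +_; -[1+_]; 0ℤ; 1ℤ)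
import Data.Integer.Properties as ℤ
import Data.Integer.Tactic.RingSolver as ℤ-Solver
open import Data.List.Base as List using (List; []; _∷_; _++_; foldr; length; filter; allFin; cartesianProductWith)
import Data.List.Properties as List
open import Data.Nat.Base as ℕ using (ℕ; zero; suc; _∸_)
import Data.Nat.Properties as ℕ
open import Data.Product.Base using (Σ; ∃; _×_; _,_; proj₁; proj₂)
open import Data.Vec.Base as Vec using (Vec; []; _∷_; lookup; tabulate; zipWith; replicate; init; last; _[_]≔_)
import Data.Vec.Properties as Vec
open import Function.Base using (_∘_; _$_)
open import Relation.Binary.PropositionalEquality as ≡ using (_≡_; _≢_; cong; cong₂)
open import Relation.Binary.Definitions using (DecidableEquality)
import Relation.Binary.Reasoning.Setoid as SetoidReasoning
open import Relation.Nullary using (yes; no; does; contradiction)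
open import Relation.Nullary.Decidable using (_×-dec_)
import Algebra.Solver.Ring.NaturalCoefficients.Default as NaturalCoefficients

-- The total ring of fractions: denominators are the non-zero-divisors.  For an
-- integral domain R this is the field of fractions of R.
module TotalFractions {c ℓ} (R : CommutativeRing c ℓ) where
  open CommutativeRing R
  open Algebra.Properties.Ring ring using (-‿distribˡ-*; -‿distribʳ-*)

  Regular : Carrier → Set (c ⊔ ℓ)
  Regular d = ∀ h → d * h ≈ 0# → h ≈ 0#

  abstract
    1-regular : Regular 1#
    1-regular h 1h≈0 = trans (sym (*-identityˡ h)) 1h≈0

    *-regular : ∀ {d e} → Regular d → Regular e → Regular (d * e)
    *-regular rd re h deh≈0 = re h (rd _ (trans (sym (*-assoc _ _ h)) deh≈0))

  record Frac : Set (c ⊔ ℓ) where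
    constructor frac
    field
      num         : Carrier
      den         : Carrier
      den-regular : Regular den
  open Frac public

  infix 4 _≈ᶠ_
  record _≈ᶠ_ (f g : Frac) : Set ℓ where
    constructor cross
    field
      uncross : num f * den g ≈ num g * den f
  open _≈ᶠ_ public

  fromR : Carrier → Frac
  fromR a = frac a 1# 1-regular

  infixl 6 _+ᶠ_
  infixl 7 _*ᶠ_
  infix  8 -ᶠ_
  _+ᶠ_ _*ᶠ_ : Frac → Frac → Frac
  f +ᶠ g = frac (num f * den g + num g * den f) (den f * den g) (*-regular (den-regular f) (den-regular g))
  f *ᶠ g = frac (num f * num g) (den f * den g) (*-regular (den-regular f) (den-regular g))

  -ᶠ_ : Frac → Frac
  -ᶠ f = frac (- num f) (den f) (den-regular f)

  private
    open NaturalCoefficients commutativeSemiring using (solve; _:=_; _:+_; _:*_)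
    open SetoidReasoning setoid

    cancel : ∀ {d} x y → Regular d → d * x ≈ d * y → x ≈ y
    cancel {d} x y rd dx≈dy = begin
      x            ≈⟨ +-identityʳ x ⟨
      x + 0#       ≈⟨ +-congˡ (-‿inverseˡ y) ⟨
      x + (- y + y) ≈⟨ +-assoc x (- y) y ⟨
      x - y + y    ≈⟨ +-congʳ (rd (x - y) dxy≈0) ⟩
      0# + y       ≈⟨ +-identityˡ y ⟩
      y            ∎
      where
      dxy≈0 : d * (x - y) ≈ 0#
      dxy≈0 = begin
        d * (x - y)         ≈⟨ distribˡ d x (- y) ⟩
        d * x + d * (- y)   ≈⟨ +-congˡ (-‿distribʳ-* d y) ⟨
        d * x - d * y       ≈⟨ +-congʳ dx≈dy ⟩
        d * y - d * y       ≈⟨ -‿inverseʳ (d * y) ⟩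
        0#                  ∎

  ≈ᶠ-refl : ∀ {f} → f ≈ᶠ f
  ≈ᶠ-refl = cross refl

  ≈ᶠ-sym : ∀ {f g} → f ≈ᶠ g → g ≈ᶠ f
  ≈ᶠ-sym (cross p) = cross (sym p)

  ≈ᶠ-trans : ∀ {f g h} → f ≈ᶠ g → g ≈ᶠ h → f ≈ᶠ h
  ≈ᶠ-trans {frac a b _} {frac c d rd} {frac e f _} (cross p) (cross q) =
    cross $ cancel (a * f) (e * b) rd $ begin
      d * (a * f) ≈⟨ solve 3 (λ d a f → d :* (a :* f) := (a :* d) :* f) refl d a f ⟩
      (a * d) * f ≈⟨ *-congʳ p ⟩
      (c * b) * f ≈⟨ solve 3 (λ c b f → (c :* b) :* f := (c :* f) :* b) refl c b f ⟩
      (c * f) * b ≈⟨ *-congʳ q ⟩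
      (e * d) * b ≈⟨ solve 3 (λ e d b → (e :* d) :* b := d :* (e :* b)) refl e d b ⟩
      d * (e * b) ∎

  private
    +ᶠ-cong : ∀ {f f′ g g′} → f ≈ᶠ f′ → g ≈ᶠ g′ → f +ᶠ g ≈ᶠ f′ +ᶠ g′
    +ᶠ-cong {frac a b _} {frac a′ b′ _} {frac c d _} {frac c′ d′ _} (cross p) (cross q) = cross $ begin
      (a * d + c * b) * (b′ * d′)
        ≈⟨ solve 6 (λ a b c d b′ d′ → (a :* d :+ c :* b) :* (b′ :* d′) := (a :* b′) :* (d :* d′) :+ (c :* d′) :* (b :* b′)) refl a b c d b′ d′ ⟩
      (a * b′) * (d * d′) + (c * d′) * (b * b′)
        ≈⟨ +-cong (*-congʳ p) (*-congʳ q) ⟩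
      (a′ * b) * (d * d′) + (c′ * d) * (b * b′)
        ≈⟨ solve 6 (λ a′ b c′ d b′ d′ → (a′ :* b) :* (d :* d′) :+ (c′ :* d) :* (b :* b′) := (a′ :* d′ :+ c′ :* b′) :* (b :* d)) refl a′ b c′ d b′ d′ ⟩
      (a′ * d′ + c′ * b′) * (b * d) ∎

    *ᶠ-cong : ∀ {f f′ g g′} → f ≈ᶠ f′ → g ≈ᶠ g′ → f *ᶠ g ≈ᶠ f′ *ᶠ g′
    *ᶠ-cong {frac a b _} {frac a′ b′ _} {frac c d _} {frac c′ d′ _} (cross p) (cross q) = cross $ begin
      (a * c) * (b′ * d′)  ≈⟨ interchange a c b′ d′ ⟩
      (a * b′) * (c * d′)  ≈⟨ *-cong p q ⟩
      (a′ * b) * (c′ * d)  ≈⟨ interchange a′ c′ b d ⟨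
      (a′ * c′) * (b * d)  ∎
      where
      interchange : ∀ w x y z → (w * x) * (y * z) ≈ (w * y) * (x * z)
      interchange = solve 4 (λ w x y z → (w :* x) :* (y :* z) := (w :* y) :* (x :* z)) refl

    -ᶠ-cong : ∀ {f g} → f ≈ᶠ g → -ᶠ f ≈ᶠ -ᶠ g
    -ᶠ-cong {frac a b _} {frac c d _} (cross p) =
      cross (trans (sym (-‿distribˡ-* a d)) (trans (-‿cong p) (-‿distribˡ-* c b)))

    +ᶠ-assoc : ∀ f g h → (f +ᶠ g) +ᶠ h ≈ᶠ f +ᶠ (g +ᶠ h)
    +ᶠ-assoc (frac a b _) (frac c d _) (frac e f _) = cross $
      solve 6 (λ a b c d e f →
        ((a :* d :+ c :* b) :* f :+ e :* (b :* d)) :* (b :* (d :* f)) :=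
        (a :* (d :* f) :+ (c :* f :+ e :* d) :* b) :* ((b :* d) :* f)) refl a b c d e f

    +ᶠ-comm : ∀ f g → f +ᶠ g ≈ᶠ g +ᶠ f
    +ᶠ-comm (frac a b _) (frac c d _) = cross (*-cong (+-comm (a * d) (c * b)) (*-comm d b))

    +ᶠ-identityˡ : ∀ f → fromR 0# +ᶠ f ≈ᶠ f
    +ᶠ-identityˡ (frac a b _) = cross $ begin
      (0# * b + a * 1#) * b ≈⟨ *-congʳ (+-cong (zeroˡ b) (*-identityʳ a)) ⟩
      (0# + a) * b          ≈⟨ *-congʳ (+-identityˡ a) ⟩
      a * b                 ≈⟨ *-congˡ (*-identityˡ b) ⟨
      a * (1# * b)          ∎

    +ᶠ-inverseˡ : ∀ f → -ᶠ f +ᶠ f ≈ᶠ fromR 0#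
    +ᶠ-inverseˡ (frac a b _) = cross $ begin
      (- a * b + a * b) * 1#  ≈⟨ *-identityʳ _ ⟩
      - a * b + a * b         ≈⟨ distribʳ b (- a) a ⟨
      (- a + a) * b           ≈⟨ *-congʳ (-‿inverseˡ a) ⟩
      0# * b                  ≈⟨ zeroˡ b ⟩
      0#                      ≈⟨ zeroˡ (b * b) ⟨
      0# * (b * b)            ∎

    *ᶠ-assoc : ∀ f g h → (f *ᶠ g) *ᶠ h ≈ᶠ f *ᶠ (g *ᶠ h)
    *ᶠ-assoc (frac a b _) (frac c d _) (frac e f _) =
      cross (*-cong (*-assoc a c e) (sym (*-assoc b d f)))

    *ᶠ-comm : ∀ f g → f *ᶠ g ≈ᶠ g *ᶠ f
    *ᶠ-comm (frac a b _) (frac c d _) = cross (*-cong (*-comm a c) (*-comm d b))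

    *ᶠ-identityˡ : ∀ f → fromR 1# *ᶠ f ≈ᶠ f
    *ᶠ-identityˡ (frac a b _) = cross (trans (*-congʳ (*-identityˡ a)) (*-congˡ (sym (*-identityˡ b))))

    distribˡᶠ : ∀ f g h → f *ᶠ (g +ᶠ h) ≈ᶠ f *ᶠ g +ᶠ f *ᶠ h
    distribˡᶠ (frac a b _) (frac c d _) (frac e f _) = cross $
      solve 6 (λ a b c d e f →
        (a :* (c :* f :+ e :* d)) :* ((b :* d) :* (b :* f)) :=
        ((a :* c) :* (b :* f) :+ (a :* e) :* (b :* d)) :* (b :* (d :* f))) refl a b c d e f

  abstract
    Frac-isCommutativeRing : IsCommutativeRing _≈ᶠ_ _+ᶠ_ _*ᶠ_ -ᶠ_ (fromR 0#) (fromR 1#)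
    Frac-isCommutativeRing = record
      { isRing = record
        { +-isAbelianGroup = record
          { isGroup = record
            { isMonoid = record
              { isSemigroup = record
                { isMagma = record
                  { isEquivalence = record { refl = ≈ᶠ-refl ; sym = ≈ᶠ-sym ; trans = ≈ᶠ-trans }
                  ; ∙-cong = +ᶠ-cong }
                ; assoc = +ᶠ-assoc }
              ; identity = +ᶠ-identityˡ , λ f → ≈ᶠ-trans (+ᶠ-comm f (fromR 0#)) (+ᶠ-identityˡ f) }
            ; inverse = +ᶠ-inverseˡ , λ f → ≈ᶠ-trans (+ᶠ-comm f (-ᶠ f)) (+ᶠ-inverseˡ f)
            ; ⁻¹-cong = -ᶠ-cong }
          ; comm = +ᶠ-comm }
        ; *-cong = *ᶠ-cong
        ; *-assoc = *ᶠ-assoc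
        ; *-identity = *ᶠ-identityˡ , λ f → ≈ᶠ-trans (*ᶠ-comm f (fromR 1#)) (*ᶠ-identityˡ f)
        ; distrib = distribˡᶠ , λ f g h →
            ≈ᶠ-trans (*ᶠ-comm (g +ᶠ h) f)
              (≈ᶠ-trans (distribˡᶠ f g h) (+ᶠ-cong (*ᶠ-comm f g) (*ᶠ-comm f h))) }
      ; *-comm = *ᶠ-comm }

  Frac-commutativeRing : CommutativeRing (c ⊔ ℓ) ℓ
  Frac-commutativeRing = record { isCommutativeRing = Frac-isCommutativeRing }

  infixl 7 _÷_
  _÷_ : Frac → Σ Carrier Regular → Frac
  f ÷ (d , rd) = frac (num f) (den f * d) (*-regular (den-regular f) rd)

Exponent : ℕ → Set
Exponent n = Vec ℤ n

module _ {n : ℕ} where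
  infixl 6 _⊞_ _⊟_
  _⊞_ _⊟_ : Exponent n → Exponent n → Exponent n
  _⊞_ = zipWith ℤ._+_
  _⊟_ = zipWith ℤ._-_

  𝟎 : Exponent n
  𝟎 = replicate n 0ℤ

  unit : Fin n → Exponent n
  unit i = 𝟎 [ i ]≔ 1ℤ

  -- (w μ)_{w(i)} = μ_i
  permuteExponent : Permutation′ n → Exponent n → Exponent n
  permuteExponent w μ = tabulate (λ j → lookup μ (w ⟨$⟩ˡ j))

  lookup-ext : ∀ {α β : Exponent n} → (∀ i → lookup α i ≡ lookup β i) → α ≡ β
  lookup-ext {α} {β} p = ≡.trans (≡.sym (Vec.tabulate∘lookup α))
    (≡.trans (Vec.tabulate-cong p) (Vec.tabulate∘lookup β))

  ⊞⊟-cancel : ∀ (α μ : Exponent n) → α ⊞ μ ⊟ α ≡ μ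
  ⊞⊟-cancel α μ = lookup-ext λ i → ≡.trans (Vec.lookup-zipWith ℤ._-_ i (α ⊞ μ) α)
    (≡.trans (cong (λ z → z ℤ.- lookup α i) (Vec.lookup-zipWith ℤ._+_ i α μ))
      (arith (lookup α i) (lookup μ i)))
    where
    arith : ∀ x y → x ℤ.+ y ℤ.- x ≡ y
    arith = ℤ-Solver.solve-∀

  ⊞⊟-cancel′ : ∀ (α ν : Exponent n) → α ⊞ (ν ⊟ α) ≡ ν
  ⊞⊟-cancel′ α ν = lookup-ext λ i → ≡.trans (Vec.lookup-zipWith ℤ._+_ i α (ν ⊟ α))
    (≡.trans (cong (λ z → lookup α i ℤ.+ z) (Vec.lookup-zipWith ℤ._-_ i ν α))
      (arith (lookup α i) (lookup ν i)))
    where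
    arith : ∀ x y → x ℤ.+ (y ℤ.- x) ≡ y
    arith = ℤ-Solver.solve-∀

  ⊟𝟎 : ∀ (ν : Exponent n) → ν ⊟ 𝟎 ≡ ν
  ⊟𝟎 = Vec.zipWith-identityʳ ℤ.+-identityʳ

  ⊞-comm : ∀ (α β : Exponent n) → α ⊞ β ≡ β ⊞ α
  ⊞-comm = Vec.zipWith-comm ℤ.+-comm

  ⊞-assoc : ∀ (α β γ : Exponent n) → (α ⊞ β) ⊞ γ ≡ α ⊞ (β ⊞ γ)
  ⊞-assoc = Vec.zipWith-assoc ℤ.+-assoc

  permute-⊞ : ∀ w (α β : Exponent n) →
              permuteExponent w (α ⊞ β) ≡ permuteExponent w α ⊞ permuteExponent w β
  permute-⊞ w α β = lookup-ext λ i → begin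
    lookup (permuteExponent w (α ⊞ β)) i
      ≡⟨ Vec.lookup∘tabulate _ i ⟩
    lookup (α ⊞ β) (w ⟨$⟩ˡ i)
      ≡⟨ Vec.lookup-zipWith ℤ._+_ (w ⟨$⟩ˡ i) α β ⟩
    lookup α (w ⟨$⟩ˡ i) ℤ.+ lookup β (w ⟨$⟩ˡ i)
      ≡⟨ cong₂ ℤ._+_ (Vec.lookup∘tabulate _ i) (Vec.lookup∘tabulate _ i) ⟨
    lookup (permuteExponent w α) i ℤ.+ lookup (permuteExponent w β) i
      ≡⟨ Vec.lookup-zipWith ℤ._+_ i (permuteExponent w α) (permuteExponent w β) ⟨
    lookup (permuteExponent w α ⊞ permuteExponent w β) i ∎
    where open ≡.≡-Reasoning

  permute-flip : ∀ w (ν : Exponent n) → permuteExponent w (permuteExponent (flip w) ν) ≡ ν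
  permute-flip w ν = lookup-ext λ i →
    ≡.trans (Vec.lookup∘tabulate _ i) (≡.trans (Vec.lookup∘tabulate _ (w ⟨$⟩ˡ i)) (cong (lookup ν) (inverseʳ w)))

  permute-flip′ : ∀ w (ν : Exponent n) → permuteExponent (flip w) (permuteExponent w ν) ≡ ν
  permute-flip′ w = permute-flip (flip w)

  ray : Exponent n → Exponent n → ℕ → Exponent n
  ray κ δ zero    = κ
  ray κ δ (suc N) = ray κ δ N ⊞ δ

  lookup-ray : ∀ κ δ N r → lookup (ray κ δ N) r ≡ lookup κ r ℤ.+ + N ℤ.* lookup δ r
  lookup-ray κ δ zero    r = ≡.sym (ℤ.+-identityʳ _)
  lookup-ray κ δ (suc N) r = begin
    lookup (ray κ δ N ⊞ δ) r                             ≡⟨ Vec.lookup-zipWith ℤ._+_ r (ray κ δ N) δ ⟩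
    lookup (ray κ δ N) r ℤ.+ lookup δ r                  ≡⟨ cong (λ z → z ℤ.+ lookup δ r) (lookup-ray κ δ N r) ⟩
    lookup κ r ℤ.+ + N ℤ.* lookup δ r ℤ.+ lookup δ r     ≡⟨ arith (lookup κ r) (+ N) (lookup δ r) ⟩
    lookup κ r ℤ.+ (1ℤ ℤ.+ + N) ℤ.* lookup δ r           ∎
    where
    open ≡.≡-Reasoning
    arith : ∀ x y z → x ℤ.+ y ℤ.* z ℤ.+ z ≡ x ℤ.+ (1ℤ ℤ.+ y) ℤ.* z
    arith = ℤ-Solver.solve-∀

  ray-escapes : ∀ κ δ r → lookup δ r ≢ 0ℤ → ∀ N μ →
                ℤ.∣ lookup μ r ℤ.- lookup κ r ∣ ℕ.< N → μ ≢ ray κ δ N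
  ray-escapes κ δ r δᵣ≢0 N μ bound ≡.refl = ℕ.<⇒≱ bound (begin
    N                                              ≡⟨ ℕ.*-identityʳ N ⟨
    N ℕ.* 1                                        ≤⟨ ℕ.*-monoʳ-≤ N (ℕ.n≢0⇒n>0 (δᵣ≢0 ∘ ℤ.∣i∣≡0⇒i≡0)) ⟩
    N ℕ.* ℤ.∣ lookup δ r ∣                         ≡⟨ ℤ.abs-* (+ N) (lookup δ r) ⟨
    ℤ.∣ + N ℤ.* lookup δ r ∣                       ≡⟨ cong ℤ.∣_∣ difference ⟨
    ℤ.∣ lookup (ray κ δ N) r ℤ.- lookup κ r ∣      ∎)
    where
    open ℕ.≤-Reasoning
    arith : ∀ x y → x ℤ.+ y ℤ.- x ≡ y
    arith = ℤ-Solver.solve-∀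
    difference : lookup (ray κ δ N) r ℤ.- lookup κ r ≡ + N ℤ.* lookup δ r
    difference = ≡.trans (cong (λ z → z ℤ.- lookup κ r) (lookup-ray κ δ N r))
      (arith (lookup κ r) (+ N ℤ.* lookup δ r))

  differ : ∀ (α β : Exponent n) → α ≢ β → ∃ λ r → lookup (α ⊟ β) r ≢ 0ℤ
  differ α β α≢β = ¬∀⟶∃¬ n (λ r → lookup (α ⊟ β) r ≡ 0ℤ) (λ r → lookup (α ⊟ β) r ℤ.≟ 0ℤ)
    λ same → α≢β (lookup-ext λ r →
      ℤ.i-j≡0⇒i≡j (lookup α r) (lookup β r)
        (≡.trans (≡.sym (Vec.lookup-zipWith ℤ._-_ r α β)) (same r)))

  shift-difference : ∀ (κ α β : Exponent n) → κ ⊞ α ⊟ β ≡ κ ⊞ (α ⊟ β)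
  shift-difference = λ κ α β → lookup-ext λ r → begin
    lookup (κ ⊞ α ⊟ β) r                          ≡⟨ Vec.lookup-zipWith ℤ._-_ r (κ ⊞ α) β ⟩
    lookup (κ ⊞ α) r ℤ.- lookup β r               ≡⟨ cong (λ z → z ℤ.- lookup β r) (Vec.lookup-zipWith ℤ._+_ r κ α) ⟩
    lookup κ r ℤ.+ lookup α r ℤ.- lookup β r      ≡⟨ ℤ.+-assoc (lookup κ r) (lookup α r) (ℤ.- lookup β r) ⟩
    lookup κ r ℤ.+ (lookup α r ℤ.- lookup β r)    ≡⟨ cong (λ z → lookup κ r ℤ.+ z) (Vec.lookup-zipWith ℤ._-_ r α β) ⟨
    lookup κ r ℤ.+ lookup (α ⊟ β) r               ≡⟨ Vec.lookup-zipWith ℤ._+_ r κ (α ⊟ β) ⟨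
    lookup (κ ⊞ (α ⊟ β)) r                        ∎
    where open ≡.≡-Reasoning

  infix 4 _≟ᵉ_
  _≟ᵉ_ : DecidableEquality (Exponent n)
  _≟ᵉ_ = Vec.≡-dec ℤ._≟_

  module Laurent {c ℓ} (R : CommutativeRing c ℓ) where
    open CommutativeRing R

    -- A Laurent polynomial is a list of terms a x^α; exponents may repeat and
    -- coefficients may vanish, so equality is equality of all coefficients.
    Poly : Set c
    Poly = List (Carrier × Exponent n)

    coeff : Exponent n → Poly → Carrier
    coeff ν []            = 0#
    coeff ν ((a , μ) ∷ f) = (if does (μ ≟ᵉ ν) then a else 0#) + coeff ν f

    infix 4 _≋_
    record _≋_ (f g : Poly) : Set (c ⊔ ℓ) where
      constructor coeffwise
      field
        coeff-≈ : ∀ ν → coeff ν f ≈ coeff ν g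
    open _≋_ public

    monomial : Exponent n → Poly
    monomial α = (1# , α) ∷ []

    constant : Carrier → Poly
    constant a = (a , 𝟎) ∷ []

    scaleTerm : Carrier × Exponent n → Poly → Poly
    scaleTerm (a , α) = List.map λ (b , β) → a * b , α ⊞ β

    infixl 7 _⊗_
    _⊗_ : Poly → Poly → Poly
    []      ⊗ g = []
    (s ∷ f) ⊗ g = scaleTerm s g ++ f ⊗ g

    ⊝_ : Poly → Poly
    ⊝_ = List.map λ (a , α) → - a , α

    permute : Permutation′ n → Poly → Poly
    permute w = List.map λ (a , α) → a , permuteExponent w α

    open SetoidReasoning setoid
    open Algebra.Properties.Ring ring using (-‿+-comm; -0#≈0#)

    coeff-++ : ∀ ν f g → coeff ν (f ++ g) ≈ coeff ν f + coeff ν g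
    coeff-++ ν []            g = sym (+-identityˡ _)
    coeff-++ ν ((a , α) ∷ f) g = trans (+-congˡ (coeff-++ ν f g)) (sym (+-assoc _ _ _))

    coeff-⊝ : ∀ ν f → coeff ν (⊝ f) ≈ - coeff ν f
    coeff-⊝ ν [] = sym -0#≈0#
    coeff-⊝ ν ((a , α) ∷ f) = trans (+-cong head (coeff-⊝ ν f)) (-‿+-comm _ _)
      where
      head : (if does (α ≟ᵉ ν) then - a else 0#) ≈ - (if does (α ≟ᵉ ν) then a else 0#)
      head with does (α ≟ᵉ ν)
      ... | true  = refl
      ... | false = sym -0#≈0#

    coeff-scale : ∀ ν a α f → coeff ν (scaleTerm (a , α) f) ≈ a * coeff (ν ⊟ α) f
    coeff-scale ν a α []            = sym (zeroʳ a)
    coeff-scale ν a α ((b , β) ∷ f) = trans (+-cong head (coeff-scale ν a α f)) (sym (distribˡ _ _ _))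
      where
      head : (if does (α ⊞ β ≟ᵉ ν) then a * b else 0#) ≈ a * (if does (β ≟ᵉ ν ⊟ α) then b else 0#)
      head with α ⊞ β ≟ᵉ ν | β ≟ᵉ ν ⊟ α
      ... | yes _   | yes _   = refl
      ... | no  _   | no  _   = sym (zeroʳ a)
      ... | yes ≡.refl | no ¬q = contradiction (≡.sym (⊞⊟-cancel α β)) ¬q
      ... | no  ¬p  | yes ≡.refl = contradiction (⊞⊟-cancel′ α ν) ¬p

    coeff-∷⊗ : ∀ ν a α f g → coeff ν (((a , α) ∷ f) ⊗ g) ≈ a * coeff (ν ⊟ α) g + coeff ν (f ⊗ g)
    coeff-∷⊗ ν a α f g = trans (coeff-++ ν (scaleTerm (a , α) g) (f ⊗ g)) (+-congʳ (coeff-scale ν a α g))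

    coeff-permute : ∀ ν w f → coeff ν (permute w f) ≈ coeff (permuteExponent (flip w) ν) f
    coeff-permute ν w []            = refl
    coeff-permute ν w ((a , α) ∷ f) = +-cong head (coeff-permute ν w f)
      where
      head : (if does (permuteExponent w α ≟ᵉ ν) then a else 0#) ≈ (if does (α ≟ᵉ permuteExponent (flip w) ν) then a else 0#)
      head with permuteExponent w α ≟ᵉ ν | α ≟ᵉ permuteExponent (flip w) ν
      ... | yes _   | yes _   = refl
      ... | no  _   | no  _   = refl
      ... | yes ≡.refl | no ¬q = contradiction (≡.sym (permute-flip′ w α)) ¬q
      ... | no  ¬p  | yes ≡.refl = contradiction (permute-flip w ν) ¬p

    ≋-refl : ∀ {f} → f ≋ f
    ≋-refl = coeffwise λ _ → refl

    ≋-sym : ∀ {f g} → f ≋ g → g ≋ f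
    ≋-sym (coeffwise p) = coeffwise λ ν → sym (p ν)

    ≋-trans : ∀ {f g h} → f ≋ g → g ≋ h → f ≋ h
    ≋-trans (coeffwise p) (coeffwise q) = coeffwise λ ν → trans (p ν) (q ν)

    private
      ≡⇒≋ : ∀ {f g} → f ≡ g → f ≋ g
      ≡⇒≋ ≡.refl = ≋-refl

      ++-cong : ∀ {f f′ g g′} → f ≋ f′ → g ≋ g′ → f ++ g ≋ f′ ++ g′
      ++-cong {f} {f′} {g} {g′} (coeffwise p) (coeffwise q) = coeffwise λ ν →
        trans (coeff-++ ν f g) (trans (+-cong (p ν) (q ν)) (sym (coeff-++ ν f′ g′)))

      ++-comm : ∀ f g → f ++ g ≋ g ++ f
      ++-comm f g = coeffwise λ ν →
        trans (coeff-++ ν f g) (trans (+-comm _ _) (sym (coeff-++ ν g f)))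

      ++-assoc : ∀ f g h → (f ++ g) ++ h ≋ f ++ (g ++ h)
      ++-assoc f g h = ≡⇒≋ (List.++-assoc f g h)

      ⊝-inverseˡ : ∀ f → ⊝ f ++ f ≋ []
      ⊝-inverseˡ f = coeffwise λ ν →
        trans (coeff-++ ν (⊝ f) f) (trans (+-congʳ (coeff-⊝ ν f)) (-‿inverseˡ _))

      ⊝-cong : ∀ {f g} → f ≋ g → ⊝ f ≋ ⊝ g
      ⊝-cong {f} {g} (coeffwise p) = coeffwise λ ν →
        trans (coeff-⊝ ν f) (trans (-‿cong (p ν)) (sym (coeff-⊝ ν g)))

      ⊗-congˡ : ∀ f {g g′} → g ≋ g′ → f ⊗ g ≋ f ⊗ g′
      ⊗-congˡ []            p = ≋-refl
      ⊗-congˡ ((a , α) ∷ f) {g} {g′} p = coeffwise λ ν → begin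
        coeff ν (((a , α) ∷ f) ⊗ g)              ≈⟨ coeff-∷⊗ ν a α f g ⟩
        a * coeff (ν ⊟ α) g + coeff ν (f ⊗ g)    ≈⟨ +-cong (*-congˡ (coeff-≈ p (ν ⊟ α))) (coeff-≈ (⊗-congˡ f p) ν) ⟩
        a * coeff (ν ⊟ α) g′ + coeff ν (f ⊗ g′)  ≈⟨ coeff-∷⊗ ν a α f g′ ⟨
        coeff ν (((a , α) ∷ f) ⊗ g′)             ∎

      ⊗-[] : ∀ f → f ⊗ [] ≡ []
      ⊗-[] []      = ≡.refl
      ⊗-[] (_ ∷ f) = ⊗-[] f

      scale-swap : ∀ s t → scaleTerm s (t ∷ []) ≋ scaleTerm t (s ∷ [])
      scale-swap (a , α) (b , β) = coeffwise λ ν → +-congʳ (head ν)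
        where
        head : ∀ ν → (if does (α ⊞ β ≟ᵉ ν) then a * b else 0#) ≈ (if does (β ⊞ α ≟ᵉ ν) then b * a else 0#)
        head ν rewrite ⊞-comm α β with does (β ⊞ α ≟ᵉ ν)
        ... | true  = *-comm a b
        ... | false = refl

      ⊗-∷ : ∀ f t g → f ⊗ (t ∷ g) ≋ scaleTerm t f ++ f ⊗ g
      ⊗-∷ []      t g = ≋-refl
      ⊗-∷ (s ∷ f) t g = ++-cong (scale-swap s t)
        (≋-trans (++-cong {scaleTerm s g} ≋-refl (⊗-∷ f t g))
        (≋-trans (≋-sym (++-assoc (scaleTerm s g) (scaleTerm t f) (f ⊗ g)))
        (≋-trans (++-cong (++-comm (scaleTerm s g) (scaleTerm t f)) ≋-refl)
                 (++-assoc (scaleTerm t f) (scaleTerm s g) (f ⊗ g)))))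

      ⊗-comm : ∀ f g → f ⊗ g ≋ g ⊗ f
      ⊗-comm f []      = ≡⇒≋ (⊗-[] f)
      ⊗-comm f (t ∷ g) = ≋-trans (⊗-∷ f t g) (++-cong {scaleTerm t f} ≋-refl (⊗-comm f g))

      ⊗-cong : ∀ {f f′ g g′} → f ≋ f′ → g ≋ g′ → f ⊗ g ≋ f′ ⊗ g′
      ⊗-cong {f} {f′} {g} {g′} p q =
        ≋-trans (⊗-congˡ f q) (≋-trans (⊗-comm f g′) (≋-trans (⊗-congˡ g′ p) (⊗-comm g′ f′)))

      ⊗-distribʳ : ∀ h f g → (f ++ g) ⊗ h ≋ f ⊗ h ++ g ⊗ h
      ⊗-distribʳ h []      g = ≋-refl
      ⊗-distribʳ h (s ∷ f) g = ≋-trans (++-cong {scaleTerm s h} ≋-refl (⊗-distribʳ h f g))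
        (≋-sym (++-assoc (scaleTerm s h) (f ⊗ h) (g ⊗ h)))

      ⊗-distribˡ : ∀ f g h → f ⊗ (g ++ h) ≋ f ⊗ g ++ f ⊗ h
      ⊗-distribˡ f g h = ≋-trans (⊗-comm f (g ++ h))
        (≋-trans (⊗-distribʳ f g h) (++-cong (⊗-comm g f) (⊗-comm h f)))

      scale-scale : ∀ s t h → scaleTerm s (scaleTerm t h) ≋ scaleTerm (proj₁ s * proj₁ t , proj₂ s ⊞ proj₂ t) h
      scale-scale s t [] = ≋-refl
      scale-scale (a , α) (b , β) ((c , γ) ∷ h) = coeffwise λ ν →
        +-cong (head ν) (coeff-≈ (scale-scale (a , α) (b , β) h) ν)
        where
        head : ∀ ν → (if does (α ⊞ (β ⊞ γ) ≟ᵉ ν) then a * (b * c) else 0#) ≈ (if does (α ⊞ β ⊞ γ ≟ᵉ ν) then a * b * c else 0#)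
        head ν rewrite ⊞-assoc α β γ with does (α ⊞ (β ⊞ γ) ≟ᵉ ν)
        ... | true  = sym (*-assoc a b c)
        ... | false = refl

      scale-⊗ : ∀ s g h → scaleTerm s g ⊗ h ≋ scaleTerm s (g ⊗ h)
      scale-⊗ s []      h = ≋-refl
      scale-⊗ s (t ∷ g) h = ≋-trans
        (++-cong (≋-sym (scale-scale s t h)) (scale-⊗ s g h))
        (≡⇒≋ (≡.sym (List.map-++ _ (scaleTerm t h) (g ⊗ h))))

      ⊗-assoc : ∀ f g h → (f ⊗ g) ⊗ h ≋ f ⊗ (g ⊗ h)
      ⊗-assoc []      g h = ≋-refl
      ⊗-assoc (s ∷ f) g h = ≋-trans (⊗-distribʳ h (scaleTerm s g) (f ⊗ g))
        (++-cong (scale-⊗ s g h) (⊗-assoc f g h))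

      ⊗-identityˡ : ∀ f → monomial 𝟎 ⊗ f ≋ f
      ⊗-identityˡ f = coeffwise λ ν → begin
        coeff ν (monomial 𝟎 ⊗ f)     ≈⟨ coeff-∷⊗ ν 1# 𝟎 [] f ⟩
        1# * coeff (ν ⊟ 𝟎) f + 0#   ≈⟨ +-identityʳ _ ⟩
        1# * coeff (ν ⊟ 𝟎) f        ≈⟨ *-identityˡ _ ⟩
        coeff (ν ⊟ 𝟎) f             ≡⟨ cong (λ κ → coeff κ f) (⊟𝟎 ν) ⟩
        coeff ν f                    ∎

    abstract
      Poly-isCommutativeRing : IsCommutativeRing _≋_ _++_ _⊗_ ⊝_ [] (monomial 𝟎)
      Poly-isCommutativeRing = record
        { isRing = record
          { +-isAbelianGroup = record
            { isGroup = record
              { isMonoid = record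
                { isSemigroup = record
                  { isMagma = record
                    { isEquivalence = record { refl = ≋-refl ; sym = ≋-sym ; trans = ≋-trans }
                    ; ∙-cong = ++-cong }
                  ; assoc = ++-assoc }
                ; identity = (λ _ → ≋-refl) , λ f → ≡⇒≋ (List.++-identityʳ f) }
              ; inverse = ⊝-inverseˡ , λ f → ≋-trans (++-comm f (⊝ f)) (⊝-inverseˡ f)
              ; ⁻¹-cong = ⊝-cong }
            ; comm = ++-comm }
          ; *-cong = ⊗-cong
          ; *-assoc = ⊗-assoc
          ; *-identity = ⊗-identityˡ , λ f → ≋-trans (⊗-comm f (monomial 𝟎)) (⊗-identityˡ f)
          ; distrib = ⊗-distribˡ , ⊗-distribʳ }
        ; *-comm = ⊗-comm }

    Poly-commutativeRing : CommutativeRing c (c ⊔ ℓ)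
    Poly-commutativeRing = record { isCommutativeRing = Poly-isCommutativeRing }

    open TotalFractions Poly-commutativeRing public

    permute-scale : ∀ w a α g → permute w (scaleTerm (a , α) g) ≡ scaleTerm (a , permuteExponent w α) (permute w g)
    permute-scale w a α []            = ≡.refl
    permute-scale w a α ((b , β) ∷ g) =
      cong₂ _∷_ (cong (a * b ,_) (permute-⊞ w α β)) (permute-scale w a α g)

    permute-⊗ : ∀ w f g → permute w (f ⊗ g) ≡ permute w f ⊗ permute w g
    permute-⊗ w []            g = ≡.refl
    permute-⊗ w ((a , α) ∷ f) g = ≡.trans (List.map-++ _ (scaleTerm (a , α) g) (f ⊗ g))
      (cong₂ _++_ (permute-scale w a α g) (permute-⊗ w f g))

    permute-inverse : ∀ w f → permute w (permute (flip w) f) ≡ f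
    permute-inverse w []            = ≡.refl
    permute-inverse w ((a , α) ∷ f) =
      cong₂ _∷_ (cong (a ,_) (permute-flip w α)) (permute-inverse w f)

    permute-cong : ∀ w {f g} → f ≋ g → permute w f ≋ permute w g
    permute-cong w {f} {g} (coeffwise p) = coeffwise λ ν →
      trans (coeff-permute ν w f) (trans (p _) (sym (coeff-permute ν w g)))

    abstract
      permute-regular : ∀ w d → Regular d → Regular (permute w d)
      permute-regular w d rd h wdh≋0 =
        ≋-trans (≡⇒≋ (≡.sym (permute-inverse w h))) (permute-cong w (rd (permute (flip w) h) dw⁻¹h≋0))
        where
        dw⁻¹h≋0 : d ⊗ permute (flip w) h ≋ []
        dw⁻¹h≋0 = ≋-trans (≡⇒≋ (≡.trans
          (cong (_⊗ permute (flip w) h) (≡.sym (permute-inverse (flip w) d)))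
          (≡.sym (permute-⊗ (flip w) (permute w d) h))))
          (permute-cong (flip w) wdh≋0)

    permuteFrac : Permutation′ n → Frac → Frac
    permuteFrac w f = frac (permute w (num f)) (permute w (den f)) (permute-regular w (den f) (den-regular f))

    private
      vanishes : ∀ κ δ r → lookup δ r ≢ 0ℤ → ∀ h → ∃ λ B → ∀ N → B ℕ.< N → coeff (ray κ δ N) h ≈ 0#
      vanishes κ δ r δᵣ≢0 []            = 0 , λ _ _ → refl
      vanishes κ δ r δᵣ≢0 ((a , μ) ∷ h) with vanishes κ δ r δᵣ≢0 h
      ... | B , zero-beyond = B₀ ℕ.⊔ B , λ N B<N →
        trans (+-cong (head N (ℕ.≤-<-trans (ℕ.m≤m⊔n B₀ B) B<N))
                      (zero-beyond N (ℕ.≤-<-trans (ℕ.m≤n⊔m B₀ B) B<N)))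
              (+-identityˡ 0#)
        where
        B₀ = ℤ.∣ lookup μ r ℤ.- lookup κ r ∣
        head : ∀ N → B₀ ℕ.< N → (if does (μ ≟ᵉ ray κ δ N) then a else 0#) ≈ 0#
        head N B₀<N with μ ≟ᵉ ray κ δ N
        ... | yes p = contradiction p (ray-escapes κ δ r δᵣ≢0 N μ B₀<N)
        ... | no  _ = refl

    private
      binomial-regular′ : ∀ α β → α ≢ β → ∀ h → (monomial α ++ ⊝ monomial β) ⊗ h ≋ [] → h ≋ []
      binomial-regular′ α β α≢β h bh≋0 = coeffwise λ κ →
        let r , δᵣ≢0 = differ α β α≢β
            B , zero-beyond = vanishes κ δ r δᵣ≢0 h
        in trans (along κ (suc B)) (zero-beyond (suc B) (ℕ.n<1+n B))
        where
        δ : Exponent n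
        δ = α ⊟ β

        open Algebra.Properties.Ring ring using (-1*x≈-x)

        step : ∀ κ → coeff κ h ≈ coeff (κ ⊞ δ) h
        step κ = begin
          u                        ≈⟨ +-identityʳ u ⟨
          u + 0#                   ≈⟨ +-congˡ (-‿inverseˡ v) ⟨
          u + (- v + v)            ≈⟨ +-assoc u (- v) v ⟨
          u + - v + v              ≈⟨ +-congʳ (+-cong (sym u-term) (sym v-term)) ⟩
          1# * coeff (ν ⊟ α) h + (- 1# * coeff (ν ⊟ β) h + 0#) + v
                                   ≈⟨ +-congʳ (+-congˡ (coeff-∷⊗ ν (- 1#) β [] h)) ⟨
          1# * coeff (ν ⊟ α) h + coeff ν ((⊝ monomial β) ⊗ h) + v
                                   ≈⟨ +-congʳ (coeff-∷⊗ ν 1# α (⊝ monomial β) h) ⟨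
          coeff ν ((monomial α ++ ⊝ monomial β) ⊗ h) + v
                                   ≈⟨ +-congʳ (coeff-≈ bh≋0 ν) ⟩
          0# + v                   ≈⟨ +-identityˡ v ⟩
          v                        ∎
          where
          ν = κ ⊞ α
          u = coeff κ h
          v = coeff (κ ⊞ δ) h
          u-term : 1# * coeff (ν ⊟ α) h ≈ u
          u-term = trans (*-identityˡ _) (reflexive (cong (λ μ → coeff μ h)
            (≡.trans (cong (_⊟ α) (⊞-comm κ α)) (⊞⊟-cancel α κ))))
          v-term : - 1# * coeff (ν ⊟ β) h + 0# ≈ - v
          v-term = trans (+-identityʳ _) (trans (-1*x≈-x _)
            (-‿cong (reflexive (cong (λ μ → coeff μ h) (shift-difference κ α β)))))

        along : ∀ κ N → coeff κ h ≈ coeff (ray κ δ N) h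
        along κ zero    = refl
        along κ (suc N) = trans (along κ N) (step (ray κ δ N))

    abstract
      binomial-regular : ∀ α β → α ≢ β → Regular (monomial α ++ ⊝ monomial β)
      binomial-regular = binomial-regular′

    binomial : ∀ α β → α ≢ β → Σ Poly Regular
    binomial α β α≢β = monomial α ++ ⊝ monomial β , binomial-regular α β α≢β

-- Each permutation of Fin n exactly once: insert zero j π sends zero to j and
-- is order-isomorphic to π elsewhere.
allPermutations : ∀ n → List (Permutation′ n)
allPermutations zero    = idₚ ∷ []
allPermutations (suc n) = cartesianProductWith (insert zero) (allFin (suc n)) (allPermutations n)

-- The symmetric group S_n for n = suc m ≥ 1.
module Coxeter (m : ℕ) where
  s : Fin m → Permutation′ (suc m)
  s i = transpose (inject₁ i) (suc i)

  Word : Set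
  Word = List (Fin m)

  -- π ∘ₚ ρ applies π first, so this is s_{i₁} s_{i₂} ⋯ as a product of functions.
  ⟦_⟧ : Word → Permutation′ (suc m)
  ⟦ [] ⟧     = idₚ
  ⟦ i ∷ is ⟧ = ⟦ is ⟧ ∘ₚ s i

  record IsReducedWord (w : Permutation′ (suc m)) (is : Word) : Set where
    field
      spells  : ⟦ is ⟧ ≈ₚ w
      minimal : ∀ js → ⟦ js ⟧ ≈ₚ w → length is ℕ.≤ length js

  -- A choice of a reduced word for every permutation.
  record ReducedWords : Set where
    field
      word    : Permutation′ (suc m) → Word
      reduced : ∀ w → IsReducedWord w (word w)

    ℓ : Permutation′ (suc m) → ℕ
    ℓ w = length (word w)

    IsLongest : Permutation′ (suc m) → Set
    IsLongest w₀ = ∀ w → ℓ w ℕ.≤ ℓ w₀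

CharacteristicZero : ∀ {c ℓ₁ ℓ₂} → HeytingField c ℓ₁ ℓ₂ → Set ℓ₂
CharacteristicZero k = ∀ p → suc p ×₁ 1# # 0#
  where
  open HeytingField k
  open HeytingCommutativeRing heytingCommutativeRing using (commutativeRing)
  open Algebra.Definitions.RawMonoid (CommutativeRing.+-rawMonoid commutativeRing) renaming (_×_ to _×₁_)

-- k plays the role of ℂ, and n = suc m.  In a Heyting field "x # 0#" says that
-- x is invertible; classically it is x ≠ 0.
module Macdonald {c ℓ₁ ℓ₂} (k : HeytingField c ℓ₁ ℓ₂) (m : ℕ) where
  open Coxeter m public

  -- k[q^±1, t½^±1], where the exponent a ∷ b ∷ [] stands for q^a t½^b.
  module k[q,t½] = Laurent {2} (HeytingCommutativeRing.commutativeRing (HeytingField.heytingCommutativeRing k))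

  -- K = k(q, t½)
  module K = CommutativeRing k[q,t½].Frac-commutativeRing

  module K[X] = Laurent {suc m} k[q,t½].Frac-commutativeRing

  module K[X]-Ring = CommutativeRing K[X].Poly-commutativeRing

  -- K(x₁, …, xₙ), in which K[X] embeds by ⟨_⟩ and where the quotients are taken.
  module K⟨X⟩ = CommutativeRing K[X].Frac-commutativeRing

  open K[X] using (Poly; coeff; monomial; constant; binomial; permuteFrac; _÷_) renaming (fromR to ⟨_⟩) public
  open K⟨X⟩ using (_≈_; _+_; _*_; _-_; -_; 0#; 1#) public
  module K-Exp = Algebra.Definitions.RawSemiring (CommutativeSemiring.rawSemiring K.commutativeSemiring)
  module K⟨X⟩-Exp = Algebra.Definitions.RawSemiring (CommutativeSemiring.rawSemiring K⟨X⟩.commutativeSemiring)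

  q^_·t½^_ : ℤ → ℤ → K.Carrier
  q^ a ·t½^ b = k[q,t½].fromR (k[q,t½].monomial (a ∷ b ∷ []))

  t t½ t⁻½ : K.Carrier
  t   = q^ 0ℤ ·t½^ (+ 2)
  t½  = q^ 0ℤ ·t½^ 1ℤ
  t⁻½ = q^ 0ℤ ·t½^ -[1+ 0 ]

  -- Integer powers of x, where y is the inverse of x.
  zpow : (x y : K.Carrier) → ℤ → K.Carrier
  zpow x y (+ a)    = x K-Exp.^ a
  zpow x y -[1+ a ] = y K-Exp.^ suc a

  scalar : K.Carrier → K⟨X⟩.Carrier
  scalar a = ⟨ constant a ⟩

  x^_ : Exponent (suc m) → K⟨X⟩.Carrier
  x^ α = ⟨ monomial α ⟩

  x : Fin (suc m) → K⟨X⟩.Carrier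
  x i = x^ unit i

  -- The positions i and i + 1 exchanged by s i.
  lo hi : Fin m → Fin (suc m)
  lo = inject₁
  hi = suc

  unit-≢ : ∀ {i j : Fin (suc m)} → i ≢ j → unit i ≢ unit j
  unit-≢ {i} {j} i≢j eq with
    ≡.trans (≡.sym (Vec.lookup∘update i 𝟎 1ℤ))
      (≡.trans (cong (λ α → lookup α i) eq)
        (≡.trans (Vec.lookup∘update′ i≢j 𝟎 1ℤ) (Vec.lookup-replicate i 0ℤ)))
  ... | ()

  lo≢hi : ∀ i → lo i ≢ hi i
  lo≢hi i eq = ℕ.<⇒≢ (ℕ.n<1+n (toℕ i)) (≡.trans (≡.sym (Fin.toℕ-inject₁ i)) (cong toℕ eq))

  𝟎≢ratio : ∀ i → 𝟎 ≢ unit (hi i) ⊟ unit (lo i)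
  𝟎≢ratio i eq with
    ≡.trans (≡.sym (Vec.lookup-replicate (lo i) 0ℤ))
      (≡.trans (cong (λ α → lookup α (lo i)) eq)
        (≡.trans (Vec.lookup-zipWith ℤ._-_ (lo i) (unit (hi i)) (unit (lo i)))
          (cong₂ ℤ._-_
            (≡.trans (Vec.lookup∘update′ (lo≢hi i) 𝟎 1ℤ) (Vec.lookup-replicate (lo i) 0ℤ))
            (Vec.lookup∘update (lo i) 𝟎 1ℤ))))
  ... | ()

  𝟎≢a : ∀ {y z} e → z ℤ.< y → 𝟎 ≢ (y ℤ.- z) ∷ e ∷ []
  𝟎≢a {y} {z} e z<y eq = ℤ.<⇒≢ z<y (≡.sym (ℤ.i-j≡0⇒i≡j y z (≡.sym (cong Vec.head eq))))

  ∂ : Fin m → K⟨X⟩.Carrier → K⟨X⟩.Carrier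
  ∂ i f = (f - permuteFrac (s i) f) ÷ binomial (unit (lo i)) (unit (hi i)) (unit-≢ (lo≢hi i))

  ∑_ : (Permutation′ (suc m) → K⟨X⟩.Carrier) → K⟨X⟩.Carrier
  ∑ F = foldr _+_ 0# (List.map F (allPermutations (suc m)))

  ∏< : ((i j : Fin (suc m)) → i < j → K⟨X⟩.Carrier) → K⟨X⟩.Carrier
  ∏< F = K⟨X⟩-Exp.product λ i → K⟨X⟩-Exp.product (factor i)
    where
    factor : (i j : Fin (suc m)) → K⟨X⟩.Carrier
    factor i j with i <? j
    ... | yes i<j = F i j i<j
    ... | no  _   = 1#

  infixl 7 _÷[x_-x_]_
  _÷[x_-x_]_ : K⟨X⟩.Carrier → (i j : Fin (suc m)) → i < j → K⟨X⟩.Carrier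
  f ÷[x i -x j ] i<j = f ÷ binomial (unit i) (unit j) (unit-≢ (Fin.<⇒≢ i<j))

  -- v_μ(r) for the minimal length v_μ with v_μ μ weakly increasing.
  v : Exponent (suc m) → Fin (suc m) → ℕ
  v μ r = 1 ℕ.+ length (filter (λ r′ → (r′ <? r) ×-dec (lookup μ r′ ℤ.≤? lookup μ r)) (allFin (suc m)))
            ℕ.+ length (filter (λ r′ → (r <? r′) ×-dec (lookup μ r′ ℤ.<? lookup μ r)) (allFin (suc m)))

  rotate : Exponent (suc m) → Exponent (suc m)
  rotate μ = last μ ∷ init μ

  -- f(x₁, …, xₙ) ↦ f(x₂, …, xₙ, q⁻¹x₁), where x^ν goes to x₂^ν₁ ⋯ xₙ^νₙ₋₁ (q⁻¹x₁)^νₙ.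
  cycle : Poly → Poly
  cycle = List.map λ (a , ν) → a K.* q^ (ℤ.- last ν) ·t½^ 0ℤ , rotate ν

  record IsElectronic (E : Exponent (suc m) → Poly) : Set (c ⊔ ℓ₁) where
    field
      E0 : E 𝟎 K[X].≋ K[X]-Ring.1#
      E1 : ∀ μ → E (rotate μ ⊞ unit zero) K[X].≋
                 constant (q^ last μ ·t½^ 0ℤ) K[X].⊗ monomial (unit zero) K[X].⊗ cycle (E μ)
      E2 : ∀ μ → (∀ j → 0ℤ ℤ.≤ lookup μ j) → ∀ i (gt : lookup μ (hi i) ℤ.< lookup μ (lo i)) →
           let d = lookup μ (lo i) ℤ.- lookup μ (hi i)
               e = + 2 ℤ.* (+ v μ (lo i) ℤ.- + v μ (hi i))
               a = q^ d ·t½^ e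
           in ⟨ E (permuteExponent (s i) μ) ⟩ ≈
                ∂ i (x (lo i) * ⟨ E μ ⟩)
                - scalar t * x (lo i) * ∂ i ⟨ E μ ⟩
                + scalar ((K.1# K.- t) K.* a k[q,t½].÷ k[q,t½].binomial 𝟎 (d ∷ e ∷ []) (𝟎≢a e gt)) * ⟨ E μ ⟩
      E3 : ∀ μ → E (μ ⊟ replicate (suc m) 1ℤ) K[X].≋ monomial (𝟎 ⊟ replicate (suc m) 1ℤ) K[X].⊗ E μ

  -- The Hecke operators, given on all of K(X) by the formula that defines them on K[X].
  T : Fin m → K⟨X⟩.Carrier → K⟨X⟩.Carrier
  T i f = - scalar t⁻½ * f + (g + permuteFrac (s i) g)
    where
    x⁻¹x = unit (hi i) ⊟ unit (lo i)
    g = (scalar t⁻½ - scalar t½ * x^ x⁻¹x) ÷ binomial 𝟎 x⁻¹x (𝟎≢ratio i) * f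

  ρ : Exponent (suc m)
  ρ = tabulate λ i → + (m ∸ toℕ i)

  Dominant : Exponent (suc m) → Set
  Dominant μ = ∀ i → lookup μ (hi i) ℤ.≤ lookup μ (lo i)

  module _ (E : Exponent (suc m) → Poly) where
    P : (W⁻¹ : K.Carrier) → Exponent (suc m) → K⟨X⟩.Carrier
    P W⁻¹ μ = scalar W⁻¹ * ∑ λ w → permuteFrac w
      (⟨ E μ ⟩ * ∏< λ i j i<j → (x i - scalar t * x j) ÷[x i -x j ] i<j)

    -- W is invertible and, with P divided by W, P is a Laurent polynomial p whose
    -- coefficient of x^μ is 1.
    record IsNormalizing (μ : Exponent (suc m)) (W : K.Carrier) : Set (c ⊔ ℓ₁) where
      field
        W⁻¹      : K.Carrier
        inverse  : W K.* W⁻¹ K.≈ K.1#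
        p        : Poly
        P≈p      : P W⁻¹ μ ≈ ⟨ p ⟩
        leading  : coeff μ p K.≈ K.1#

  module _ (words : ReducedWords) where
    open ReducedWords words

    -- The argument μ is λ + ρ.
    A : (Exponent (suc m) → Poly) → Exponent (suc m) → K⟨X⟩.Carrier
    A E μ = (∏< λ i j i<j → (x j - scalar t * x i) ÷[x i -x j ] i<j)
          * ∑ λ w → scalar ((K.- K.1#) K-Exp.^ ℓ w) * permuteFrac w ⟨ E μ ⟩

    Tʷ : Permutation′ (suc m) → K⟨X⟩.Carrier → K⟨X⟩.Carrier
    Tʷ w f = foldr T f (word w)

    module _ (w₀ : Permutation′ (suc m)) where
      𝟏₀ ε₀ : K⟨X⟩.Carrier → K⟨X⟩.Carrier
      𝟏₀ f = ∑ λ w → scalar (zpow t½ t⁻½ (+ ℓ w ℤ.- + ℓ w₀)) * Tʷ w f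
      ε₀ f = ∑ λ w → scalar (zpow (K.- t⁻½) (K.- t½) (+ ℓ w ℤ.- + ℓ w₀)) * Tʷ w f

      -- t^{ℓ(w₀)/2}
      t^½ℓ : K.Carrier
      t^½ℓ = t½ K-Exp.^ ℓ w₀

{-# OPTIONS --safe #-}
module Submission where

-- The operators τ_i = t½ T_i act on K(X) as
--   τ_i = α_{i,i+1} + (1 + α_{i+1,i}) s_i   with   α_{ab} = (1 − t) x_b / (x_a − x_b).
-- The two relations α_{ab} + α_{ba} = t − 1 and
-- α_{ab} α_{bc} = α_{ac} (1 − t + α_{ab} + α_{bc}) give the braid relations, so that T
-- along a reduced word of w depends only on w.  Writing w = c_j (1 × w′) with
-- c_j = s_{j-1} ⋯ s₁ s₀ and w′ ∈ S_{n-1}, a partial fraction expansion and induction on n give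
--   ∑_w t^{ℓ(w)/2} T_w = ∑_w w ∏_{i<j} (1 + α_{ij}),
-- the bosonic identity.  The fermionic one is the same identity for t⁻¹ and −s_i in place
-- of t and s_i, conjugated by ∏_{i<j} (x_i − t⁻¹ x_j) / (x_i − x_j).
--
-- That P_Λ can be normalised is seen at t½ = 1: there (E0)–(E3) give E_μ = x^μ and τ_i = s_i,
-- so the coefficient of x^Λ before normalisation specialises to the order of the stabiliser
-- of Λ.  As this is not 0 in characteristic 0, the coefficient is invertible in K.

open import Algebra.Apartness.Bundles using (HeytingField; HeytingCommutativeRing)
open import Algebra.Bundles using (CommutativeMonoid; CommutativeRing; RawRing)
import Algebra.Definitions.RawMonoid
import Algebra.Properties.CommutativeMonoid.Sum
import Algebra.Properties.CommutativeSemigroup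
import Algebra.Properties.CommutativeSemiring.Exp
import Algebra.Properties.Ring
import Algebra.Properties.Semiring.Exp
import Algebra.Properties.Semiring.Mult
import Algebra.Properties.Semiring.Sum
import Algebra.Solver.Ring
open import Algebra.Solver.Ring.AlmostCommutativeRing using (fromCommutativeRing; _-Raw-AlmostCommutative⟶_)
open import Data.Bool.Base using (true; false; if_then_else_)
open import Data.Fin.Base using (Fin; zero; suc; toℕ; inject₁; fromℕ; punchIn; _<_)
open import Data.Fin.Permutation
  using (Permutation′; _⟨$⟩ʳ_; _⟨$⟩ˡ_; _∘ₚ_; flip; insert; insert-punchIn; inverseʳ; inverseˡ)
  renaming (_≈_ to _≈ₚ_; id to idₚ)
import Data.Fin.Properties as Fin
open import Data.Integer.Base as ℤ using (ℤ; +_; -[1+_]; 0ℤ; 1ℤ)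
import Data.Integer.Properties as ℤ
open import Data.List.Base as List using (List; []; _∷_; _++_; foldr; length; cartesianProductWith)
import Data.List.Properties as List
open import Data.List.Relation.Unary.All as All using (All; []; _∷_)
import Data.List.Relation.Unary.All.Properties as All
open import Data.Maybe.Base using (Maybe; just; nothing)
open import Data.Nat.Base as ℕ using (ℕ; zero; suc; z≤n; s≤s)
import Data.Nat.Properties as ℕ
open import Data.Product.Base using (∃; _×_; _,_; proj₁; proj₂)
open import Data.Sum.Base using (_⊎_; inj₁; inj₂)
open import Data.Vec.Base as Vec using (Vec; []; _∷_; lookup; replicate; last)
import Data.Vec.Properties as Vec
open import Function.Base using (_∘_)
open import Level as Level using (0ℓ; _⊔_)
open import Relation.Binary.Bundles using (Setoid)
open import Relation.Binary.PropositionalEquality as ≡ using (_≡_; _≢_; cong; cong₂)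
import Relation.Binary.Reasoning.Setoid as SetoidReasoning
open import Relation.Nullary using (¬_; Dec; yes; no; does; contradiction)
open import Defs

-- Equality in `k`, and hence in K, is not assumed decidable, so a coefficient cannot be inverted
-- just for being different from 0: a regular numerator has to be exhibited. This is why the
-- specialisation at t½ = 1 keeps track of denominators. Statements at t½ = 1 are congruences modulo
-- (1 - t½) `L`, where `L` consists of Laurent polynomials whose scalars have a denominator that
-- stays regular there. Three facts make this possible: divided differences preserve `L`, the
-- denominators 1 - q^d t^e of (E2) become 1 - q^d with d > 0, and the correction terms carry the
-- factor 1 - t.
--
-- The symmetrizer is proved for two actions at once: `s` acts on coefficients by ring
-- automorphisms, while `σ` acts on arguments and may carry signs. Both cases are then instances of
-- one induction, in which only the two relations between the α's enter.
--
-- The reduced words are an arbitrary choice. Reading such a word from the right, every letter has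
-- to lengthen the code, so no quadratic relation ever occurs and the braid relations suffice.

-- The library's ring solver with coefficients in ℤ, where (a , b) stands for a − b;
-- the solver compares normal forms syntactically, so differences are kept reduced.
module IntegerRingSolver {c ℓ} (R : CommutativeRing c ℓ) where
  open CommutativeRing R hiding (zero)
  open Algebra.Properties.Ring ring using (-‿distribˡ-*; -‿distribʳ-*; -‿involutive; -0#≈0#; -‿+-comm)
  open Algebra.Properties.Semiring.Mult semiring using (×1-homo-*; ×-homo-+) renaming (_×_ to _×′_)
  open Algebra.Properties.CommutativeSemigroup (CommutativeRing.+-commutativeSemigroup R) using (interchange)
  open SetoidReasoning setoid

  private
    reduce : ℕ × ℕ → ℕ × ℕ
    reduce (suc a , suc b) = reduce (a , b)
    reduce (zero  , b)     = zero , b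
    reduce (suc a , zero)  = suc a , zero

    coefficients : RawRing 0ℓ 0ℓ
    coefficients = record
      { Carrier = ℕ × ℕ
      ; _≈_ = _≡_
      ; _+_ = λ (a , b) (c , d) → reduce (a ℕ.+ c , b ℕ.+ d)
      ; _*_ = λ (a , b) (c , d) → reduce (a ℕ.* c ℕ.+ b ℕ.* d , a ℕ.* d ℕ.+ b ℕ.* c)
      ; -_ = λ (a , b) → b , a
      ; 0# = 0 , 0
      ; 1# = 1 , 0
      }

    ι : ℕ → Carrier
    ι n = n ×′ 1#

    ι-+ : ∀ a b → ι (a ℕ.+ b) ≈ ι a + ι b
    ι-+ = ×-homo-+ 1#

    -- ⟦ 1 , 0 ⟧ᶜ must be 1# on the nose for 𝟙 to denote 1#.
    ⟦_⟧ᶜ : ℕ × ℕ → Carrier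
    ⟦ 1 , 0 ⟧ᶜ = 1#
    ⟦ a , b ⟧ᶜ = ι a - ι b

    ⟦⟧ᶜ-difference : ∀ a b → ⟦ a , b ⟧ᶜ ≈ ι a - ι b
    ⟦⟧ᶜ-difference 0             b       = refl
    ⟦⟧ᶜ-difference 1             0       = sym (trans (+-congˡ -0#≈0#) (trans (+-identityʳ _) (+-identityʳ 1#)))
    ⟦⟧ᶜ-difference 1             (suc b) = refl
    ⟦⟧ᶜ-difference (suc (suc a)) b       = refl

    minus-sum : ∀ a b c d → (a + c) - (b + d) ≈ (a - b) + (c - d)
    minus-sum a b c d = trans (+-congˡ (sym (-‿+-comm b d))) (interchange a c (- b) (- d))

    ⟦reduce⟧ᶜ : ∀ a b → ⟦ reduce (a , b) ⟧ᶜ ≈ ι a - ι b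
    ⟦reduce⟧ᶜ (suc a) (suc b) = trans (⟦reduce⟧ᶜ a b) (sym (trans (minus-sum 1# 1# (ι a) (ι b))
      (trans (+-congʳ (-‿inverseʳ 1#)) (+-identityˡ _))))
    ⟦reduce⟧ᶜ zero    b       = ⟦⟧ᶜ-difference 0 b
    ⟦reduce⟧ᶜ (suc a) zero    = ⟦⟧ᶜ-difference (suc a) 0

    product : ∀ a b c d → (a * c + b * d) - (a * d + b * c) ≈ (a - b) * (c - d)
    product a b c d = begin
      (a * c + b * d) - (a * d + b * c)            ≈⟨ minus-sum (a * c) (a * d) (b * d) (b * c) ⟩
      (a * c - a * d) + (b * d - b * c)            ≈⟨ +-cong (+-congˡ (-‿distribʳ-* a d)) (+-comm _ _) ⟩
      (a * c + a * - d) + (- (b * c) + b * d)      ≈⟨ +-cong (sym (distribˡ a c (- d))) (+-cong (-‿distribˡ-* b c) flip-sign) ⟩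
      a * (c - d) + (- b * c + - b * - d)          ≈⟨ +-congˡ (distribˡ (- b) c (- d)) ⟨
      a * (c - d) + - b * (c - d)                  ≈⟨ distribʳ (c - d) a (- b) ⟨
      (a - b) * (c - d)                            ∎
      where
      flip-sign : b * d ≈ - b * - d
      flip-sign = begin
        b * d          ≈⟨ -‿involutive _ ⟨
        - - (b * d)    ≈⟨ -‿cong (-‿distribʳ-* b d) ⟩
        - (b * - d)    ≈⟨ -‿distribˡ-* b (- d) ⟩
        - b * - d      ∎

    ring-morphism : coefficients -Raw-AlmostCommutative⟶ fromCommutativeRing R
    ring-morphism = record
      { ⟦_⟧    = ⟦_⟧ᶜ
      ; +-homo = λ (a , b) (c , d) → trans (⟦reduce⟧ᶜ (a ℕ.+ c) (b ℕ.+ d))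
          (trans (trans (+-cong (ι-+ a c) (-‿cong (ι-+ b d))) (minus-sum (ι a) (ι b) (ι c) (ι d)))
                 (sym (+-cong (⟦⟧ᶜ-difference a b) (⟦⟧ᶜ-difference c d))))
      ; *-homo = λ (a , b) (c , d) → trans (⟦reduce⟧ᶜ (a ℕ.* c ℕ.+ b ℕ.* d) (a ℕ.* d ℕ.+ b ℕ.* c))
          (trans (trans (+-cong (trans (ι-+ (a ℕ.* c) (b ℕ.* d)) (+-cong (×1-homo-* a c) (×1-homo-* b d)))
                        (-‿cong (trans (ι-+ (a ℕ.* d) (b ℕ.* c)) (+-cong (×1-homo-* a d) (×1-homo-* b c)))))
                (product (ι a) (ι b) (ι c) (ι d)))
                (sym (*-cong (⟦⟧ᶜ-difference a b) (⟦⟧ᶜ-difference c d))))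
      ; -‿homo = λ (a , b) → trans (⟦⟧ᶜ-difference b a) (trans (+-comm (ι b) (- ι a))
          (trans (+-congˡ (sym (-‿involutive (ι b)))) (trans (-‿+-comm (ι a) (- ι b))
          (-‿cong (sym (⟦⟧ᶜ-difference a b))))))
      ; 0-homo = -‿inverseʳ 0#
      ; 1-homo = refl
      }

    weakly-decide : ∀ x y → Maybe (⟦ x ⟧ᶜ ≈ ⟦ y ⟧ᶜ)
    weakly-decide (a , b) (c , d) with a ℕ.+ d ℕ.≟ c ℕ.+ b
    ... | no  _  = nothing
    ... | yes eq = just (begin
      ⟦ a , b ⟧ᶜ                       ≈⟨ ⟦⟧ᶜ-difference a b ⟩
      ι a - ι b                        ≈⟨ +-identityʳ _ ⟨
      ι a - ι b + 0#                   ≈⟨ +-congˡ (-‿inverseʳ (ι d)) ⟨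
      (ι a - ι b) + (ι d - ι d)        ≈⟨ minus-sum (ι a) (ι b) (ι d) (ι d) ⟨
      (ι a + ι d) - (ι b + ι d)        ≈⟨ +-cong a+d≈c+b (-‿cong (+-comm (ι b) (ι d))) ⟩
      (ι c + ι b) - (ι d + ι b)        ≈⟨ minus-sum (ι c) (ι d) (ι b) (ι b) ⟩
      (ι c - ι d) + (ι b - ι b)        ≈⟨ +-congˡ (-‿inverseʳ (ι b)) ⟩
      ι c - ι d + 0#                   ≈⟨ +-identityʳ _ ⟩
      ι c - ι d                        ≈⟨ ⟦⟧ᶜ-difference c d ⟨
      ⟦ c , d ⟧ᶜ                       ∎)
      where
      a+d≈c+b : ι a + ι d ≈ ι c + ι b
      a+d≈c+b = trans (sym (ι-+ a d)) (trans (reflexive (cong ι eq)) (ι-+ c b))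

  open Algebra.Solver.Ring coefficients (fromCommutativeRing R) ring-morphism weakly-decide public
    using (Polynomial; solve; _:=_; _:+_; _:*_; _:-_; :-_; con)

  𝟙 : ∀ {n} → Polynomial n
  𝟙 = con (1 , 0)

-- Normal forms for permutations

-- The element c_j · (1 × w′) of S_{m+1} is coded by j and the code of w′ ∈ S_m.
data Code : ℕ → Set where
  []  : Code zero
  _∷_ : ∀ {m} → Fin (suc (suc m)) → Code m → Code (suc m)

len : ∀ {m} → Code m → ℕ
len []      = 0
len (j ∷ c) = toℕ j ℕ.+ len c

identity : ∀ m → Code m
identity zero    = []
identity (suc m) = zero ∷ identity m

longest : ∀ m → Code m
longest zero    = []
longest (suc m) = fromℕ (suc m) ∷ longest m

len≤longest : ∀ {m} (c : Code m) → len c ℕ.≤ len (longest m)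
len≤longest []      = z≤n
len≤longest (j ∷ c) = ℕ.+-mono-≤ (Fin.≤fromℕ j) (len≤longest c)

len-identity : ∀ m → len (identity m) ≡ 0
len-identity zero    = ≡.refl
len-identity (suc m) = len-identity m

-- How s_i meets c_j: s_i c_j is c_{j+1}, c_{j-1}, c_j s_i (j < i) or c_j s_{i+1} (i + 1 < j).
data Position : ∀ {m} → Fin (suc m) → Fin (suc (suc m)) → Set where
  ascent  : ∀ {m} (i : Fin (suc m)) → Position i (inject₁ i)
  descent : ∀ {m} (i : Fin (suc m)) → Position i (suc i)
  above   : ∀ {m} (i : Fin m) j → toℕ j ℕ.≤ toℕ i → Position (suc i) j
  below   : ∀ {m} (i : Fin m) j → suc (toℕ i) ℕ.< toℕ j → Position (inject₁ i) j

position : ∀ {m} (i : Fin (suc m)) j → Position i j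
position           zero    zero          = ascent zero
position           zero    (suc zero)    = descent zero
position {suc m}   zero    (suc (suc j)) = below zero (suc (suc j)) (s≤s (s≤s z≤n))
position           (suc i) zero          = above i zero z≤n
position {suc m}   (suc i) (suc j) with position i j
... | ascent  i     = ascent (suc i)
... | descent i     = descent (suc i)
... | above i′ j p  = above (suc i′) (suc j) (s≤s p)
... | below i′ j p  = below (suc i′) (suc j) (s≤s p)

act : ∀ {m} → Fin m → Code m → Code m
act {suc m} i (j ∷ c) with position i j
... | ascent  i    = suc i ∷ c
... | descent i    = inject₁ i ∷ c
... | above i′ j _ = j ∷ act i′ c
... | below i′ j _ = j ∷ act i′ c

len-act : ∀ {m} (i : Fin m) c → len (act i c) ≡ suc (len c) ⊎ suc (len (act i c)) ≡ len c
len-act {suc m} i (j ∷ c) with position i j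
... | ascent  i = inj₁ (cong (λ k → suc k ℕ.+ len c) (≡.sym (Fin.toℕ-inject₁ i)))
... | descent i = inj₂ (cong (λ k → suc k ℕ.+ len c) (Fin.toℕ-inject₁ i))
... | above i′ j _ with len-act i′ c
...   | inj₁ up   = inj₁ (≡.trans (cong (toℕ j ℕ.+_) up) (ℕ.+-suc (toℕ j) (len c)))
...   | inj₂ down = inj₂ (≡.trans (≡.sym (ℕ.+-suc (toℕ j) _)) (cong (toℕ j ℕ.+_) down))
len-act {suc m} _ (j ∷ c) | below i′ j _ with len-act i′ c
...   | inj₁ up   = inj₁ (≡.trans (cong (toℕ j ℕ.+_) up) (ℕ.+-suc (toℕ j) (len c)))
...   | inj₂ down = inj₂ (≡.trans (≡.sym (ℕ.+-suc (toℕ j) _)) (cong (toℕ j ℕ.+_) down))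

fromWord : ∀ {m} → List (Fin m) → Code m
fromWord {m} = foldr act (identity m)

len-act≤ : ∀ {m} (i : Fin m) c → len (act i c) ℕ.≤ suc (len c)
len-act≤ i c with len-act i c
... | inj₁ up   = ℕ.≤-reflexive up
... | inj₂ down = ℕ.≤-trans (ℕ.n≤1+n _) (ℕ.≤-trans (ℕ.≤-reflexive down) (ℕ.n≤1+n _))

len-fromWord : ∀ {m} (is : List (Fin m)) → len (fromWord is) ℕ.≤ length is
len-fromWord {m} []       = ℕ.≤-reflexive (len-identity m)
len-fromWord     (i ∷ is) = ℕ.≤-trans (len-act≤ i (fromWord is)) (s≤s (len-fromWord is))

-- The word of c_j, with c_j = s_{j-1} ⋯ s₁ s₀. Through it each code is spelled by a word of length
-- `len`, the competitor against which the given reduced words are measured.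
pathWord : ∀ {m} → Fin (suc m) → List (Fin m)
pathWord {zero}  _       = []
pathWord {suc m} zero    = []
pathWord {suc m} (suc j) = List.map suc (pathWord j) List.++ zero ∷ []

toWord : ∀ {m} → Code m → List (Fin m)
toWord []      = []
toWord (j ∷ c) = pathWord j List.++ List.map suc (toWord c)

length-pathWord : ∀ {m} (j : Fin (suc m)) → length (pathWord j) ≡ toℕ j
length-pathWord {zero}  zero    = ≡.refl
length-pathWord {suc m} zero    = ≡.refl
length-pathWord {suc m} (suc j) = begin
  length (List.map suc (pathWord j) List.++ zero ∷ [])  ≡⟨ List.length-++ (List.map suc (pathWord j)) ⟩
  length (List.map suc (pathWord j)) ℕ.+ 1              ≡⟨ ℕ.+-comm _ 1 ⟩
  suc (length (List.map suc (pathWord j)))              ≡⟨ cong suc (List.length-map suc (pathWord j)) ⟩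
  suc (length (pathWord j))                             ≡⟨ cong suc (length-pathWord j) ⟩
  suc (toℕ j)                                           ∎
  where
  open ≡.≡-Reasoning

length-toWord : ∀ {m} (c : Code m) → length (toWord c) ≡ len c
length-toWord []      = ≡.refl
length-toWord (j ∷ c) = ≡.trans (List.length-++ (pathWord j))
  (cong₂ ℕ._+_ (length-pathWord j) (≡.trans (List.length-map suc (toWord c)) (length-toWord c)))

-- Operators indexed by codes and by words

module Operators {a ℓ} (S : Setoid a ℓ) where
  open Setoid S renaming (Carrier to C)
  open SetoidReasoning S

  -- The relations shared by the s_i and by the Hecke-type operators. Involutivity is kept apart as
  -- `Involutive`, since the latter satisfy another quadratic relation.
  record Braided {m} (τ : Fin m → C → C) : Set (a ⊔ ℓ) where
    field
      τ-cong  : ∀ i {f g} → f ≈ g → τ i f ≈ τ i g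
      commute : ∀ i j → suc (toℕ i) ℕ.< toℕ j → ∀ f → τ i (τ j f) ≈ τ j (τ i f)
      braid   : ∀ i j → toℕ j ≡ suc (toℕ i) → ∀ f → τ i (τ j (τ i f)) ≈ τ j (τ i (τ j f))
  open Braided

  Braided-suc : ∀ {m} {τ : Fin (suc m) → C → C} → Braided τ → Braided (τ ∘ suc)
  Braided-suc B = record
    { τ-cong  = τ-cong B ∘ suc
    ; commute = λ i j p → commute B (suc i) (suc j) (s≤s p)
    ; braid   = λ i j p → braid B (suc i) (suc j) (cong suc p)
    }

  path : ∀ {m} → (Fin m → C → C) → Fin (suc m) → C → C
  path {zero}  τ _       f = f
  path {suc m} τ zero    f = f
  path {suc m} τ (suc j) f = path (τ ∘ suc) j (τ zero f)

  op : ∀ {m} → (Fin m → C → C) → Code m → C → C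
  op τ []      f = f
  op τ (j ∷ c) f = path τ j (op (τ ∘ suc) c f)

  op-identity : ∀ {m} (τ : Fin m → C → C) f → op τ (identity m) f ≡ f
  op-identity {zero}  τ f = ≡.refl
  op-identity {suc m} τ f = op-identity (τ ∘ suc) f

  path-cong : ∀ {m} {τ : Fin m → C → C} → (∀ i {f g} → f ≈ g → τ i f ≈ τ i g) →
              ∀ j {f g} → f ≈ g → path τ j f ≈ path τ j g
  path-cong {zero}  τ-cong _       p = p
  path-cong {suc m} τ-cong zero    p = p
  path-cong {suc m} τ-cong (suc j) p = path-cong (τ-cong ∘ suc) j (τ-cong zero p)

  op-cong : ∀ {m} {τ : Fin m → C → C} → (∀ i {f g} → f ≈ g → τ i f ≈ τ i g) →
            ∀ c {f g} → f ≈ g → op τ c f ≈ op τ c g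
  op-cong τ-cong []      p = p
  op-cong τ-cong (j ∷ c) p = path-cong τ-cong j (op-cong (τ-cong ∘ suc) c p)

  path-ascent : ∀ {m} (τ : Fin (suc m) → C → C) i f → τ i (path τ (inject₁ i) f) ≡ path τ (suc i) f
  path-ascent {zero}  τ zero    f = ≡.refl
  path-ascent {suc m} τ zero    f = ≡.refl
  path-ascent {suc m} τ (suc i) f = path-ascent (τ ∘ suc) i (τ zero f)

  -- All factors of c_j have index below that of `i`, hence at distance at least two from `suc i`,
  -- and commute with it.
  path-above : ∀ {m} {τ : Fin (suc m) → C → C} → Braided τ → ∀ (i : Fin m) j → toℕ j ℕ.≤ toℕ i → ∀ f →
               τ (suc i) (path τ j f) ≈ path τ j (τ (suc i) f)
  path-above {suc m} B i       zero    _       f = refl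
  path-above {suc m} {τ} B (suc i) (suc j) (s≤s p) f =
    trans (path-above (Braided-suc B) i j p (τ zero f))
          (path-cong (τ-cong B ∘ suc) j (sym (commute B zero (suc (suc i)) (s≤s (s≤s z≤n)) f)))

  path-intertwine : ∀ {m} {φ : C → C} {τ υ : Fin m → C → C} → (∀ i {f g} → f ≈ g → υ i f ≈ υ i g) →
                    (∀ i f → φ (τ i f) ≈ υ i (φ f)) → ∀ j f → φ (path τ j f) ≈ path υ j (φ f)
  path-intertwine {zero}          υ-cong φ-τ _       f = refl
  path-intertwine {suc m}         υ-cong φ-τ zero    f = refl
  path-intertwine {suc m} {φ} {τ} υ-cong φ-τ (suc j) f =
    trans (path-intertwine (υ-cong ∘ suc) (φ-τ ∘ suc) j (τ zero f))
          (path-cong (υ-cong ∘ suc) j (φ-τ zero f))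

  -- Used for multiplication by an invariant element, which commutes with the operators, and for
  -- multiplication by `Δ⁻`, which conjugates one family into another.
  op-intertwine : ∀ {m} {φ : C → C} {τ υ : Fin m → C → C} → (∀ i {f g} → f ≈ g → υ i f ≈ υ i g) →
                  (∀ i f → φ (τ i f) ≈ υ i (φ f)) → ∀ c f → φ (op τ c f) ≈ op υ c (φ f)
  op-intertwine υ-cong φ-τ []      f = refl
  op-intertwine υ-cong φ-τ (j ∷ c) f = trans (path-intertwine υ-cong φ-τ j _)
    (path-cong υ-cong j (op-intertwine (υ-cong ∘ suc) (φ-τ ∘ suc) c f))

  -- For `i` zero, s₀ slides past all factors of the path except the last two, where s₀ s₁ s₀ = s₁
  -- s₀ s₁ leaves an s₁ on the right. Otherwise the factor s₀ at the end of the path commutes with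
  -- the operator that comes out of the induction.
  path-below : ∀ {m} {τ : Fin (suc m) → C → C} → Braided τ → ∀ (i : Fin m) j → suc (toℕ i) ℕ.< toℕ j → ∀ f →
               τ (inject₁ i) (path τ j f) ≈ path τ j (τ (suc i) f)
  path-below {suc m} {τ} B zero    (suc zero)    (s≤s ()) f
  path-below {suc m} {τ} B zero    (suc (suc j)) _       f = begin
    τ zero (path (λ k → τ (suc (suc k))) j (τ (suc zero) (τ zero f)))
      ≈⟨ path-intertwine (λ k → τ-cong B (suc (suc k))) (λ i → commute B zero (suc (suc i)) (s≤s (s≤s z≤n))) j _ ⟩
    path (λ k → τ (suc (suc k))) j (τ zero (τ (suc zero) (τ zero f)))
      ≈⟨ path-cong (λ k → τ-cong B (suc (suc k))) j (braid B zero (suc zero) ≡.refl f) ⟩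
    path (λ k → τ (suc (suc k))) j (τ (suc zero) (τ zero (τ (suc zero) f))) ∎
  path-below {suc m} {τ} B (suc i) (suc j) (s≤s p) f =
    trans (path-below (Braided-suc B) i j p (τ zero f))
          (path-cong (τ-cong B ∘ suc) j (sym (commute B zero (suc (suc i)) (s≤s (s≤s z≤n)) f)))

  -- Where the length goes up, no product s_i s_i has to be cancelled, so the braid relations alone
  -- do it.
  op-ascend : ∀ {m} {τ : Fin m → C → C} → Braided τ → ∀ i c → len (act i c) ≡ suc (len c) → ∀ f →
              τ i (op τ c f) ≈ op τ (act i c) f
  op-ascend {suc m} {τ} B i (j ∷ c) up f with position i j
  ... | ascent  i = reflexive (path-ascent τ i _)
  ... | descent i = contradiction (ℕ.<-≤-trans (ℕ.n<1+n _) (ℕ.≤-reflexive (≡.sym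
    (≡.trans (≡.sym (cong (ℕ._+ len c) (Fin.toℕ-inject₁ i))) up)))) (ℕ.<-asym (ℕ.n<1+n _))
  ... | above i′ j p = trans (path-above B i′ j p _) (path-cong (τ-cong B) j
    (op-ascend (Braided-suc B) i′ c
      (ℕ.+-cancelˡ-≡ (toℕ j) _ _ (≡.trans up (≡.sym (ℕ.+-suc (toℕ j) (len c))))) f))
  ... | below i′ j p = trans (path-below B i′ j p _) (path-cong (τ-cong B) j
    (op-ascend (Braided-suc B) i′ c
      (ℕ.+-cancelˡ-≡ (toℕ j) _ _ (≡.trans up (≡.sym (ℕ.+-suc (toℕ j) (len c))))) f))

  Involutive : ∀ {m} → (Fin m → C → C) → Set (a ⊔ ℓ)
  Involutive τ = ∀ i f → τ i (τ i f) ≈ f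

  path-descent : ∀ {m} {τ : Fin (suc m) → C → C} → (∀ i {f g} → f ≈ g → τ i f ≈ τ i g) → Involutive τ →
                 ∀ i f → τ i (path τ (suc i) f) ≈ path τ (inject₁ i) f
  path-descent {_} {τ} cong inv i f = trans (cong i (reflexive (≡.sym (path-ascent τ i f)))) (inv i _)

  -- Meant for the permutations themselves: s_i s_i = 1 covers the descents that `op-ascend`
  -- excludes.
  op-act : ∀ {m} {τ : Fin m → C → C} → Braided τ → Involutive τ → ∀ i c f →
           τ i (op τ c f) ≈ op τ (act i c) f
  op-act {suc m} {τ} B inv i (j ∷ c) f with position i j
  ... | ascent  i = reflexive (path-ascent τ i _)
  ... | descent i = path-descent (τ-cong B) inv i _
  ... | above i′ j p = trans (path-above B i′ j p _)
    (path-cong (τ-cong B) j (op-act (Braided-suc B) (inv ∘ suc) i′ c f))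
  ... | below i′ j p = trans (path-below B i′ j p _)
    (path-cong (τ-cong B) j (op-act (Braided-suc B) (inv ∘ suc) i′ c f))

  op-fromWord : ∀ {m} {τ : Fin m → C → C} → Braided τ → Involutive τ → ∀ is f →
                foldr τ f is ≈ op τ (fromWord is) f
  op-fromWord {_} {τ} B inv []       f = reflexive (≡.sym (op-identity τ f))
  op-fromWord {_} {τ} B inv (i ∷ is) f =
    trans (τ-cong B i (op-fromWord B inv is f)) (op-act B inv i (fromWord is) f)

  -- Matsumoto's theorem in terms of normal forms. A word no longer than its code gains length at
  -- every letter; a single descent would leave the code too short.
  op-reduced : ∀ {m} {τ : Fin m → C → C} → Braided τ → ∀ is → length is ℕ.≤ len (fromWord is) → ∀ f →
               foldr τ f is ≈ op τ (fromWord is) f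
  op-reduced {_} {τ} B []       _       f = reflexive (≡.sym (op-identity τ f))
  op-reduced {_} {τ} B (i ∷ is) minimal f with len-act i (fromWord is)
  ... | inj₁ up   = trans
    (τ-cong B i (op-reduced B is (ℕ.≤-pred (ℕ.≤-trans minimal (ℕ.≤-reflexive up))) f))
    (op-ascend B i (fromWord is) up f)
  ... | inj₂ down = contradiction (begin-strict
    len (act i (fromWord is))   <⟨ ℕ.≤-reflexive down ⟩
    len (fromWord is)           ≤⟨ len-fromWord is ⟩
    length is                   <⟨ minimal ⟩
    len (act i (fromWord is))   ∎′) (ℕ.<-irrefl ≡.refl)
    where
    open ℕ.≤-Reasoning using (begin-strict_; step-<; step-≤) renaming (_∎ to _∎′)

  foldr-path : ∀ {m} (τ : Fin m → C → C) j f → foldr τ f (pathWord j) ≡ path τ j f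
  foldr-path {zero}  τ _       f = ≡.refl
  foldr-path {suc m} τ zero    f = ≡.refl
  foldr-path {suc m} τ (suc j) f = ≡.trans (List.foldr-++ τ f (List.map suc (pathWord j)) (zero ∷ []))
    (≡.trans (List.foldr-map τ suc (τ zero f) (pathWord j)) (foldr-path (τ ∘ suc) j (τ zero f)))

  foldr-toWord : ∀ {m} (τ : Fin m → C → C) c f → foldr τ f (toWord c) ≡ op τ c f
  foldr-toWord τ []      f = ≡.refl
  foldr-toWord τ (j ∷ c) f = ≡.trans (List.foldr-++ τ f (pathWord j) (List.map suc (toWord c)))
    (≡.trans (foldr-path τ j _) (cong (path τ j)
      (≡.trans (List.foldr-map τ suc f (toWord c)) (foldr-toWord (τ ∘ suc) c f))))

-- Adjacent transpositions and the permutation of a code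

-- The transposition s_i by recursion on `i`, because `Coxeter.s` is given by equality tests and
-- does not reduce along the inductions on codes.
swap : ∀ {m} → Fin m → Fin (suc m) → Fin (suc m)
swap         zero    zero          = suc zero
swap         zero    (suc zero)    = zero
swap         zero    (suc (suc x)) = suc (suc x)
swap         (suc i) zero          = zero
swap {suc m} (suc i) (suc x)       = suc (swap i x)

s≡swap : ∀ {m} (i : Fin m) x → Coxeter.s m i ⟨$⟩ʳ x ≡ swap i x
s≡swap zero    zero          = ≡.refl
s≡swap zero    (suc zero)    = ≡.refl
s≡swap zero    (suc (suc x)) = ≡.refl
s≡swap (suc i) zero          = ≡.refl
s≡swap {suc m} (suc i) (suc x) = ≡.trans shift (cong suc (s≡swap i x))
  where
  shift : Coxeter.s (suc m) (suc i) ⟨$⟩ʳ suc x ≡ suc (Coxeter.s m i ⟨$⟩ʳ x)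
  shift with does (x Fin.≟ inject₁ i)
  ... | true = ≡.refl
  ... | false with does (x Fin.≟ suc i)
  ...   | true  = ≡.refl
  ...   | false = ≡.refl

swap-lo : ∀ {m} (i : Fin m) → swap i (inject₁ i) ≡ suc i
swap-lo zero    = ≡.refl
swap-lo (suc i) = cong suc (swap-lo i)

swap-hi : ∀ {m} (i : Fin m) → swap i (suc i) ≡ inject₁ i
swap-hi zero    = ≡.refl
swap-hi (suc i) = cong suc (swap-hi i)

swap-involutive : ∀ {m} (i : Fin m) x → swap i (swap i x) ≡ x
swap-involutive zero    zero          = ≡.refl
swap-involutive zero    (suc zero)    = ≡.refl
swap-involutive zero    (suc (suc x)) = ≡.refl
swap-involutive (suc i) zero          = ≡.refl
swap-involutive {suc m} (suc i) (suc x) = cong suc (swap-involutive i x)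

module _ where
  private
    commute : ∀ {m} (i j : Fin m) → suc (toℕ i) ℕ.< toℕ j → ∀ x → swap i (swap j x) ≡ swap j (swap i x)
    commute zero    (suc zero)    (s≤s ()) _
    commute zero    (suc (suc j)) _ zero          = ≡.refl
    commute zero    (suc (suc j)) _ (suc zero)    = ≡.refl
    commute zero    (suc (suc j)) _ (suc (suc x)) = ≡.refl
    commute (suc i) (suc j)       _ zero          = ≡.refl
    commute {suc m} (suc i) (suc j) (s≤s p) (suc x) = cong suc (commute i j p x)

    braid : ∀ {m} (i j : Fin m) → toℕ j ≡ suc (toℕ i) → ∀ x → swap i (swap j (swap i x)) ≡ swap j (swap i (swap j x))
    braid zero    (suc zero)    _ zero                = ≡.refl
    braid zero    (suc zero)    _ (suc zero)          = ≡.refl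
    braid zero    (suc zero)    _ (suc (suc zero))    = ≡.refl
    braid zero    (suc zero)    _ (suc (suc (suc x))) = ≡.refl
    braid (suc i) (suc j)       _ zero                = ≡.refl
    braid {suc m} (suc i) (suc j) p (suc x)           = cong suc (braid i j (ℕ.suc-injective p) x)

  swap-Braided : ∀ m → Operators.Braided (≡.setoid (Fin (suc m))) {m} swap
  swap-Braided m = record { τ-cong = λ i → cong (swap i) ; commute = commute ; braid = braid }

-- The recursion copies that of `allPermutations`, so that sums over this list turn into iterated
-- sums over codes.
perm : ∀ {m} → Code m → Permutation′ (suc m)
perm []      = insert zero zero idₚ
perm (j ∷ c) = insert zero j (perm c)

private module Op n = Operators (≡.setoid (Fin n))

path-fixes-zero : ∀ {m n} (τ : Fin m → Fin (suc n) → Fin (suc n)) → (∀ i → τ i zero ≡ zero) →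
                  ∀ j → Op.path (suc n) τ j zero ≡ zero
path-fixes-zero {zero}      τ fixes _       = ≡.refl
path-fixes-zero {suc m}     τ fixes zero    = ≡.refl
path-fixes-zero {suc m} {n} τ fixes (suc j) =
  ≡.trans (cong (Op.path (suc n) (τ ∘ suc) j) (fixes zero)) (path-fixes-zero (τ ∘ suc) (fixes ∘ suc) j)

op-fixes-zero : ∀ {m n} (τ : Fin m → Fin (suc n) → Fin (suc n)) → (∀ i → τ i zero ≡ zero) →
                ∀ c → Op.op (suc n) τ c zero ≡ zero
op-fixes-zero         τ fixes []      = ≡.refl
op-fixes-zero {_} {n} τ fixes (j ∷ c) =
  ≡.trans (cong (Op.path (suc n) τ j) (op-fixes-zero (τ ∘ suc) (fixes ∘ suc) c)) (path-fixes-zero τ fixes j)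

path-suc : ∀ {m n} (τ : Fin m → Fin (suc n) → Fin (suc n)) (υ : Fin m → Fin n → Fin n) →
           (∀ i x → τ i (suc x) ≡ suc (υ i x)) → ∀ j x → Op.path (suc n) τ j (suc x) ≡ suc (Op.path n υ j x)
path-suc {zero}      τ υ shift _       x = ≡.refl
path-suc {suc m}     τ υ shift zero    x = ≡.refl
path-suc {suc m} {n} τ υ shift (suc j) x =
  ≡.trans (cong (Op.path (suc n) (τ ∘ suc) j) (shift zero x)) (path-suc (τ ∘ suc) (υ ∘ suc) (shift ∘ suc) j (υ zero x))

op-suc : ∀ {m n} (τ : Fin m → Fin (suc n) → Fin (suc n)) (υ : Fin m → Fin n → Fin n) →
         (∀ i x → τ i (suc x) ≡ suc (υ i x)) → ∀ c x → Op.op (suc n) τ c (suc x) ≡ suc (Op.op n υ c x)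
op-suc         τ υ shift []      x = ≡.refl
op-suc {_} {n} τ υ shift (j ∷ c) x =
  ≡.trans (cong (Op.path (suc n) τ j) (op-suc (τ ∘ suc) (υ ∘ suc) (shift ∘ suc) c x))
          (path-suc τ υ shift j (Op.op n (υ ∘ suc) c x))

path-swap-zero : ∀ {m} j → Op.path (suc m) (swap {m}) j zero ≡ j
path-swap-zero {zero}  zero    = ≡.refl
path-swap-zero {suc m} zero    = ≡.refl
path-swap-zero {suc m} (suc j) =
  ≡.trans (path-suc (swap ∘ suc) swap (λ _ _ → ≡.refl) j zero) (cong suc (path-swap-zero j))

path-swap-suc : ∀ {m} j x → Op.path (suc (suc m)) swap j (suc x) ≡ punchIn j x
path-swap-suc         zero    x       = ≡.refl
path-swap-suc         (suc j) zero    = path-fixes-zero (swap ∘ suc) (λ _ → ≡.refl) j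
path-swap-suc {suc m} (suc j) (suc x) =
  ≡.trans (path-suc (swap ∘ suc) swap (λ _ _ → ≡.refl) j (suc x)) (cong suc (path-swap-suc j x))

-- c_j sends zero to `j` and is increasing on the other points, which is exactly how `insert zero j`
-- extends a permutation.
perm≡op : ∀ {m} (c : Code m) x → perm c ⟨$⟩ʳ x ≡ Op.op (suc m) swap c x
perm≡op []              zero    = ≡.refl
perm≡op {suc m} (j ∷ c) zero    = ≡.sym (≡.trans
  (cong (Op.path (suc (suc m)) swap j) (op-fixes-zero (swap ∘ suc) (λ _ → ≡.refl) c)) (path-swap-zero j))
perm≡op {suc m} (j ∷ c) (suc x) = begin
  insert zero j (perm c) ⟨$⟩ʳ suc x                           ≡⟨ insert-punchIn zero j (perm c) x ⟩
  punchIn j (perm c ⟨$⟩ʳ x)                                   ≡⟨ cong (punchIn j) (perm≡op c x) ⟩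
  punchIn j (Op.op (suc m) swap c x)                          ≡⟨ path-swap-suc j _ ⟨
  Op.path (suc (suc m)) swap j (suc (Op.op (suc m) swap c x)) ≡⟨ cong (Op.path (suc (suc m)) swap j) (op-suc (swap ∘ suc) swap (λ _ _ → ≡.refl) c x) ⟨
  Op.op (suc (suc m)) swap (j ∷ c) (suc x)                    ∎
  where
  open ≡.≡-Reasoning

perm-injective : ∀ {m} (c d : Code m) → perm c ≈ₚ perm d → c ≡ d
perm-injective []      []      _  = ≡.refl
perm-injective (j ∷ c) (k ∷ d) eq with eq zero
... | ≡.refl = cong (j ∷_) (perm-injective c d λ x → Fin.punchIn-injective j _ _
  (≡.trans (≡.sym (insert-punchIn zero j (perm c) x)) (≡.trans (eq (suc x)) (insert-punchIn zero j (perm d) x))))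

⟦⟧≡foldr : ∀ {m} is x → Coxeter.⟦_⟧ m is ⟨$⟩ʳ x ≡ foldr swap x is
⟦⟧≡foldr []       x = ≡.refl
⟦⟧≡foldr (i ∷ is) x = ≡.trans (s≡swap i _) (cong (swap i) (⟦⟧≡foldr is x))

perm-fromWord : ∀ {m} is → perm (fromWord is) ≈ₚ Coxeter.⟦_⟧ m is
perm-fromWord {m} is x = ≡.trans (perm≡op (fromWord is) x)
  (≡.trans (≡.sym (Operators.op-fromWord (≡.setoid (Fin (suc m))) (swap-Braided m) swap-involutive is x))
           (≡.sym (⟦⟧≡foldr is x)))

perm-toWord : ∀ {m} (c : Code m) → perm c ≈ₚ Coxeter.⟦_⟧ m (toWord c)
perm-toWord {m} c x = ≡.trans (perm≡op c x)
  (≡.trans (≡.sym (Operators.foldr-toWord (≡.setoid (Fin (suc m))) swap c x)) (≡.sym (⟦⟧≡foldr (toWord c) x)))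

-- Reduced words

module _ {m : ℕ} (words : Coxeter.ReducedWords m) where
  open Coxeter.ReducedWords words
  open Coxeter m using (IsReducedWord)
  module Reduced w = IsReducedWord (reduced w)

  -- The word read off from the code spells the same permutation in `len` letters, and a reduced
  -- word is at most as long.
  word-minimal : ∀ w → length (word w) ℕ.≤ len (fromWord (word w))
  word-minimal w = ℕ.≤-trans
    (Reduced.minimal w (toWord c) λ x →
      ≡.trans (≡.sym (perm-toWord c x)) (≡.trans (perm-fromWord (word w) x) (Reduced.spells w x)))
    (ℕ.≤-reflexive (length-toWord c))
    where c = fromWord (word w)

  ℓ≡len : ∀ w → ℓ w ≡ len (fromWord (word w))
  ℓ≡len w = ℕ.≤-antisym (word-minimal w) (len-fromWord (word w))

  fromWord-word : ∀ c → fromWord (word (perm c)) ≡ c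
  fromWord-word c = perm-injective _ c λ x →
    ≡.trans (perm-fromWord (word (perm c)) x) (Reduced.spells (perm c) x)

  ℓ-perm : ∀ c → ℓ (perm c) ≡ len c
  ℓ-perm c = ≡.trans (ℓ≡len (perm c)) (cong len (fromWord-word c))

  ℓ-longest : ∀ w₀ → IsLongest w₀ → ℓ w₀ ≡ len (longest m)
  ℓ-longest w₀ is-longest = ℕ.≤-antisym
    (ℕ.≤-trans (ℕ.≤-reflexive (ℓ≡len w₀)) (len≤longest (fromWord (word w₀))))
    (ℕ.≤-trans (ℕ.≤-reflexive (≡.sym (ℓ-perm (longest m)))) (is-longest (perm (longest m))))

-- Sums over permutations

module CodeSum {a ℓ} (M : CommutativeMonoid a ℓ) where
  open CommutativeMonoid M
  open Algebra.Properties.CommutativeMonoid.Sum M using (sum; sum-cong-≋)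

  ∑ᶜ : ∀ {m} → (Code m → Carrier) → Carrier
  ∑ᶜ {zero}  F = F []
  ∑ᶜ {suc m} F = sum λ j → ∑ᶜ λ c → F (j ∷ c)

  ∑ᶜ-cong : ∀ {m} {F G : Code m → Carrier} → (∀ c → F c ≈ G c) → ∑ᶜ F ≈ ∑ᶜ G
  ∑ᶜ-cong {zero}  p = p []
  ∑ᶜ-cong {suc m} p = sum-cong-≋ λ j → ∑ᶜ-cong λ c → p (j ∷ c)

  sumList : List Carrier → Carrier
  sumList = foldr _∙_ ε

  sumList-++ : ∀ xs ys → sumList (xs ++ ys) ≈ sumList xs ∙ sumList ys
  sumList-++ []       ys = sym (identityˡ _)
  sumList-++ (x ∷ xs) ys = trans (∙-congˡ (sumList-++ xs ys)) (sym (assoc x _ _))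

  module _ {A B C : Set} where
    sumList-product : ∀ {n} (F : C → Carrier) (g : A → B → C) (h : Fin n → A) ys →
      sumList (List.map F (cartesianProductWith g (List.tabulate h) ys)) ≈
      sum λ j → sumList (List.map (F ∘ g (h j)) ys)
    sumList-product {zero}  F g h ys = refl
    sumList-product {suc n} F g h ys = trans
      (reflexive (cong sumList (List.map-++ F (List.map (g (h zero)) ys) _)))
      (trans (sumList-++ (List.map F (List.map (g (h zero)) ys)) _)
        (∙-cong (reflexive (cong sumList (≡.sym (List.map-∘ ys)))) (sumList-product F g (h ∘ suc) ys)))

  sum-permutations : ∀ {m} (F : Permutation′ (suc m) → Carrier) →
                     sumList (List.map F (allPermutations (suc m))) ≈ ∑ᶜ (F ∘ perm)
  sum-permutations {zero}  F = identityʳ _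
  sum-permutations {suc m} F = trans (sumList-product F (insert zero) (λ j → j) (allPermutations (suc m)))
    (sum-cong-≋ λ j → sum-permutations (F ∘ insert zero j))

module _ {a ℓ b ℓ′} (M : CommutativeMonoid a ℓ) (N : CommutativeMonoid b ℓ′) where
  private
    module M = CommutativeMonoid M
    module N = CommutativeMonoid N
    module ΣM = CodeSum M
    module ΣN = CodeSum N
    module SM = Algebra.Properties.CommutativeMonoid.Sum M
    module SN = Algebra.Properties.CommutativeMonoid.Sum N

  ∑ᶜ-homo : (φ : M.Carrier → N.Carrier) → φ M.ε N.≈ N.ε → (∀ f g → φ (f M.∙ g) N.≈ φ f N.∙ φ g) →
            ∀ {m} (F : Code m → M.Carrier) → φ (ΣM.∑ᶜ F) N.≈ ΣN.∑ᶜ (φ ∘ F)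
  ∑ᶜ-homo φ φ-ε φ-∙ {zero}  F = N.refl
  ∑ᶜ-homo φ φ-ε φ-∙ {suc m} F = N.trans (sum-homo λ j → ΣM.∑ᶜ λ c → F (j ∷ c))
    (SN.sum-cong-≋ λ j → ∑ᶜ-homo φ φ-ε φ-∙ λ c → F (j ∷ c))
    where
    sum-homo : ∀ {n} (f : Fin n → M.Carrier) → φ (SM.sum f) N.≈ SN.sum (φ ∘ f)
    sum-homo {zero}  f = φ-ε
    sum-homo {suc n} f = N.trans (φ-∙ (f zero) _) (N.∙-congˡ (sum-homo (f ∘ suc)))

swap-fixes : ∀ {m} (i : Fin m) x → toℕ x ≢ toℕ i → toℕ x ≢ suc (toℕ i) → swap i x ≡ x
swap-fixes zero    zero          p q = contradiction ≡.refl p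
swap-fixes zero    (suc zero)    p q = contradiction ≡.refl q
swap-fixes zero    (suc (suc x)) p q = ≡.refl
swap-fixes (suc i) zero          p q = ≡.refl
swap-fixes {suc m} (suc i) (suc x) p q = cong suc (swap-fixes i x (p ∘ cong suc) (q ∘ cong suc))

-- The symmetrizer

module Symmetrizer {c ℓ} (F : CommutativeRing c ℓ) where
  open CommutativeRing F hiding (zero)
  open Operators setoid
  open CodeSum +-commutativeMonoid
  open Algebra.Properties.Semiring.Sum semiring using (sum; sum-cong-≋; *-distribˡ-sum; *-distribʳ-sum)
  open Algebra.Properties.CommutativeMonoid.Sum +-commutativeMonoid using (sum-permute; ∑-distrib-+)
  open Algebra.Properties.CommutativeMonoid.Sum *-commutativeMonoid
    using () renaming (sum to product; sum-cong-≋ to product-cong; sum-permute to product-permute)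
  open IntegerRingSolver F
  open SetoidReasoning setoid

  -- The only identities between the α's that the braid relations and the symmetrizer use. They hold
  -- for t and for t⁻¹ alike, with `u` equal to 1 - t and 1 - t⁻¹.
  record Relations {N} (u : Carrier) (α : Fin N → Fin N → Carrier) : Set (c ⊔ ℓ) where
    field
      opposite : ∀ {i j} → i ≢ j → α i j + α j i ≈ - u
      triple   : ∀ {i j k} → i ≢ j → j ≢ k → i ≢ k → α i j * α j k ≈ α i k * (u + α i j + α j k)

  Relations-suc : ∀ {N u} {α : Fin (suc N) → Fin (suc N) → Carrier} →
                  Relations u α → Relations u (λ i j → α (suc i) (suc j))
  Relations-suc R = record
    { opposite = λ p → opposite (p ∘ Fin.suc-injective)
    ; triple   = λ p q r → triple (p ∘ Fin.suc-injective) (q ∘ Fin.suc-injective) (r ∘ Fin.suc-injective)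
    }
    where
    open Relations R

  -- ∏_{r ≠ k} (1 + α k r)
  residue : ∀ {N} → (Fin N → Fin N → Carrier) → Fin N → Carrier
  residue {suc N} α zero    = product λ r → 1# + α zero (suc r)
  residue {suc N} α (suc k) = (1# + α (suc k) zero) * residue (λ i j → α (suc i) (suc j)) k

  -- With y_k = (1 - t) x_k / (x - x_k), this expands ∏ (x - t x_k) / (x - x_k) in partial fractions
  -- in x. Nothing is kept of the extra point x but its relation with the α's, so that in the
  -- induction the point x₀ can play the same role, with `z` in place of `y`.
  partial-fractions : ∀ {N u} {α : Fin N → Fin N → Carrier} → Relations u α → ∀ (y : Fin N → Carrier) →
    (∀ {j k} → j ≢ k → y j * α j k ≈ y k * (u + y j + α j k)) →
    1# + sum (λ k → y k * residue α k) ≈ product λ k → 1# + y k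
  partial-fractions {zero}              R y y-triple = +-identityʳ 1#
  partial-fractions {suc N} {u} {α} R y y-triple = begin
    1# + (y₀ * product (λ r → 1# + z r) + sum (λ k → y (suc k) * ((1# + α (suc k) zero) * C k)))
      ≈⟨ +-congˡ (+-cong (*-congˡ (sym (partial-fractions (Relations-suc R) z z-triple)))
                         (sum-cong-≋ λ k → swap-term k)) ⟩
    1# + (y₀ * (1# + sum (λ k → z k * C k)) + sum (λ k → (1# + y₀) * (y (suc k) * C k) + (- y₀) * (z k * C k)))
      ≈⟨ +-congˡ (+-congˡ (trans (∑-distrib-+ (λ k → (1# + y₀) * (y (suc k) * C k)) (λ k → (- y₀) * (z k * C k)))
           (sym (+-cong (*-distribˡ-sum (1# + y₀) (λ k → y (suc k) * C k)) (*-distribˡ-sum (- y₀) (λ k → z k * C k)))))) ⟩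
    1# + (y₀ * (1# + sum (λ k → z k * C k)) + ((1# + y₀) * sum (λ k → y (suc k) * C k) + (- y₀) * sum (λ k → z k * C k)))
      ≈⟨ solve 3 (λ y₀ S T → 𝟙 :+ (y₀ :* (𝟙 :+ S) :+ ((𝟙 :+ y₀) :* T :+ (:- y₀) :* S)) := (𝟙 :+ y₀) :* (𝟙 :+ T)) refl _ _ _ ⟩
    (1# + y₀) * (1# + sum (λ k → y (suc k) * C k))
      ≈⟨ *-congˡ (partial-fractions (Relations-suc R) (y ∘ suc) (λ p → y-triple (p ∘ Fin.suc-injective))) ⟩
    (1# + y₀) * product (λ k → 1# + y (suc k)) ∎
    where
    open Relations R
    y₀ = y zero
    z : Fin N → Carrier
    z r = α zero (suc r)
    C = residue λ i j → α (suc i) (suc j)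
    z-triple : ∀ {j k} → j ≢ k → z j * α (suc j) (suc k) ≈ z k * (u + z j + α (suc j) (suc k))
    z-triple p = triple (λ ()) (p ∘ Fin.suc-injective) (λ ())
    swap-term : ∀ k → y (suc k) * ((1# + α (suc k) zero) * C k) ≈ (1# + y₀) * (y (suc k) * C k) + (- y₀) * (z k * C k)
    swap-term k = begin
      a * ((1# + b) * w)
        ≈⟨ solve 3 (λ a b w → a :* ((𝟙 :+ b) :* w) := a :* w :+ a :* b :* w) refl a b w ⟩
      a * w + a * b * w
        ≈⟨ +-congˡ (*-congʳ (y-triple λ ())) ⟩
      a * w + y₀ * (u + a + b) * w
        ≈⟨ solve 6 (λ a b w y₀ u z → a :* w :+ y₀ :* (u :+ a :+ b) :* w :=
             (𝟙 :+ y₀) :* (a :* w) :+ (:- y₀) :* (z :* w) :+ y₀ :* w :* ((z :+ b) :+ u)) refl a b w y₀ u (z k) ⟩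
      (1# + y₀) * (a * w) + (- y₀) * (z k * w) + y₀ * w * ((z k + b) + u)
        ≈⟨ +-congˡ (trans (*-congˡ (trans (+-congʳ (opposite λ ())) (-‿inverseˡ u))) (zeroʳ _)) ⟩
      (1# + y₀) * (a * w) + (- y₀) * (z k * w) + 0#
        ≈⟨ +-identityʳ _ ⟩
      (1# + y₀) * (a * w) + (- y₀) * (z k * w) ∎
      where
      a = y (suc k)
      b = α (suc k) zero
      w = C k

  -- α a b stands for (1 − t) x_b / (x_a − x_b) and u for 1 − t, so that
  -- 1 + α a b = (x_a − t x_b) / (x_a − x_b).
  record System (m : ℕ) : Set (c ⊔ ℓ) where
    field
      s         : Fin m → Carrier → Carrier
      s-cong    : ∀ i {f g} → f ≈ g → s i f ≈ s i g
      s-+       : ∀ i f g → s i (f + g) ≈ s i f + s i g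
      s-*       : ∀ i f g → s i (f * g) ≈ s i f * s i g
      s-1       : ∀ i → s i 1# ≈ 1#
      -- The action on arguments, semilinear over `s`: it is `s` itself in the bosonic case and -`s`
      -- in the fermionic one.
      σ         : Fin m → Carrier → Carrier
      σ-+       : ∀ i f g → σ i (f + g) ≈ σ i f + σ i g
      σ-*       : ∀ i a f → σ i (a * f) ≈ s i a * σ i f
      σ-braided : Braided σ
      σ-invol   : Involutive σ
      u         : Carrier
      α         : Fin (suc m) → Fin (suc m) → Carrier
      s-α       : ∀ i a b → s i (α a b) ≈ α (swap i a) (swap i b)
      relations : Relations u α
    open Braided σ-braided public renaming (τ-cong to σ-cong; commute to σ-commute; braid to σ-braid)
    open Relations relations public

    τ : Fin m → Carrier → Carrier
    τ i f = α (inject₁ i) (suc i) * f + (1# + α (suc i) (inject₁ i)) * σ i f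

  restrict : ∀ {m} → System (suc m) → System m
  restrict Y = record
    { s         = s ∘ suc
    ; s-cong    = s-cong ∘ suc
    ; s-+       = s-+ ∘ suc
    ; s-*       = s-* ∘ suc
    ; s-1       = s-1 ∘ suc
    ; σ         = σ ∘ suc
    ; σ-+       = σ-+ ∘ suc
    ; σ-*       = σ-* ∘ suc
    ; σ-braided = Braided-suc σ-braided
    ; σ-invol   = σ-invol ∘ suc
    ; u         = u
    ; α         = λ a b → α (suc a) (suc b)
    ; s-α       = λ i a b → s-α (suc i) (suc a) (suc b)
    ; relations = Relations-suc relations
    }
    where
    open System Y

  firstRow : ∀ {m} → (Fin (suc m) → Fin (suc m) → Carrier) → Carrier
  firstRow α = product λ r → 1# + α zero (suc r)

  triangle : ∀ {m} → (Fin (suc m) → Fin (suc m) → Carrier) → Carrier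
  triangle {zero}  α = 1#
  triangle {suc m} α = firstRow α * triangle λ a b → α (suc a) (suc b)

  Additive : (Carrier → Carrier) → Set (c ⊔ ℓ)
  Additive φ = ∀ f g → φ (f + g) ≈ φ f + φ g

  additive-0 : ∀ {φ} → (∀ {f g} → f ≈ g → φ f ≈ φ g) → Additive φ → φ 0# ≈ 0#
  additive-0 {φ} φ-cong φ-+ = begin
    φ 0#                     ≈⟨ solve 1 (λ x → x := x :+ x :- x) refl (φ 0#) ⟩
    φ 0# + φ 0# - φ 0#       ≈⟨ +-congʳ (φ-+ 0# 0#) ⟨
    φ (0# + 0#) - φ 0#       ≈⟨ +-congʳ (φ-cong (+-identityˡ 0#)) ⟩
    φ 0# - φ 0#              ≈⟨ -‿inverseʳ _ ⟩
    0#                       ∎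

  additive-sum : ∀ {φ} → (∀ {f g} → f ≈ g → φ f ≈ φ g) → Additive φ →
                 ∀ {n} (f : Fin n → Carrier) → φ (sum f) ≈ sum (φ ∘ f)
  additive-sum φ-cong φ-+ {zero}  f = additive-0 φ-cong φ-+
  additive-sum φ-cong φ-+ {suc n} f = trans (φ-+ _ _) (+-congˡ (additive-sum φ-cong φ-+ (f ∘ suc)))

  additive-∑ᶜ : ∀ {φ} → (∀ {f g} → f ≈ g → φ f ≈ φ g) → Additive φ →
                ∀ {m} (f : Code m → Carrier) → φ (∑ᶜ f) ≈ ∑ᶜ (φ ∘ f)
  additive-∑ᶜ φ-cong φ-+ {zero}  f = refl
  additive-∑ᶜ φ-cong φ-+ {suc m} f =
    trans (additive-sum φ-cong φ-+ λ j → ∑ᶜ (f ∘ (j ∷_))) (sum-cong-≋ λ j → additive-∑ᶜ φ-cong φ-+ (f ∘ (j ∷_)))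

  path-additive : ∀ {m} {τ : Fin m → Carrier → Carrier} → (∀ i {f g} → f ≈ g → τ i f ≈ τ i g) →
                  (∀ i → Additive (τ i)) → ∀ j → Additive (path τ j)
  path-additive {zero}  τ-cong τ-+ _       f g = refl
  path-additive {suc m} τ-cong τ-+ zero    f g = refl
  path-additive {suc m} τ-cong τ-+ (suc j) f g =
    trans (path-cong (τ-cong ∘ suc) j (τ-+ zero f g)) (path-additive (τ-cong ∘ suc) (τ-+ ∘ suc) j _ _)

  module _ {m} (Y : System m) where
    open System Y

    τ-additive : ∀ i → Additive (τ i)
    τ-additive i f g = trans (+-congˡ (*-congˡ (σ-+ i f g)))
      (solve 6 (λ a b f g sf sg → a :* (f :+ g) :+ b :* (sf :+ sg) := (a :* f :+ b :* sf) :+ (a :* g :+ b :* sg))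
        refl _ _ f g (σ i f) (σ i g))

    τ-congruent : ∀ i {f g} → f ≈ g → τ i f ≈ τ i g
    τ-congruent i p = +-cong (*-congˡ p) (*-congˡ (σ-cong i p))

    s-1+α : ∀ i a b → s i (1# + α a b) ≈ 1# + α (swap i a) (swap i b)
    s-1+α i a b = trans (s-+ i _ _) (+-cong (s-1 i) (s-α i a b))

    s-product : ∀ i {n} (f : Fin n → Carrier) → s i (product f) ≈ product (s i ∘ f)
    s-product i {zero}  f = s-1 i
    s-product i {suc n} f = trans (s-* i _ _) (*-congˡ (s-product i (f ∘ suc)))

    σ-scale : ∀ i {a} f → s i a ≈ a → σ i (a * f) ≈ a * σ i f
    σ-scale i f p = trans (σ-* i _ f) (*-congʳ p)

  path-semilinear : ∀ {m} (Y : System m) → let open System Y in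
                    ∀ j a f → path σ j (a * f) ≈ path s j a * path σ j f
  path-semilinear {zero}  Y _       a f = refl
  path-semilinear {suc m} Y zero    a f = refl
  path-semilinear {suc m} Y (suc j) a f = trans (path-cong (σ-cong ∘ suc) j (σ-* zero a f))
    (path-semilinear (restrict Y) j _ _)
    where
    open System Y

  firstRow-swap : ∀ {m} (Y : System (suc m)) → let open System Y in
    s zero (firstRow α) ≈ (1# + α (suc zero) zero) * firstRow λ a b → α (suc a) (suc b)
  firstRow-swap Y = trans (s-* zero _ _) (*-cong (s-1+α Y zero zero (suc zero))
    (trans (s-product Y zero λ r → 1# + α zero (suc (suc r))) (product-cong λ r → s-1+α Y zero zero (suc (suc r)))))
    where
    open System Y

  -- c_j carries the point 0 to j, hence the product over r ≠ 0 to the product over r ≠ j. The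
  -- weight `h` is general in order to absorb the factor 1 + α_{a0} that each step of the path
  -- splits off.
  path-residue : ∀ {m} (Y : System m) → let open System Y in
    ∀ (h : Fin (suc m) → Carrier) → (∀ i a → s i (h a) ≈ h (swap i a)) →
    ∀ j → path s j (h zero * firstRow α) ≈ h j * residue α j
  path-residue {zero}  Y h s-h zero    = refl
  path-residue {suc m} Y h s-h zero    = refl
  path-residue {suc m} Y h s-h (suc j) = begin
    path (s ∘ suc) j (s zero (h zero * firstRow α))
      ≈⟨ path-cong (s-cong ∘ suc) j step ⟩
    path (s ∘ suc) j (h (suc zero) * (1# + α (suc zero) zero) * firstRow (λ a b → α (suc a) (suc b)))
      ≈⟨ path-residue (restrict Y) (λ a → h (suc a) * (1# + α (suc a) zero))
           (λ i a → trans (s-* (suc i) _ _) (*-cong (s-h (suc i) (suc a)) (s-1+α Y (suc i) (suc a) zero))) j ⟩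
    h (suc j) * (1# + α (suc j) zero) * residue (λ a b → α (suc a) (suc b)) j
      ≈⟨ *-assoc _ _ _ ⟩
    h (suc j) * ((1# + α (suc j) zero) * residue (λ a b → α (suc a) (suc b)) j) ∎
    where
    open System Y
    step : s zero (h zero * firstRow α) ≈ h (suc zero) * (1# + α (suc zero) zero) * firstRow (λ a b → α (suc a) (suc b))
    step = trans (s-* zero _ _) (trans (*-cong (s-h zero zero)
      (firstRow-swap Y)) (sym (*-assoc _ _ _)))

  path-fixed : ∀ {m} {τ : Fin m → Carrier → Carrier} → (∀ i {f g} → f ≈ g → τ i f ≈ τ i g) →
               ∀ {f} → (∀ i → τ i f ≈ f) → ∀ j → path τ j f ≈ f
  path-fixed {zero}  τ-cong fixed _       = refl
  path-fixed {suc m} τ-cong fixed zero    = refl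
  path-fixed {suc m} τ-cong fixed (suc j) =
    trans (path-cong (τ-cong ∘ suc) j (fixed zero)) (path-fixed (τ-cong ∘ suc) (fixed ∘ suc) j)

  -- After s₀ is peeled off the paths, τ₀ g is still fixed by the σ_i with i ≥ 2, so the induction
  -- applies to it. It leaves multiples of g whose coefficients are the terms of a partial fraction
  -- expansion; together with the summand g of the empty path they add up to `firstRow α` times g.
  sum-path : ∀ {m} (Y : System m) → let open System Y in
    ∀ {g} → (∀ i → 0 ℕ.< toℕ i → σ i g ≈ g) →
    sum (λ j → path τ j g) ≈ sum (λ j → path σ j (firstRow α * g))
  sum-path {zero}  Y {g} g-inv = +-congʳ (sym (*-identityˡ g))
  sum-path {suc m} Y {g} g-inv = begin
    g + sum (λ j → path (τ ∘ suc) j (τ zero g))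
      ≈⟨ +-congˡ (sum-path (restrict Y) τg-inv) ⟩
    g + sum (λ j → path (σ ∘ suc) j (D′ * τ zero g))
      ≈⟨ +-congˡ (sum-cong-≋ λ j → trans (path-cong (σ-cong ∘ suc) j split)
           (trans (path-additive (σ-cong ∘ suc) (σ-+ ∘ suc) j _ _) (+-congʳ (fixed-part j)))) ⟩
    g + sum (λ j → α zero (suc j) * residue α′ j * g + path σ (suc j) (D * g))
      ≈⟨ +-congˡ (trans (∑-distrib-+ (λ j → α zero (suc j) * residue α′ j * g) (λ j → path σ (suc j) (D * g)))
           (+-congʳ (sym (*-distribʳ-sum g λ j → α zero (suc j) * residue α′ j)))) ⟩
    g + (sum (λ j → α zero (suc j) * residue α′ j) * g + sum (λ j → path σ (suc j) (D * g)))
      ≈⟨ solve 3 (λ g S T → g :+ (S :* g :+ T) := (𝟙 :+ S) :* g :+ T) refl g _ _ ⟩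
    (1# + sum (λ j → α zero (suc j) * residue α′ j)) * g + sum (λ j → path σ (suc j) (D * g))
      ≈⟨ +-congʳ (*-congʳ (partial-fractions (Relations-suc relations) (λ k → α zero (suc k))
           (λ p → triple (λ ()) (p ∘ Fin.suc-injective) (λ ())))) ⟩
    D * g + sum (λ j → path σ (suc j) (D * g)) ∎
    where
    open System Y
    α′ : Fin (suc m) → Fin (suc m) → Carrier
    α′ a b = α (suc a) (suc b)
    D  = firstRow α
    D′ = firstRow α′

    fixed : ∀ i → σ (suc i) g ≈ g
    fixed i = g-inv (suc i) (s≤s z≤n)

    τg-inv : ∀ i → 0 ℕ.< toℕ i → σ (suc i) (τ zero g) ≈ τ zero g
    τg-inv (suc i) _ = trans (σ-+ k _ _) (+-cong
      (trans (σ-scale Y k g (s-α k zero (suc zero))) (*-congˡ (fixed (suc i))))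
      (trans (σ-scale Y k (σ zero g) (s-1+α Y k (suc zero) zero))
        (*-congˡ (trans (sym (σ-commute zero k (s≤s (s≤s z≤n)) g)) (σ-cong zero (fixed (suc i)))))))
      where k = suc (suc i)

    -- The first term is a multiple of g, which the remaining paths fix; the second is already of
    -- the form wanted on the right-hand side.
    split : D′ * τ zero g ≈ α zero (suc zero) * D′ * g + σ zero (D * g)
    split = begin
      D′ * (α zero (suc zero) * g + (1# + α (suc zero) zero) * σ zero g)
        ≈⟨ solve 5 (λ d a g b f → d :* (a :* g :+ b :* f) := a :* d :* g :+ (b :* d) :* f) refl D′ _ g _ _ ⟩
      α zero (suc zero) * D′ * g + ((1# + α (suc zero) zero) * D′) * σ zero g
        ≈⟨ +-congˡ (trans (*-congʳ (sym (firstRow-swap Y))) (sym (σ-* zero D g))) ⟩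
      α zero (suc zero) * D′ * g + σ zero (D * g) ∎

    fixed-part : ∀ j → path (σ ∘ suc) j (α zero (suc zero) * D′ * g) ≈ α zero (suc j) * residue α′ j * g
    fixed-part j = trans (path-semilinear (restrict Y) j _ g) (*-cong
      (path-residue (restrict Y) (λ a → α zero (suc a)) (λ i a → s-α (suc i) zero (suc a)) j)
      (path-fixed (σ-cong ∘ suc) fixed j))

  swap-above : ∀ {m} (i : Fin m) (j : Fin (suc (suc m))) → toℕ j ℕ.≤ toℕ i → swap (suc i) j ≡ j
  swap-above i j p = swap-fixes (suc i) j (ℕ.<⇒≢ (s≤s p)) (ℕ.<⇒≢ (ℕ.≤-trans (s≤s p) (ℕ.n≤1+n _)))

  swap-below : ∀ {m} (i : Fin m) (j : Fin (suc (suc m))) → suc (toℕ i) ℕ.< toℕ j → swap (inject₁ i) j ≡ j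
  swap-below i j p = swap-fixes (inject₁ i) j
    (λ q → ℕ.<⇒≢ (ℕ.<-trans (ℕ.n<1+n _) p) (≡.sym (≡.trans q (Fin.toℕ-inject₁ i))))
    (λ q → ℕ.<⇒≢ p (≡.sym (≡.trans q (cong suc (Fin.toℕ-inject₁ i)))))

  -- s_i c_j lies in the coset of c_{s_i(j)} modulo 1 × S_{n-1}, and that subgroup fixes `g`.
  σ-path : ∀ {m} (Y : System (suc m)) → let open System Y in
           ∀ {g} → (∀ i → σ (suc i) g ≈ g) → ∀ i j → σ i (path σ j g) ≈ path σ (swap i j) g
  σ-path Y {g} g-inv i j with position i j
  ... | ascent  i rewrite swap-lo i = reflexive (path-ascent σ i g)
    where
    open System Y
  ... | descent i rewrite swap-hi i = path-descent σ-cong σ-invol i g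
    where
    open System Y
  ... | above i′ j p rewrite swap-above i′ j p =
    trans (path-above σ-braided i′ j p g) (path-cong σ-cong j (g-inv i′))
    where
    open System Y
  ... | below i′ j p rewrite swap-below i′ j p =
    trans (path-below σ-braided i′ j p g) (path-cong σ-cong j (g-inv i′))
    where
    open System Y

  sum-swap : ∀ {m} (i : Fin m) (f : Fin (suc m) → Carrier) → sum (f ∘ swap i) ≈ sum f
  sum-swap {m} i f = sym (trans (sum-permute f (Coxeter.s m i)) (sum-cong-≋ λ j → reflexive (cong f (s≡swap i j))))

  product-swap : ∀ {m} (i : Fin m) (f : Fin (suc m) → Carrier) → product (f ∘ swap i) ≈ product f
  product-swap {m} i f =
    sym (trans (product-permute f (Coxeter.s m i)) (product-cong λ j → reflexive (cong f (s≡swap i j))))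

  -- By induction the inner sum is fixed by 1 × S_{n-1}; hence s_i only permutes the summands of the
  -- outer sum, as it permutes the points `j`.
  ∑-invariant : ∀ {m} (Y : System m) → let open System Y in
                ∀ f i → σ i (∑ᶜ λ c → op σ c f) ≈ ∑ᶜ λ c → op σ c f
  ∑-invariant {suc m} Y f i = begin
    σ i (sum λ j → ∑ᶜ λ c → path σ j (op (σ ∘ suc) c f))
      ≈⟨ σ-cong i gather ⟩
    σ i (sum λ j → path σ j g)
      ≈⟨ additive-sum (σ-cong i) (σ-+ i) (λ j → path σ j g) ⟩
    (sum λ j → σ i (path σ j g))
      ≈⟨ sum-cong-≋ (σ-path Y (∑-invariant (restrict Y) f) i) ⟩
    (sum λ j → path σ (swap i j) g)
      ≈⟨ sum-swap i (λ j → path σ j g) ⟩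
    (sum λ j → path σ j g)
      ≈⟨ gather ⟨
    (sum λ j → ∑ᶜ λ c → path σ j (op (σ ∘ suc) c f)) ∎
    where
    open System Y
    g = ∑ᶜ λ c → op (σ ∘ suc) c f
    gather : (sum λ j → ∑ᶜ λ c → path σ j (op (σ ∘ suc) c f)) ≈ sum λ j → path σ j g
    gather = sum-cong-≋ λ j → sym (additive-∑ᶜ (path-cong σ-cong j) (path-additive σ-cong σ-+ j) λ c → op (σ ∘ suc) c f)

  firstRow-invariant : ∀ {m} (Y : System (suc m)) → let open System Y in
                       ∀ i → s (suc i) (firstRow α) ≈ firstRow α
  firstRow-invariant Y i = trans (s-product Y (suc i) λ r → 1# + α zero (suc r))
    (trans (product-cong λ r → s-1+α Y (suc i) zero (suc r)) (product-swap i λ r → 1# + α zero (suc r)))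
    where
    open System Y

  symmetrizer : ∀ {m} (Y : System m) → let open System Y in
                ∀ f → (∑ᶜ λ c → op τ c f) ≈ ∑ᶜ λ c → op σ c (triangle α * f)
  symmetrizer {zero}  Y f = sym (*-identityˡ f)
  symmetrizer {suc m} Y f = begin
    (sum λ j → ∑ᶜ λ c → path τ j (op (τ ∘ suc) c f))
      ≈⟨ sum-cong-≋ (λ j → additive-∑ᶜ (path-cong (τ-congruent Y) j) (path-additive (τ-congruent Y) (τ-additive Y) j) λ c → op (τ ∘ suc) c f) ⟨
    (sum λ j → path τ j (∑ᶜ λ c → op (τ ∘ suc) c f))
      ≈⟨ sum-cong-≋ (λ j → path-cong (τ-congruent Y) j (symmetrizer (restrict Y) f)) ⟩
    (sum λ j → path τ j g)
      ≈⟨ sum-path Y (λ { (suc i) _ → ∑-invariant (restrict Y) (Δ′ * f) i }) ⟩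
    (sum λ j → path σ j (firstRow α * g))
      -- The first row is invariant under 1 × S_{n-1}, so it moves inside the inner sum, where it
      -- completes the triangle.
      ≈⟨ sum-cong-≋ (λ j → path-cong σ-cong j (trans
           (additive-∑ᶜ *-congˡ (distribˡ (firstRow α)) λ c → op (σ ∘ suc) c (Δ′ * f))
           (∑ᶜ-cong λ c → trans (op-intertwine (σ-cong ∘ suc) (λ i h → sym (σ-scale Y (suc i) h (firstRow-invariant Y i))) c (Δ′ * f))
             (op-cong (σ-cong ∘ suc) c (sym (*-assoc _ _ _)))))) ⟩
    (sum λ j → path σ j (∑ᶜ λ c → op (σ ∘ suc) c (triangle α * f)))
      ≈⟨ sum-cong-≋ (λ j → additive-∑ᶜ (path-cong σ-cong j) (path-additive σ-cong σ-+ j) λ c → op (σ ∘ suc) c (triangle α * f)) ⟩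
    (sum λ j → ∑ᶜ λ c → path σ j (op (σ ∘ suc) c (triangle α * f))) ∎
    where
    open System Y
    Δ′ = triangle λ a b → α (suc a) (suc b)
    g = ∑ᶜ λ c → op (σ ∘ suc) c (Δ′ * f)

-- Braid relations for the operators τ

module BraidRelations {c ℓ} (F : CommutativeRing c ℓ) where
  open CommutativeRing F hiding (zero)
  open Operators setoid
  open IntegerRingSolver F
  open SetoidReasoning setoid
  open Symmetrizer F
  open Algebra.Properties.CommutativeMonoid.Sum *-commutativeMonoid
    using () renaming (sum to product; sum-cong-≋ to product-cong)
  module _ {m} (Y : System m) where
    open System Y

    private
      s-α′ : ∀ i {a b a′ b′} → swap i a ≡ a′ → swap i b ≡ b′ → s i (α a b) ≈ α a′ b′
      s-α′ i {a} {b} p q = trans (s-α i a b) (reflexive (cong₂ α p q))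

      s-1+α′ : ∀ i {a b a′ b′} → swap i a ≡ a′ → swap i b ≡ b′ → s i (1# + α a b) ≈ 1# + α a′ b′
      s-1+α′ i {a} {b} p q = trans (s-1+α Y i a b) (+-congˡ (reflexive (cong₂ α p q)))

      σ-τ : ∀ i {a a′ b b′ f g} → s i a ≈ a′ → s i b ≈ b′ →
            σ i (a * f + b * g) ≈ a′ * σ i f + b′ * σ i g
      σ-τ i p q = trans (σ-+ i _ _) (+-cong (trans (σ-* i _ _) (*-congʳ p)) (trans (σ-* i _ _) (*-congʳ q)))

      commuting : ∀ i j → suc (toℕ i) ℕ.< toℕ j → ∀ f → τ i (τ j f) ≈ τ j (τ i f)
      commuting i j i+1<j f = begin
        a * (b * f + b′ * σ j f) + a′ * σ i (b * f + b′ * σ j f)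
          ≈⟨ +-congˡ (*-congˡ (σ-τ i (s-α′ i i-lo i-hi) (s-1+α′ i i-hi i-lo))) ⟩
        a * (b * f + b′ * σ j f) + a′ * (b * σ i f + b′ * σ i (σ j f))
          ≈⟨ +-congˡ (*-congˡ (+-congˡ (*-congˡ (σ-commute i j i+1<j f)))) ⟩
        a * (b * f + b′ * σ j f) + a′ * (b * σ i f + b′ * σ j (σ i f))
          ≈⟨ solve 8 (λ a a′ b b′ f fi fj fij → a :* (b :* f :+ b′ :* fj) :+ a′ :* (b :* fi :+ b′ :* fij) :=
               b :* (a :* f :+ a′ :* fi) :+ b′ :* (a :* fj :+ a′ :* fij)) refl a a′ b b′ f _ _ _ ⟩
        b * (a * f + a′ * σ i f) + b′ * (a * σ j f + a′ * σ j (σ i f))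
          ≈⟨ +-congˡ (*-congˡ (σ-τ j (s-α′ j j-lo j-hi) (s-1+α′ j j-hi j-lo))) ⟨
        b * (a * f + a′ * σ i f) + b′ * σ j (a * f + a′ * σ i f) ∎
        where
        a  = α (inject₁ i) (suc i)
        a′ = 1# + α (suc i) (inject₁ i)
        b  = α (inject₁ j) (suc j)
        b′ = 1# + α (suc j) (inject₁ j)
        i<j : toℕ i ℕ.< toℕ j
        i<j = ℕ.<-trans (ℕ.n<1+n _) i+1<j
        i-lo : swap i (inject₁ j) ≡ inject₁ j
        i-lo = swap-fixes i _ (λ e → ℕ.<⇒≢ i<j (≡.sym (≡.trans (≡.sym (Fin.toℕ-inject₁ j)) e)))
          (λ e → ℕ.<⇒≢ i+1<j (≡.sym (≡.trans (≡.sym (Fin.toℕ-inject₁ j)) e)))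
        i-hi : swap i (suc j) ≡ suc j
        i-hi = swap-fixes i _ (λ e → ℕ.<⇒≢ (ℕ.<-trans i<j (ℕ.n<1+n _)) (≡.sym e))
          (λ e → ℕ.<⇒≢ (s≤s i<j) (≡.sym e))
        j-lo : swap j (inject₁ i) ≡ inject₁ i
        j-lo = swap-fixes j _ (λ e → ℕ.<⇒≢ i<j (≡.trans (≡.sym (Fin.toℕ-inject₁ i)) e))
          (λ e → ℕ.<⇒≢ (ℕ.<-trans i<j (ℕ.n<1+n _)) (≡.trans (≡.sym (Fin.toℕ-inject₁ i)) e))
        j-hi : swap j (suc i) ≡ suc i
        j-hi = swap-fixes j _ (ℕ.<⇒≢ i+1<j) (ℕ.<⇒≢ (s≤s i<j))

      braiding : ∀ i j → toℕ j ≡ suc (toℕ i) → ∀ f → τ i (τ j (τ i f)) ≈ τ j (τ i (τ j f))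
      braiding i j j≡i+1 f = begin
        τ i (τ j (τ i f))
          ≈⟨ +-cong (*-congˡ τjτi) (*-congˡ (trans (σ-cong i τjτi) (trans
               (σ-τ i (s-α′ i i-b i-c) (s-1+α′ i i-c i-b))
               (+-cong (*-congˡ (trans (σ-τ i (s-α′ i i-a i-b) (s-1+α′ i i-b i-a)) (+-congˡ (*-congˡ (σ-invol i f)))))
                       (*-congˡ (σ-τ i (s-α′ i i-a i-c) (s-1+α′ i i-c i-a))))))) ⟩
        left A′ B′
          -- Only A′ and B′ are eliminated by means of `opposite`; Γ′ can remain a free symbol of
          -- the polynomial identity.
          ≈⟨ expand (solve-opposite (opposite a≢b)) (solve-opposite (opposite b≢c)) ⟩
        right A′ B′
          ≈⟨ +-congˡ (*-congˡ (+-congˡ (*-congˡ (+-congˡ (*-congˡ (σ-braid i j j≡i+1 f)))))) ⟩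
        B * (A * (B * f + (1# + B′) * fj) + (1# + A′) * (Γ * fi + (1# + Γ′) * fij)) +
        (1# + B′) * (Γ * (B′ * fj + (1# + B) * f) + (1# + Γ′) * (A * fji + (1# + A′) * σ j fij))
          ≈⟨ +-cong (*-congˡ τiτj) (*-congˡ (trans (σ-cong j τiτj) (trans
               (σ-τ j (s-α′ j j-a j-b) (s-1+α′ j j-b j-a))
               (+-cong (*-congˡ (trans (σ-τ j (s-α′ j j-b j-c) (s-1+α′ j j-c j-b)) (+-congˡ (*-congˡ (σ-invol j f)))))
                       (*-congˡ (σ-τ j (s-α′ j j-a j-c) (s-1+α′ j j-c j-a))))))) ⟨
        B * τ i (τ j f) + (1# + B′) * σ j (τ i (τ j f))
          ≈⟨ τ-j (τ i (τ j f)) ⟨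
        τ j (τ i (τ j f)) ∎
        where
        a = inject₁ i
        b = suc i
        d = suc j
        A  = α a b
        A′ = α b a
        B  = α b d
        B′ = α d b
        Γ  = α a d
        Γ′ = α d a
        fi  = σ i f
        fj  = σ j f
        fij = σ i (σ j f)
        fji = σ j (σ i f)

        lo-j : inject₁ j ≡ b
        lo-j = Fin.toℕ-injective (≡.trans (Fin.toℕ-inject₁ j) j≡i+1)
        i-a : swap i a ≡ b
        i-a = swap-lo i
        i-b : swap i b ≡ a
        i-b = swap-hi i
        i-c : swap i d ≡ d
        i-c = swap-fixes i d (λ e → ℕ.<⇒≢ (ℕ.≤-trans (ℕ.n≤1+n _) (ℕ.≤-reflexive (cong suc (≡.sym j≡i+1)))) (≡.sym e))
          (λ e → ℕ.<⇒≢ (ℕ.≤-reflexive (cong suc (≡.sym j≡i+1))) (≡.sym e))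
        j-a : swap j a ≡ a
        j-a = swap-fixes j a (λ e → ℕ.<⇒≢ i<j (≡.trans (≡.sym (Fin.toℕ-inject₁ i)) e))
          (λ e → ℕ.<⇒≢ (ℕ.<-trans i<j (ℕ.n<1+n _)) (≡.trans (≡.sym (Fin.toℕ-inject₁ i)) e))
          where
          i<j : toℕ i ℕ.< toℕ j
          i<j = ℕ.≤-reflexive (≡.sym j≡i+1)
        j-b : swap j b ≡ d
        j-b = ≡.trans (cong (swap j) (≡.sym lo-j)) (swap-lo j)
        j-c : swap j d ≡ b
        j-c = ≡.trans (swap-hi j) lo-j

        a≢b : a ≢ b
        a≢b e = ℕ.<⇒≢ (ℕ.n<1+n _) (≡.trans (≡.sym (Fin.toℕ-inject₁ i)) (cong toℕ e))
        b≢c : b ≢ d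
        b≢c e = ℕ.<⇒≢ (ℕ.≤-reflexive (cong suc (≡.sym j≡i+1))) (cong toℕ e)
        a≢c : a ≢ d
        a≢c e = ℕ.<⇒≢ (ℕ.m≤n⇒m≤1+n (ℕ.≤-reflexive (≡.sym j≡i+1))) (≡.trans (≡.sym (Fin.toℕ-inject₁ i)) (cong toℕ e))

        τ-j : ∀ g → τ j g ≈ B * g + (1# + B′) * σ j g
        τ-j g = reflexive (cong (λ p → α p d * g + (1# + α d p) * σ j g) lo-j)

        τjτi : τ j (τ i f) ≈ B * (A * f + (1# + A′) * fi) + (1# + B′) * (Γ * fj + (1# + Γ′) * fji)
        τjτi = trans (τ-j (τ i f)) (+-congˡ (*-congˡ (σ-τ j (s-α′ j j-a j-b) (s-1+α′ j j-b j-a))))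

        τiτj : τ i (τ j f) ≈ A * (B * f + (1# + B′) * fj) + (1# + A′) * (Γ * fi + (1# + Γ′) * fij)
        τiτj = trans (τ-congruent Y i (τ-j f)) (+-congˡ (*-congˡ (σ-τ i (s-α′ i i-b i-c) (s-1+α′ i i-c i-b))))

        solve-opposite : ∀ {x y} → x + y ≈ - u → y ≈ - u - x
        solve-opposite {x} {y} p = begin
          y              ≈⟨ solve 2 (λ x y → y := x :+ y :- x) refl x y ⟩
          x + y - x      ≈⟨ +-congʳ p ⟩
          - u - x        ∎

        left right : Carrier → Carrier → Carrier
        left A′ B′ =
          A * (B * (A * f + (1# + A′) * fi) + (1# + B′) * (Γ * fj + (1# + Γ′) * fji)) +
          (1# + A′) * (Γ * (A′ * fi + (1# + A) * f) + (1# + Γ′) * (B * fij + (1# + B′) * σ i fji))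
        right A′ B′ =
          B * (A * (B * f + (1# + B′) * fj) + (1# + A′) * (Γ * fi + (1# + Γ′) * fij)) +
          (1# + B′) * (Γ * (B′ * fj + (1# + B) * f) + (1# + Γ′) * (A * fji + (1# + A′) * σ i fji))

        -- Comparing coefficients, the two sides differ by a multiple of
        -- A B − Γ (u + A + B).
        expand : A′ ≈ - u - A → B′ ≈ - u - B → left A′ B′ ≈ right A′ B′
        expand p q = begin
          left A′ B′
            ≈⟨ left-cong p q ⟩
          left (- u - A) (- u - B)
            ≈⟨ solve 11 (λ u A B Γ Γ′ f fi fj fij fji w →
                 let A′ = :- u :- A ; B′ = :- u :- B in
                 A :* (B :* (A :* f :+ (𝟙 :+ A′) :* fi) :+ (𝟙 :+ B′) :* (Γ :* fj :+ (𝟙 :+ Γ′) :* fji)) :+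
                 (𝟙 :+ A′) :* (Γ :* (A′ :* fi :+ (𝟙 :+ A) :* f) :+ (𝟙 :+ Γ′) :* (B :* fij :+ (𝟙 :+ B′) :* w)) :=
                 B :* (A :* (B :* f :+ (𝟙 :+ B′) :* fj) :+ (𝟙 :+ A′) :* (Γ :* fi :+ (𝟙 :+ Γ′) :* fij)) :+
                 (𝟙 :+ B′) :* (Γ :* (B′ :* fj :+ (𝟙 :+ B) :* f) :+ (𝟙 :+ Γ′) :* (A :* fji :+ (𝟙 :+ A′) :* w)) :+
                 ((A :- B) :* f :+ (𝟙 :+ A′) :* fi :- (𝟙 :+ B′) :* fj) :* (A :* B :- Γ :* (u :+ A :+ B)))
               refl u A B Γ Γ′ f fi fj fij fji (σ i fji) ⟩
          right (- u - A) (- u - B) + e * (A * B - Γ * (u + A + B))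
            ≈⟨ +-congˡ (trans (*-congˡ (trans (+-congʳ (triple a≢b b≢c a≢c)) (-‿inverseʳ _))) (zeroʳ e)) ⟩
          right (- u - A) (- u - B) + 0#
            ≈⟨ +-identityʳ _ ⟩
          right (- u - A) (- u - B)
            ≈⟨ right-cong p q ⟨
          right A′ B′ ∎
          where
          e = (A - B) * f + (1# + (- u - A)) * fi - (1# + (- u - B)) * fj
          left-cong : ∀ {x x′ y y′} → x ≈ x′ → y ≈ y′ → left x y ≈ left x′ y′
          left-cong p q = +-cong
            (*-congˡ (+-cong (*-congˡ (+-congˡ (*-congʳ (+-congˡ p)))) (*-congʳ (+-congˡ q))))
            (*-cong (+-congˡ p) (+-cong (*-congˡ (+-congʳ (*-congʳ p))) (*-congˡ (+-congˡ (*-congʳ (+-congˡ q))))))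
          right-cong : ∀ {x x′ y y′} → x ≈ x′ → y ≈ y′ → right x y ≈ right x′ y′
          right-cong p q = +-cong
            (*-congˡ (+-cong (*-congˡ (+-congˡ (*-congʳ (+-congˡ q)))) (*-congʳ (+-congˡ p))))
            (*-cong (+-congˡ q) (+-cong (*-congˡ (+-congʳ (*-congʳ q))) (*-congˡ (+-congˡ (*-congʳ (+-congˡ p))))))

    τ-braided : Braided τ
    τ-braided = record { τ-cong = τ-congruent Y ; commute = commuting ; braid = braiding }

  -- s_i permutes the factors of the triangle, except for the one of the pair (i, i+1), which it
  -- reverses. Stated crosswise to avoid a division.
  triangle-swap : ∀ {m} (Y : System m) → let open System Y in ∀ i →
    s i (triangle α) * (1# + α (inject₁ i) (suc i)) ≈ triangle α * (1# + α (suc i) (inject₁ i))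
  triangle-swap {suc zero} Y zero = begin
    s zero (firstRow α * 1#) * (1# + α zero (suc zero))
      ≈⟨ *-congʳ (trans (s-* zero _ _) (*-cong (firstRow-swap Y) (s-1 zero))) ⟩
    (1# + α (suc zero) zero) * 1# * 1# * (1# + α zero (suc zero))
      ≈⟨ solve 2 (λ x y → x :* 𝟙 :* 𝟙 :* y := y :* 𝟙 :* 𝟙 :* x) refl _ _ ⟩
    (1# + α zero (suc zero)) * 1# * 1# * (1# + α (suc zero) zero) ∎
    where
    open System Y
  triangle-swap {suc (suc m)} Y zero = begin
    s zero (firstRow α * (D′ * Δ″)) * (1# + α zero (suc zero))
      ≈⟨ *-congʳ (trans (s-* zero _ _) (*-cong (firstRow-swap Y) (trans (s-* zero _ _) (*-cong s-D′ s-Δ″)))) ⟩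
    (1# + α (suc zero) zero) * D′ * (D₁ * Δ″) * (1# + α zero (suc zero))
      ≈⟨ solve 5 (λ x y D′ D₁ Δ″ → x :* D′ :* (D₁ :* Δ″) :* y := y :* D₁ :* (D′ :* Δ″) :* x) refl _ _ _ _ _ ⟩
    (1# + α zero (suc zero)) * D₁ * (D′ * Δ″) * (1# + α (suc zero) zero) ∎
    where
    open System Y
    D′ = firstRow λ a b → α (suc a) (suc b)
    D₁ = product λ r → 1# + α zero (suc (suc r))
    Δ″ = triangle λ a b → α (suc (suc a)) (suc (suc b))
    s-D′ : s zero D′ ≈ D₁
    s-D′ = trans (s-product Y zero λ r → 1# + α (suc zero) (suc (suc r)))
      (product-cong λ r → s-1+α Y zero (suc zero) (suc (suc r)))
    s-triangle : ∀ {n} (α′ : Fin (suc n) → Fin (suc n) → Carrier) →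
                 (∀ a b → s zero (α′ a b) ≈ α′ a b) → s zero (triangle α′) ≈ triangle α′
    s-triangle {zero}  α′ s-α′ = s-1 zero
    s-triangle {suc n} α′ s-α′ = trans (s-* zero _ _) (*-cong
      (trans (s-product Y zero λ r → 1# + α′ zero (suc r))
        (product-cong λ r → trans (s-+ zero _ _) (+-cong (s-1 zero) (s-α′ zero (suc r)))))
      (s-triangle (λ a b → α′ (suc a) (suc b)) λ a b → s-α′ (suc a) (suc b)))
    s-Δ″ : s zero Δ″ ≈ Δ″
    s-Δ″ = s-triangle (λ a b → α (suc (suc a)) (suc (suc b))) λ a b → s-α zero (suc (suc a)) (suc (suc b))
  triangle-swap {suc m} Y (suc i) = begin
    s (suc i) (firstRow α * Δ′) * (1# + α (suc (inject₁ i)) (suc (suc i)))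
      ≈⟨ *-congʳ (trans (s-* (suc i) _ _) (*-congʳ (firstRow-invariant Y i))) ⟩
    firstRow α * s (suc i) Δ′ * (1# + α (suc (inject₁ i)) (suc (suc i)))
      ≈⟨ trans (*-assoc _ _ _) (*-congˡ (triangle-swap (restrict Y) i)) ⟩
    firstRow α * (Δ′ * (1# + α (suc (suc i)) (suc (inject₁ i))))
      ≈⟨ *-assoc _ _ _ ⟨
    firstRow α * Δ′ * (1# + α (suc (suc i)) (suc (inject₁ i))) ∎
    where
    open System Y
    Δ′ = triangle λ a b → α (suc a) (suc b)

-- The bosonic and the fermionic system

module Frames {c c≈} (F : CommutativeRing c c≈) where
  open CommutativeRing F hiding (zero)
  open Algebra.Properties.Ring ring using (-‿distribˡ-*; -‿distribʳ-*; -‿involutive; -‿+-comm)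
  open Algebra.Properties.Semiring.Exp semiring public using (_^_; ^-homo-*; ^-congˡ)
  open Algebra.Properties.CommutativeSemiring.Exp commutativeSemiring public using (^-distrib-*)
  open Operators setoid
  open CodeSum +-commutativeMonoid
  open IntegerRingSolver F
  open SetoidReasoning setoid
  open Symmetrizer F
  open BraidRelations F
  open Algebra.Properties.CommutativeMonoid.Sum *-commutativeMonoid
    using () renaming (sum to product; sum-cong-≋ to product-cong)

  -- Here `z` is an integer power. The factor x^N removes the shift by ℓ(w₀) from the exponents in
  -- 𝟏₀ and ε₀, whichever sign they have.
  integer-power-shift : ∀ {x y} (z : ℤ → Carrier) → (∀ a → z (+ a) ≡ x ^ a) → (∀ a → z -[1+ a ] ≡ y ^ suc a) →
                        x * y ≈ 1# → ∀ N a → x ^ N * z (+ a ℤ.- + N) ≈ x ^ a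
  integer-power-shift {x} {y} z z-+ z-- xy≈1 N a =
    trans (*-congˡ (reflexive (cong z (ℤ.m-n≡m⊖n a N)))) (shift N a)
    where
    1^N≈1 : ∀ N → 1# ^ N ≈ 1#
    1^N≈1 zero    = refl
    1^N≈1 (suc N) = trans (*-identityˡ _) (1^N≈1 N)
    shift : ∀ N a → x ^ N * z (a ℤ.⊖ N) ≈ x ^ a
    shift zero    a       = trans (*-identityˡ _) (reflexive (z-+ a))
    shift (suc N) zero    = trans (*-congˡ (reflexive (z-- N)))
      (trans (sym (^-distrib-* x y (suc N))) (trans (^-congˡ (suc N) xy≈1) (1^N≈1 (suc N))))
    shift (suc N) (suc a) = trans (*-congˡ (reflexive (cong z (ℤ.[1+m]⊖[1+n]≡m⊖n a N))))
      (trans (*-assoc x _ _) (*-congˡ (shift N a)))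

  pull-scalar : ∀ {m} A W (B C X : Code m → Carrier) → (∀ c → A * B c ≈ C c) →
                (A * W) * ∑ᶜ (λ c → B c * X c) ≈ W * ∑ᶜ (λ c → C c * X c)
  pull-scalar A W B C X AB≈C = begin
    A * W * ∑ᶜ (λ c → B c * X c)
      ≈⟨ solve 3 (λ A W S → A :* W :* S := W :* (A :* S)) refl A W _ ⟩
    W * (A * ∑ᶜ (λ c → B c * X c))
      ≈⟨ *-congˡ (additive-∑ᶜ *-congˡ (distribˡ A) (λ c → B c * X c)) ⟩
    W * ∑ᶜ (λ c → A * (B c * X c))
      ≈⟨ *-congˡ (∑ᶜ-cong λ c → trans (sym (*-assoc A _ _)) (*-congʳ (AB≈C c))) ⟩
    W * ∑ᶜ (λ c → C c * X c) ∎

  upper : ∀ {m} → (Fin (suc m) → Fin (suc m) → Carrier) → Carrier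
  upper {zero}  f = 1#
  upper {suc m} f = product (λ r → f zero (suc r)) * upper λ a b → f (suc a) (suc b)

  upper-cong : ∀ {m} {f g : Fin (suc m) → Fin (suc m) → Carrier} →
               (∀ a b → a < b → f a b ≈ g a b) → upper f ≈ upper g
  upper-cong {zero}  p = refl
  upper-cong {suc m} p = *-cong (product-cong λ r → p zero (suc r) (s≤s z≤n)) (upper-cong λ a b a<b → p (suc a) (suc b) (s≤s a<b))

  product-scale : ∀ {n} k (f : Fin n → Carrier) → product (λ r → k * f r) ≈ k ^ n * product f
  product-scale {zero}  k f = sym (*-identityˡ 1#)
  product-scale {suc n} k f = trans (*-congˡ (product-scale k (f ∘ suc)))
    (solve 4 (λ k p f₀ P → k :* f₀ :* (p :* P) := k :* p :* (f₀ :* P)) refl k (k ^ n) (f zero) (product (f ∘ suc)))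

  upper-scale : ∀ {m} k (f : Fin (suc m) → Fin (suc m) → Carrier) →
                upper (λ a b → k * f a b) ≈ k ^ len (longest m) * upper f
  upper-scale {zero}  k f = sym (*-identityˡ 1#)
  upper-scale {suc m} k f = begin
    product (λ r → k * f zero (suc r)) * upper (λ a b → k * f (suc a) (suc b))
      ≈⟨ *-cong (product-scale k λ r → f zero (suc r)) (upper-scale k λ a b → f (suc a) (suc b)) ⟩
    k ^ suc m * P * (k ^ N * U)
      ≈⟨ solve 4 (λ p P q U → p :* P :* (q :* U) := p :* q :* (P :* U)) refl (k ^ suc m) P (k ^ N) U ⟩
    k ^ suc m * k ^ N * (P * U)
      ≈⟨ *-congʳ (trans (sym (^-homo-* k (suc m) N)) (reflexive (cong (λ e → k ^ (e ℕ.+ N)) (≡.sym (Fin.toℕ-fromℕ (suc m)))))) ⟩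
    k ^ len (longest (suc m)) * (P * U) ∎
    where
    N = len (longest m)
    P = product λ r → f zero (suc r)
    U = upper λ a b → f (suc a) (suc b)

  product-upper : ∀ {m} (f g : Fin (suc m) → Fin (suc m) → Carrier) →
                  (∀ a b → a < b → f a b ≈ g a b) → (∀ a b → ¬ a < b → f a b ≈ 1#) →
                  product (λ a → product (f a)) ≈ upper g
  product-upper {zero}  f g f≈g f≈1 =
    trans (*-identityʳ _) (trans (*-identityʳ _) (f≈1 zero zero λ ()))
  product-upper {suc m} f g f≈g f≈1 = *-cong
    (trans (*-cong (f≈1 zero zero λ ()) (product-cong λ b → f≈g zero (suc b) (s≤s z≤n))) (*-identityˡ _))
    (trans (product-cong {y = λ a → product λ b → f (suc a) (suc b)} λ a → trans (*-congʳ (f≈1 (suc a) zero λ ())) (*-identityˡ _))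
      (product-upper (λ a b → f (suc a) (suc b)) (λ a b → g (suc a) (suc b))
        (λ a b a<b → f≈g (suc a) (suc b) (s≤s a<b)) λ a b a≮b → f≈1 (suc a) (suc b) λ { (s≤s a<b) → a≮b a<b }))

  -- The blocks of f are separate arguments so that unification can find the local
  -- function in the definition of ∏<, which has no name outside Defs.
  product-upper-blocks : ∀ {m} {corner : Carrier} {row column : Fin m → Carrier} {rest : Fin m → Fin m → Carrier}
    (g : Fin (suc m) → Fin (suc m) → Carrier) →
    corner ≈ 1# → (∀ b → row b ≈ g zero (suc b)) → (∀ a → column a ≈ 1#) →
    (∀ a b → a < b → rest a b ≈ g (suc a) (suc b)) → (∀ a b → ¬ a < b → rest a b ≈ 1#) →
    corner * product row * product (λ a → column a * product (rest a)) ≈ upper g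
  product-upper-blocks {m} {corner} {row} {column} {rest} g corner≈1 row≈g column≈1 rest≈g rest≈1 =
    product-upper f g f≈g f≈1
    where
    f : Fin (suc m) → Fin (suc m) → Carrier
    f zero    zero    = corner
    f zero    (suc b) = row b
    f (suc a) zero    = column a
    f (suc a) (suc b) = rest a b
    f≈g : ∀ a b → a < b → f a b ≈ g a b
    f≈g zero    (suc b) _         = row≈g b
    f≈g (suc a) (suc b) (s≤s a<b) = rest≈g a b a<b
    f≈1 : ∀ a b → ¬ a < b → f a b ≈ 1#
    f≈1 zero    zero    _   = corner≈1
    f≈1 zero    (suc b) a≮b = contradiction (s≤s z≤n) a≮b
    f≈1 (suc a) zero    _   = column≈1 a
    f≈1 (suc a) (suc b) a≮b = rest≈1 a b (a≮b ∘ s≤s)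

  triangle≈upper : ∀ {m} (α : Fin (suc m) → Fin (suc m) → Carrier) → triangle α ≈ upper λ a b → 1# + α a b
  triangle≈upper {zero}  α = refl
  triangle≈upper {suc m} α = *-congˡ (triangle≈upper λ a b → α (suc a) (suc b))

  Unit : Carrier → Set (c ⊔ c≈)
  Unit a = ∃ λ b → a * b ≈ 1#

  Unit-resp : ∀ a b → a ≈ b → Unit a → Unit b
  Unit-resp a b a≈b (a⁻¹ , p) = a⁻¹ , trans (*-congʳ (sym a≈b)) p

  -- Congruences with explicit arguments, for rings whose operations unfold.
  minus-congˡ : ∀ a b b′ → b ≈ b′ → a - b ≈ a - b′
  minus-congˡ a b b′ p = +-congˡ (-‿cong p)

  times-congˡ : ∀ a b b′ → b ≈ b′ → a * b ≈ a * b′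
  times-congˡ a b b′ p = *-congˡ p

  times-congʳ : ∀ a a′ b → a ≈ a′ → a * b ≈ a′ * b
  times-congʳ a a′ b p = *-congʳ p

  times-cong : ∀ a a′ b b′ → a ≈ a′ → b ≈ b′ → a * b ≈ a′ * b′
  times-cong a a′ b b′ p q = *-cong p q

  plus-cong : ∀ a a′ b b′ → a ≈ a′ → b ≈ b′ → a + b ≈ a′ + b′
  plus-cong a a′ b b′ p q = +-cong p q

  scaled-remainder : ∀ e a x₀ y d z w l p → e ≈ a * x₀ * y → y ≈ d * z + w * l → a * d ≈ 1# → x₀ * z ≈ p →
                     e ≈ p + w * (a * x₀ * l)
  scaled-remainder e a x₀ y d z w l p e≈ y≈ ad≈1 x₀z≈p = begin
    e                                       ≈⟨ trans e≈ (*-congˡ y≈) ⟩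
    a * x₀ * (d * z + w * l)
      ≈⟨ solve 6 (λ a x d z w l → a :* x :* (d :* z :+ w :* l) := (a :* d) :* (x :* z) :+ w :* (a :* x :* l)) refl a x₀ d z w l ⟩
    a * d * (x₀ * z) + w * (a * x₀ * l)     ≈⟨ +-congʳ (trans (*-cong ad≈1 x₀z≈p) (*-identityˡ p)) ⟩
    p + w * (a * x₀ * l)                    ∎

  divide-cancel : ∀ d a r x → x ≈ a * r → d * r ≈ 1# → d * x ≈ a
  divide-cancel d a r x p q = begin
    d * x          ≈⟨ *-congˡ p ⟩
    d * (a * r)    ≈⟨ solve 3 (λ d a r → d :* (a :* r) := (d :* r) :* a) refl d a r ⟩
    d * r * a      ≈⟨ trans (*-congʳ q) (*-identityˡ a) ⟩
    a              ∎

  factor-out : ∀ p a r x y → x ≈ p * a * r → y ≈ a * r → x ≈ p * y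
  factor-out p a r x y x≈ y≈ = trans x≈ (trans (*-assoc p a r) (*-congˡ (sym y≈)))

  minus-hom : ∀ a a′ b b′ → a ≈ a′ → b ≈ - b′ → a + b ≈ a′ - b′
  minus-hom a a′ b b′ p q = +-cong p q

  negated-root : ∀ h h⁻¹ t → h * h ≈ t → h * h⁻¹ ≈ 1# → h ≈ - h⁻¹ * - t
  negated-root h h⁻¹ t hh≈t hh⁻¹≈1 = sym (begin
    - h⁻¹ * - t           ≈⟨ *-congˡ (-‿cong hh≈t) ⟨
    - h⁻¹ * - (h * h)     ≈⟨ solve 2 (λ h k → (:- k) :* (:- (h :* h)) := (h :* k) :* h) refl h h⁻¹ ⟩
    h * h⁻¹ * h           ≈⟨ *-congʳ hh⁻¹≈1 ⟩
    1# * h                ≈⟨ *-identityˡ h ⟩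
    h                     ∎)

  negated-inverse : ∀ h h⁻¹ → h * h⁻¹ ≈ 1# → - h⁻¹ * - h ≈ 1#
  negated-inverse h h⁻¹ p = trans (solve 2 (λ h k → (:- k) :* (:- h) := h :* k) refl h h⁻¹) p

  Unit-* : ∀ {a b} → Unit a → Unit b → Unit (a * b)
  Unit-* {a} {b} (a⁻¹ , p) (b⁻¹ , q) = a⁻¹ * b⁻¹ , (begin
    a * b * (a⁻¹ * b⁻¹)      ≈⟨ solve 4 (λ a b x y → a :* b :* (x :* y) := (a :* x) :* (b :* y)) refl a b a⁻¹ b⁻¹ ⟩
    (a * a⁻¹) * (b * b⁻¹)    ≈⟨ *-cong p q ⟩
    1# * 1#                  ≈⟨ *-identityˡ 1# ⟩
    1#                       ∎)

  Unit-product : ∀ {n} (f : Fin n → Carrier) → (∀ r → Unit (f r)) → Unit (product f)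
  Unit-product {zero}  f units = 1# , *-identityˡ 1#
  Unit-product {suc n} f units = Unit-* (units zero) (Unit-product (f ∘ suc) (units ∘ suc))

  Unit-triangle : ∀ {m} (α : Fin (suc m) → Fin (suc m) → Carrier) →
                  (∀ {a b} → a ≢ b → Unit (1# + α a b)) → Unit (triangle α)
  Unit-triangle {zero}  α units = 1# , *-identityˡ 1#
  Unit-triangle {suc m} α units = Unit-* (Unit-product (λ r → 1# + α zero (suc r)) λ r → units λ ())
    (Unit-triangle (λ a b → α (suc a) (suc b)) λ a≢b → units (a≢b ∘ Fin.suc-injective))

  foldr-scale : ∀ {m} {τ υ : Fin m → Carrier → Carrier} {a} → (∀ i {f g} → f ≈ g → υ i f ≈ υ i g) →
                (∀ i f → τ i f ≈ a * υ i f) → (∀ i f → υ i (a * f) ≈ a * υ i f) →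
                ∀ is f → foldr τ f is ≈ a ^ length is * foldr υ f is
  foldr-scale υ-cong τ≈aυ υ-linear [] f = sym (*-identityˡ f)
  foldr-scale {_} {τ} {υ} {a} υ-cong τ≈aυ υ-linear (i ∷ is) f = begin
    τ i (foldr τ f is)                          ≈⟨ τ≈aυ i _ ⟩
    a * υ i (foldr τ f is)                      ≈⟨ *-congˡ (υ-cong i (foldr-scale υ-cong τ≈aυ υ-linear is f)) ⟩
    a * υ i (a ^ length is * foldr υ f is)      ≈⟨ *-congˡ (υ-power (length is)) ⟩
    a * (a ^ length is * υ i (foldr υ f is))    ≈⟨ *-assoc _ _ _ ⟨
    a ^ length (i ∷ is) * υ i (foldr υ f is)    ∎
    where
    υ-power : ∀ n {g} → υ i (a ^ n * g) ≈ a ^ n * υ i g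
    υ-power zero    = trans (υ-cong i (*-identityˡ _)) (sym (*-identityˡ _))
    υ-power (suc n) = trans (υ-cong i (*-assoc _ _ _))
      (trans (υ-linear i _) (trans (*-congˡ (υ-power n)) (sym (*-assoc _ _ _))))

  op-scale : ∀ {m} {τ υ : Fin m → Carrier → Carrier} {a} → (∀ i {f g} → f ≈ g → υ i f ≈ υ i g) →
             (∀ i f → τ i f ≈ a * υ i f) → (∀ i f → υ i (a * f) ≈ a * υ i f) →
             ∀ c f → op τ c f ≈ a ^ len c * op υ c f
  op-scale {_} {τ} {υ} {a} υ-cong τ≈aυ υ-linear c f = begin
    op τ c f                                             ≡⟨ foldr-toWord τ c f ⟨
    foldr τ f (toWord c)                                 ≈⟨ foldr-scale υ-cong τ≈aυ υ-linear (toWord c) f ⟩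
    a ^ length (toWord c) * foldr υ f (toWord c)
      ≡⟨ cong₂ (λ e g → a ^ e * g) (length-toWord c) (foldr-toWord υ c f) ⟩
    a ^ len c * op υ c f                                 ∎

  -- The facts about K(X) on which both identities rest, with `inv a b` for 1 / (x_a - x_b). No
  -- fraction has to be unfolded from here on.
  record Frame (m : ℕ) : Set (c ⊔ c≈) where
    field
      s         : Fin m → Carrier → Carrier
      s-+       : ∀ i f g → s i (f + g) ≈ s i f + s i g
      s-*       : ∀ i f g → s i (f * g) ≈ s i f * s i g
      s-1       : ∀ i → s i 1# ≈ 1#
      s-braided : Braided s
      s-invol   : Involutive s
      x         : Fin (suc m) → Carrier
      s-x       : ∀ i a → s i (x a) ≈ x (swap i a)
      inv       : Fin (suc m) → Fin (suc m) → Carrier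
      inv-inv   : ∀ {a b} → a ≢ b → (x a - x b) * inv a b ≈ 1#
      -- A default value. Being invariant, it lets `s-inv` hold for all pairs, equal or not.
      inv-diag  : ∀ a → inv a a ≈ 0#
      t t⁻¹     : Carrier
      t-inverse : t * t⁻¹ ≈ 1#
      s-t       : ∀ i → s i t ≈ t
      s-t⁻¹     : ∀ i → s i t⁻¹ ≈ t⁻¹
      diff-unit : ∀ {a b} → a ≢ b → Unit (x a - t⁻¹ * x b)
    open Braided s-braided public renaming (τ-cong to s-cong; commute to s-commute; braid to s-braid)

    s-neg : ∀ i f → s i (- f) ≈ - s i f
    s-neg i f = begin
      s i (- f)                    ≈⟨ solve 2 (λ x y → x := y :+ x :- y) refl _ _ ⟩
      s i f + s i (- f) - s i f    ≈⟨ +-congʳ (s-+ i f (- f)) ⟨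
      s i (f - f) - s i f          ≈⟨ +-congʳ (trans (s-cong i (-‿inverseʳ f)) (additive-0 (s-cong i) (s-+ i))) ⟩
      0# - s i f                   ≈⟨ +-identityˡ _ ⟩
      - s i f                      ∎

    s-inv : ∀ i a b → s i (inv a b) ≈ inv (swap i a) (swap i b)
    s-inv i a b with a Fin.≟ b
    ... | yes ≡.refl = trans (s-cong i (inv-diag a)) (trans (additive-0 (s-cong i) (s-+ i)) (sym (inv-diag _)))
    ... | no  a≢b    = begin
      s i (inv a b)                             ≈⟨ *-identityˡ _ ⟨
      1# * s i (inv a b)                        ≈⟨ *-congʳ (inv-inv sa≢sb) ⟨
      (x sa - x sb) * inv sa sb * s i (inv a b)
        ≈⟨ solve 3 (λ d v w → d :* v :* w := (d :* w) :* v) refl _ _ _ ⟩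
      ((x sa - x sb) * s i (inv a b)) * inv sa sb
        ≈⟨ *-congʳ (*-congʳ (trans (s-+ i _ _) (+-cong (s-x i a) (trans (s-neg i _) (-‿cong (s-x i b)))))) ⟨
      (s i (x a - x b) * s i (inv a b)) * inv sa sb
        ≈⟨ *-congʳ (trans (sym (s-* i _ _)) (trans (s-cong i (inv-inv a≢b)) (s-1 i))) ⟩
      1# * inv sa sb                            ≈⟨ *-identityˡ _ ⟩
      inv sa sb                                 ∎
      where
      sa = swap i a
      sb = swap i b
      sa≢sb : sa ≢ sb
      sa≢sb e = a≢b (≡.trans (≡.sym (swap-involutive i a)) (≡.trans (cong (swap i) e) (swap-involutive i b)))

    α : Carrier → Fin (suc m) → Fin (suc m) → Carrier
    α r a b = (1# - r) * (x b * inv a b)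

    1+α : ∀ r {a b} → a ≢ b → 1# + α r a b ≈ (x a - r * x b) * inv a b
    1+α r {a} {b} a≢b = begin
      1# + (1# - r) * (x b * inv a b)
        ≈⟨ +-congʳ (inv-inv a≢b) ⟨
      (x a - x b) * inv a b + (1# - r) * (x b * inv a b)
        ≈⟨ solve 4 (λ r x y i → (x :- y) :* i :+ (𝟙 :- r) :* (y :* i) := (x :- r :* y) :* i) refl r (x a) (x b) (inv a b) ⟩
      (x a - r * x b) * inv a b ∎

    inv-opposite : ∀ {a b} → a ≢ b → inv b a ≈ - inv a b
    inv-opposite {a} {b} a≢b = begin
      inv b a                                   ≈⟨ *-identityʳ _ ⟨
      inv b a * 1#                              ≈⟨ *-congˡ (inv-inv a≢b) ⟨
      inv b a * ((x a - x b) * inv a b)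
        ≈⟨ solve 4 (λ j x y i → j :* ((x :- y) :* i) := :- ((y :- x) :* j :* i)) refl _ (x a) (x b) _ ⟩
      - ((x b - x a) * inv b a * inv a b)       ≈⟨ -‿cong (*-congʳ (inv-inv (a≢b ∘ ≡.sym))) ⟩
      - (1# * inv a b)                          ≈⟨ -‿cong (*-identityˡ _) ⟩
      - inv a b                                 ∎

    -- From x_a - x_d = (x_a - x_b) + (x_b - x_d); this is the source of `triple` for the α's.
    inv-triple : ∀ {a b d} → a ≢ b → b ≢ d → a ≢ d → inv a b * inv b d ≈ inv a d * (inv a b + inv b d)
    inv-triple {a} {b} {d} a≢b b≢d a≢d = begin
      inv a b * inv b d
        ≈⟨ trans (sym (*-identityˡ _)) (*-congʳ (sym (inv-inv a≢d))) ⟩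
      (x a - x d) * inv a d * (inv a b * inv b d)
        ≈⟨ solve 6 (λ x y z i j k → (x :- z) :* k :* (i :* j) := k :* ((y :- z) :* j :* i :+ (x :- y) :* i :* j))
             refl (x a) (x b) (x d) (inv a b) (inv b d) (inv a d) ⟩
      inv a d * ((x b - x d) * inv b d * inv a b + (x a - x b) * inv a b * inv b d)
        ≈⟨ *-congˡ (+-cong (trans (*-congʳ (inv-inv b≢d)) (*-identityˡ _)) (trans (*-congʳ (inv-inv a≢b)) (*-identityˡ _))) ⟩
      inv a d * (inv a b + inv b d) ∎

    α-relations : ∀ r → Relations (1# - r) (α r)
    α-relations r = record
      { opposite = λ {a} {b} a≢b → begin
          (1# - r) * (x b * inv a b) + (1# - r) * (x a * inv b a)
            ≈⟨ +-congˡ (*-congˡ (*-congˡ (inv-opposite a≢b))) ⟩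
          (1# - r) * (x b * inv a b) + (1# - r) * (x a * - inv a b)
            ≈⟨ solve 4 (λ r x y i → (𝟙 :- r) :* (y :* i) :+ (𝟙 :- r) :* (x :* (:- i)) := :- ((𝟙 :- r) :* ((x :- y) :* i)))
                 refl r (x a) (x b) (inv a b) ⟩
          - ((1# - r) * ((x a - x b) * inv a b))
            ≈⟨ -‿cong (trans (*-congˡ (inv-inv a≢b)) (*-identityʳ _)) ⟩
          - (1# - r) ∎
      ; triple = λ {a} {b} {d} a≢b b≢d a≢d → begin
          (1# - r) * (x b * inv a b) * ((1# - r) * (x d * inv b d))
            ≈⟨ solve 5 (λ r y z i j → (𝟙 :- r) :* (y :* i) :* ((𝟙 :- r) :* (z :* j)) :=
                 (𝟙 :- r) :* (𝟙 :- r) :* (z :* y) :* (i :* j)) refl r (x b) (x d) (inv a b) (inv b d) ⟩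
          (1# - r) * (1# - r) * (x d * x b) * (inv a b * inv b d)
            ≈⟨ *-congˡ (inv-triple a≢b b≢d a≢d) ⟩
          (1# - r) * (1# - r) * (x d * x b) * (inv a d * (inv a b + inv b d))
            ≈⟨ solve 6 (λ r y z i j k → (𝟙 :- r) :* (𝟙 :- r) :* (z :* y) :* (k :* (i :+ j)) :=
                 (𝟙 :- r) :* (z :* k) :* ((𝟙 :- r) :* ((y :- z) :* j) :+ (𝟙 :- r) :* (y :* i) :+ (𝟙 :- r) :* (z :* j)))
                 refl r (x b) (x d) (inv a b) (inv b d) (inv a d) ⟩
          (1# - r) * (x d * inv a d) * ((1# - r) * ((x b - x d) * inv b d) + α r a b + α r b d)
            ≈⟨ *-congˡ (+-congʳ (+-congʳ (trans (*-congˡ (inv-inv b≢d)) (*-identityʳ _)))) ⟩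
          (1# - r) * (x d * inv a d) * (1# - r + α r a b + α r b d) ∎
      }

    s-α : ∀ {r} → (∀ i → s i r ≈ r) → ∀ i a b → s i (α r a b) ≈ α r (swap i a) (swap i b)
    s-α {r} s-r i a b = trans (s-* i _ _) (*-cong
      (trans (s-+ i _ _) (+-cong (s-1 i) (trans (s-neg i _) (-‿cong (s-r i)))))
      (trans (s-* i _ _) (*-cong (s-x i b) (s-inv i a b))))

    bosonic : System m
    bosonic = record
      { s = s ; s-cong = s-cong ; s-+ = s-+ ; s-* = s-* ; s-1 = s-1
      ; σ = s ; σ-+ = s-+ ; σ-* = s-* ; σ-braided = s-braided ; σ-invol = s-invol
      ; u = 1# - t ; α = α t ; s-α = s-α s-t ; relations = α-relations t
      }

    sgn-s : Fin m → Carrier → Carrier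
    sgn-s i f = - s i f

    fermionic : System m
    fermionic = record
      { s = s ; s-cong = s-cong ; s-+ = s-+ ; s-* = s-* ; s-1 = s-1
      ; σ = sgn-s
      ; σ-+ = λ i f g → trans (-‿cong (s-+ i f g)) (sym (-‿+-comm _ _))
      ; σ-* = λ i a f → trans (-‿cong (s-* i a f)) (-‿distribʳ-* _ _)
      ; σ-braided = record
        { τ-cong  = λ i p → -‿cong (s-cong i p)
        ; commute = λ i j p f → -‿cong (trans (s-neg i _) (trans (-‿cong (s-commute i j p f)) (sym (s-neg j _))))
        ; braid   = λ i j p f → -‿cong (trans (three i j f) (trans (s-braid i j p f) (sym (three j i f))))
        }
      ; σ-invol = λ i f → trans (-‿cong (s-neg i _)) (trans (-‿involutive _) (s-invol i f))
      ; u = 1# - t⁻¹ ; α = α t⁻¹ ; s-α = s-α s-t⁻¹ ; relations = α-relations t⁻¹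
      }
      where
      three : ∀ i j f → s i (- s j (- s i f)) ≈ s i (s j (s i f))
      three i j f = s-cong i (trans (-‿cong (s-neg j _)) (-‿involutive _))

    module 𝔹 = System bosonic
    module 𝔽 = System fermionic

    -- This is − t⁻½ T_i, as 𝔹.τ is t½ T_i.
    η : Fin m → Carrier → Carrier
    η i f = - t⁻¹ * 𝔹.τ i f

    Δ⁻ : Carrier
    Δ⁻ = triangle (α t⁻¹)

    -- Trades t for t⁻¹ at the cost of reversing the pair, and so compensates for the reversal in
    -- `triangle-swap`.
    reflect : ∀ {a b} → a ≢ b → t⁻¹ * (1# + α t b a) ≈ 1# + α t⁻¹ a b
    reflect {a} {b} a≢b = begin
      t⁻¹ * (1# + α t b a)
        ≈⟨ *-congˡ (1+α t (a≢b ∘ ≡.sym)) ⟩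
      t⁻¹ * ((x b - t * x a) * inv b a)
        ≈⟨ *-congˡ (*-congˡ (inv-opposite a≢b)) ⟩
      t⁻¹ * ((x b - t * x a) * - inv a b)
        ≈⟨ solve 5 (λ r t x y i → r :* ((y :- t :* x) :* (:- i)) := ((t :* r) :* x :- r :* y) :* i) refl t⁻¹ t (x a) (x b) (inv a b) ⟩
      (t * t⁻¹ * x a - t⁻¹ * x b) * inv a b
        ≈⟨ *-congʳ (+-congʳ (trans (*-congʳ t-inverse) (*-identityˡ _))) ⟩
      (x a - t⁻¹ * x b) * inv a b
        ≈⟨ 1+α t⁻¹ a≢b ⟨
      1# + α t⁻¹ a b ∎

    lo≢hi : ∀ (i : Fin m) → inject₁ i ≢ suc i
    lo≢hi i e = ℕ.<⇒≢ (ℕ.n<1+n _) (≡.trans (≡.sym (Fin.toℕ-inject₁ i)) (cong toℕ e))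

    -- Coefficients are compared: for f because 1 - t⁻¹ = -t⁻¹ (1 - t), and for s_i f by
    -- `triangle-swap` together with `reflect`.
    η-conjugate : ∀ i f → Δ⁻ * 𝔽.τ i f ≈ η i (Δ⁻ * f)
    η-conjugate i f = begin
      Δ⁻ * (e * f + (1# + e′) * - s i f)
        ≈⟨ solve 5 (λ Δ e e′ f g → Δ :* (e :* f :+ (𝟙 :+ e′) :* (:- g)) := e :* (Δ :* f) :- Δ :* (𝟙 :+ e′) :* g)
             refl Δ⁻ e e′ f (s i f) ⟩
      e * (Δ⁻ * f) - Δ⁻ * (1# + e′) * s i f
        ≈⟨ +-cong (*-congʳ first) (-‿cong (*-congʳ (trans (sym (triangle-swap fermionic i)) (*-congˡ (sym (reflect (lo≢hi i))))))) ⟩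
      - t⁻¹ * a * (Δ⁻ * f) - s i Δ⁻ * (t⁻¹ * (1# + a′)) * s i f
        ≈⟨ solve 6 (λ r a D E a′ g → (:- r) :* a :* D :- E :* (r :* a′) :* g := (:- r) :* (a :* D :+ a′ :* (E :* g)))
             refl t⁻¹ a (Δ⁻ * f) (s i Δ⁻) (1# + a′) (s i f) ⟩
      - t⁻¹ * (a * (Δ⁻ * f) + (1# + a′) * (s i Δ⁻ * s i f))
        ≈⟨ *-congˡ (+-congˡ (*-congˡ (s-* i Δ⁻ f))) ⟨
      - t⁻¹ * 𝔹.τ i (Δ⁻ * f) ∎
      where
      a  = α t (inject₁ i) (suc i)
      a′ = α t (suc i) (inject₁ i)
      e  = α t⁻¹ (inject₁ i) (suc i)
      e′ = α t⁻¹ (suc i) (inject₁ i)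
      first : e ≈ - t⁻¹ * a
      first = begin
        (1# - t⁻¹) * p                 ≈⟨ *-congʳ (+-congʳ t-inverse) ⟨
        (t * t⁻¹ - t⁻¹) * p            ≈⟨ solve 3 (λ t r p → (t :* r :- r) :* p := (:- r) :* ((𝟙 :- t) :* p)) refl t t⁻¹ p ⟩
        - t⁻¹ * ((1# - t) * p)         ∎
        where p = x (suc i) * inv (inject₁ i) (suc i)

    η-cong : ∀ i {f g} → f ≈ g → η i f ≈ η i g
    η-cong i p = *-congˡ (τ-congruent bosonic i p)

    antisymmetrizer : ∀ f → (∑ᶜ λ c → op η c f) ≈ Δ⁻ * ∑ᶜ λ c → op sgn-s c f
    antisymmetrizer f = begin
      (∑ᶜ λ c → op η c f)
        ≈⟨ ∑ᶜ-cong (λ c → trans (op-cong η-cong c (sym Δf′)) (sym (op-intertwine η-cong η-conjugate c f′))) ⟩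
      (∑ᶜ λ c → Δ⁻ * op 𝔽.τ c f′)
        ≈⟨ additive-∑ᶜ *-congˡ (distribˡ Δ⁻) (λ c → op 𝔽.τ c f′) ⟨
      Δ⁻ * (∑ᶜ λ c → op 𝔽.τ c f′)
        ≈⟨ *-congˡ (symmetrizer fermionic f′) ⟩
      Δ⁻ * (∑ᶜ λ c → op sgn-s c (Δ⁻ * f′))
        ≈⟨ *-congˡ (∑ᶜ-cong λ c → op-cong (𝔽.σ-cong) c Δf′) ⟩
      Δ⁻ * (∑ᶜ λ c → op sgn-s c f) ∎
      where
      Δ⁻-unit : Unit Δ⁻
      Δ⁻-unit = Unit-triangle (α t⁻¹) λ {a} {b} a≢b → let y , p = diff-unit a≢b in
        (x a - x b) * y , (begin
          (1# + α t⁻¹ a b) * ((x a - x b) * y)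
            ≈⟨ *-congʳ (1+α t⁻¹ a≢b) ⟩
          (x a - t⁻¹ * x b) * inv a b * ((x a - x b) * y)
            ≈⟨ solve 4 (λ e i d y → e :* i :* (d :* y) := (e :* y) :* (d :* i)) refl _ _ _ _ ⟩
          ((x a - t⁻¹ * x b) * y) * ((x a - x b) * inv a b)
            ≈⟨ *-cong p (inv-inv a≢b) ⟩
          1# * 1#  ≈⟨ *-identityˡ 1# ⟩
          1#       ∎)
      -- Dividing by `Δ⁻` in advance cancels the triangle that `symmetrizer` puts inside the sum, so
      -- that only the `Δ⁻` in front survives.
      f′ = proj₁ Δ⁻-unit * f
      Δf′ : Δ⁻ * f′ ≈ f
      Δf′ = trans (sym (*-assoc _ _ _)) (trans (*-congʳ (proj₂ Δ⁻-unit)) (*-identityˡ f))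

    τ-linear : ∀ {r} → (∀ i → s i r ≈ r) → ∀ i f → 𝔹.τ i (r * f) ≈ r * 𝔹.τ i f
    τ-linear {r} s-r i f = trans (+-congˡ (*-congˡ (trans (s-* i r f) (*-congʳ (s-r i)))))
      (solve 5 (λ a b r f g → a :* (r :* f) :+ b :* (r :* g) := r :* (a :* f :+ b :* g)) refl _ _ r f (s i f))

    op-η : ∀ c f → op η c f ≈ (- t⁻¹) ^ len c * op 𝔹.τ c f
    op-η = op-scale (τ-congruent bosonic) (λ _ _ → refl)
      (τ-linear λ i → trans (s-neg i t⁻¹) (-‿cong (s-t⁻¹ i)))

    op-sgn-s : ∀ c f → op sgn-s c f ≈ (- 1#) ^ len c * op s c f
    op-sgn-s = op-scale s-cong
      (λ i f → sym (trans (sym (-‿distribˡ-* 1# _)) (-‿cong (*-identityˡ _))))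
      (λ i f → trans (s-* i _ f) (*-congʳ (trans (s-neg i 1#) (-‿cong (s-1 i)))))

    upper-bosonic : upper (λ a b → (x a - t * x b) * inv a b) ≈ triangle (α t)
    upper-bosonic = sym (trans (triangle≈upper (α t)) (upper-cong λ a b a<b → 1+α t (Fin.<⇒≢ a<b)))

    -- Each of the n(n-1)/2 pairs contributes a factor -t, as x_b - t x_a = -t (x_a - t⁻¹ x_b);
    -- `len (longest m)` counts the pairs.
    upper-fermionic : upper (λ a b → (x b - t * x a) * inv a b) ≈ (- t) ^ len (longest m) * Δ⁻
    upper-fermionic = trans (upper-cong λ a b a<b → entry (Fin.<⇒≢ a<b))
      (trans (upper-scale (- t) (λ a b → 1# + α t⁻¹ a b)) (*-congˡ (sym (triangle≈upper (α t⁻¹)))))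
      where
      entry : ∀ {a b} → a ≢ b → (x b - t * x a) * inv a b ≈ - t * (1# + α t⁻¹ a b)
      entry {a} {b} a≢b = sym (begin
        - t * (1# + α t⁻¹ a b)                    ≈⟨ *-congˡ (1+α t⁻¹ a≢b) ⟩
        - t * ((x a - t⁻¹ * x b) * inv a b)
          ≈⟨ solve 5 (λ t r x y i → (:- t) :* ((x :- r :* y) :* i) := ((t :* r) :* y :- t :* x) :* i) refl t t⁻¹ (x a) (x b) _ ⟩
        (t * t⁻¹ * x b - t * x a) * inv a b       ≈⟨ *-congʳ (+-congʳ (trans (*-congʳ t-inverse) (*-identityˡ _))) ⟩
        (x b - t * x a) * inv a b                 ∎)

    -- With y = x_{i+1} / x_i, d = 1 / (1 − y) and h = t^½.
    hecke-τ : ∀ i {h h⁻¹ y d} → h * h ≈ t → h * h⁻¹ ≈ 1# → (∀ i → s i h ≈ h) → x (inject₁ i) * y ≈ x (suc i) →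
              (1# - y) * d ≈ 1# → ∀ f g → g ≈ (h⁻¹ - h * y) * d * f →
              h * (- h⁻¹ * f + (g + s i g)) ≈ 𝔹.τ i f
    hecke-τ i {h} {h⁻¹} {y} {d} hh hh⁻¹ s-h xy d-inv f g g≈Gf = begin
      h * (- h⁻¹ * f + (g + s i g))
        ≈⟨ *-congˡ (+-congˡ (+-cong g≈Gf (s-cong i g≈Gf))) ⟩
      h * (- h⁻¹ * f + (G * f + s i (G * f)))
        ≈⟨ *-congˡ (+-congˡ (+-congˡ (s-* i G f))) ⟩
      h * (- h⁻¹ * f + (G * f + s i G * s i f))
        ≈⟨ solve 6 (λ h k f g sg sf → h :* ((:- k) :* f :+ (g :* f :+ sg :* sf)) := (:- (h :* k)) :* f :+ (h :* g) :* f :+ (h :* sg) :* sf)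
             refl h h⁻¹ f G (s i G) (s i f) ⟩
      - (h * h⁻¹) * f + h * G * f + h * s i G * s i f
        ≈⟨ +-cong (+-cong (*-congʳ (-‿cong hh⁻¹)) (*-congʳ hG)) (*-congʳ hsG) ⟩
      - 1# * f + (1# + a) * f + (1# + a′) * s i f
        ≈⟨ solve 4 (λ a b f g → (:- 𝟙) :* f :+ (𝟙 :+ a) :* f :+ b :* g := a :* f :+ b :* g) refl a (1# + a′) f (s i f) ⟩
      a * f + (1# + a′) * s i f ∎
      where
      a  = α t (inject₁ i) (suc i)
      a′ = α t (suc i) (inject₁ i)
      G  = (h⁻¹ - h * y) * d
      xₗ = x (inject₁ i)
      v  = inv (inject₁ i) (suc i)
      d≈xv : d ≈ xₗ * v
      d≈xv = begin
        d                                    ≈⟨ *-identityʳ d ⟨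
        d * 1#                               ≈⟨ *-congˡ (inv-inv (lo≢hi i)) ⟨
        d * ((xₗ - x (suc i)) * v)           ≈⟨ *-congˡ (*-congʳ (+-congˡ (-‿cong xy))) ⟨
        d * ((xₗ - xₗ * y) * v)              ≈⟨ solve 4 (λ d x y v → d :* ((x :- x :* y) :* v) := ((𝟙 :- y) :* d) :* (x :* v)) refl d xₗ y v ⟩
        (1# - y) * d * (xₗ * v)              ≈⟨ trans (*-congʳ d-inv) (*-identityˡ _) ⟩
        xₗ * v                               ∎
      hG : h * G ≈ 1# + a
      hG = begin
        h * ((h⁻¹ - h * y) * d)              ≈⟨ *-congˡ (*-congˡ d≈xv) ⟩
        h * ((h⁻¹ - h * y) * (xₗ * v))
          ≈⟨ solve 5 (λ h k y x v → h :* ((k :- h :* y) :* (x :* v)) := ((h :* k) :* x :- (h :* h) :* (x :* y)) :* v) refl h h⁻¹ y xₗ v ⟩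
        (h * h⁻¹ * xₗ - h * h * (xₗ * y)) * v
          ≈⟨ *-congʳ (+-cong (trans (*-congʳ hh⁻¹) (*-identityˡ _)) (-‿cong (*-cong hh xy))) ⟩
        (xₗ - t * x (suc i)) * v             ≈⟨ 1+α t (lo≢hi i) ⟨
        1# + a                               ∎
      hsG : h * s i G ≈ 1# + a′
      hsG = begin
        h * s i G              ≈⟨ *-congʳ (s-h i) ⟨
        s i h * s i G          ≈⟨ s-* i h G ⟨
        s i (h * G)            ≈⟨ s-cong i hG ⟩
        s i (1# + a)           ≈⟨ s-1+α bosonic i (inject₁ i) (suc i) ⟩
        1# + α t (swap i (inject₁ i)) (swap i (suc i))  ≡⟨ cong₂ (λ p q → 1# + α t p q) (swap-lo i) (swap-hi i) ⟩
        1# + a′                ∎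

    module Hecke {h h⁻¹ : Carrier} (hh≈t : h * h ≈ t) (hh⁻¹≈1 : h * h⁻¹ ≈ 1#)
                 (s-h : ∀ i → s i h ≈ h) (s-h⁻¹ : ∀ i → s i h⁻¹ ≈ h⁻¹)
                 (T : Fin m → Carrier → Carrier) (hT≈τ : ∀ i f → h * T i f ≈ 𝔹.τ i f) where
      T≈h⁻¹τ : ∀ i f → T i f ≈ h⁻¹ * 𝔹.τ i f
      T≈h⁻¹τ i f = begin
        T i f                   ≈⟨ *-identityˡ _ ⟨
        1# * T i f              ≈⟨ *-congʳ (trans (*-comm h⁻¹ h) hh⁻¹≈1) ⟨
        h⁻¹ * h * T i f         ≈⟨ *-assoc _ _ _ ⟩
        h⁻¹ * (h * T i f)       ≈⟨ *-congˡ (hT≈τ i f) ⟩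
        h⁻¹ * 𝔹.τ i f           ∎

      T-cong : ∀ i {f g} → f ≈ g → T i f ≈ T i g
      T-cong i {f} {g} p = trans (T≈h⁻¹τ i f) (trans (*-congˡ (τ-congruent bosonic i p)) (sym (T≈h⁻¹τ i g)))

      T-linear : ∀ {r} → (∀ i → s i r ≈ r) → ∀ i f → T i (r * f) ≈ r * T i f
      T-linear {r} s-r i f = begin
        T i (r * f)             ≈⟨ T≈h⁻¹τ i (r * f) ⟩
        h⁻¹ * 𝔹.τ i (r * f)     ≈⟨ *-congˡ (τ-linear s-r i f) ⟩
        h⁻¹ * (r * 𝔹.τ i f)     ≈⟨ solve 3 (λ k r f → k :* (r :* f) := r :* (k :* f)) refl h⁻¹ r _ ⟩
        r * (h⁻¹ * 𝔹.τ i f)     ≈⟨ *-congˡ (T≈h⁻¹τ i f) ⟨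
        r * T i f               ∎

      module _ (words : Coxeter.ReducedWords m) where
        open Coxeter.ReducedWords words

        Tᶜ : Code m → Carrier → Carrier
        Tᶜ c f = foldr T f (word (perm c))

        bosonic-word : ∀ c f → h ^ ℓ (perm c) * Tᶜ c f ≈ op 𝔹.τ c f
        bosonic-word c f = begin
          h ^ ℓ (perm c) * Tᶜ c f
            ≈⟨ foldr-scale T-cong (λ i g → sym (hT≈τ i g)) (T-linear s-h) (word (perm c)) f ⟨
          foldr 𝔹.τ f (word (perm c))
            ≈⟨ op-reduced (τ-braided bosonic) (word (perm c)) (word-minimal words (perm c)) f ⟩
          op 𝔹.τ (fromWord (word (perm c))) f
            ≡⟨ cong (λ d → op 𝔹.τ d f) (fromWord-word words c) ⟩
          op 𝔹.τ c f ∎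

        -- Since -t⁻½ = -t⁻¹ · t½, this is the bosonic statement multiplied by (-t⁻¹)^ℓ.
        fermionic-word : ∀ c f → (- h⁻¹) ^ ℓ (perm c) * Tᶜ c f ≈ op η c f
        fermionic-word c f = begin
          (- h⁻¹) ^ ℓ (perm c) * Tᶜ c f
            ≈⟨ *-congʳ (trans (^-congˡ (ℓ (perm c)) -h⁻¹) (^-distrib-* (- t⁻¹) h (ℓ (perm c)))) ⟩
          (- t⁻¹) ^ ℓ (perm c) * h ^ ℓ (perm c) * Tᶜ c f
            ≈⟨ trans (*-assoc _ _ _) (*-congˡ (bosonic-word c f)) ⟩
          (- t⁻¹) ^ ℓ (perm c) * op 𝔹.τ c f
            ≡⟨ cong (λ e → (- t⁻¹) ^ e * op 𝔹.τ c f) (ℓ-perm words c) ⟩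
          (- t⁻¹) ^ len c * op 𝔹.τ c f
            ≈⟨ op-η c f ⟨
          op η c f ∎
          where
          -h⁻¹ : - h⁻¹ ≈ - t⁻¹ * h
          -h⁻¹ = begin
            - h⁻¹                      ≈⟨ -‿cong (trans (sym (*-identityˡ h⁻¹)) (*-congʳ (sym t-inverse))) ⟩
            - (t * t⁻¹ * h⁻¹)          ≈⟨ -‿cong (*-congʳ (*-congʳ hh≈t)) ⟨
            - (h * h * t⁻¹ * h⁻¹)      ≈⟨ solve 3 (λ h k r → :- (h :* h :* r :* k) := (:- r) :* h :* (h :* k)) refl h h⁻¹ t⁻¹ ⟩
            - t⁻¹ * h * (h * h⁻¹)      ≈⟨ trans (*-congˡ hh⁻¹≈1) (*-identityʳ _) ⟩
            - t⁻¹ * h                  ∎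

        symmetrizer-words : ∀ f → ∑ᶜ (λ c → h ^ ℓ (perm c) * Tᶜ c f) ≈ ∑ᶜ λ c → op s c (triangle (α t) * f)
        symmetrizer-words f = trans (∑ᶜ-cong λ c → bosonic-word c f) (symmetrizer bosonic f)

        antisymmetrizer-words : ∀ f → ∑ᶜ (λ c → (- h⁻¹) ^ ℓ (perm c) * Tᶜ c f) ≈
                                      Δ⁻ * ∑ᶜ λ c → (- 1#) ^ ℓ (perm c) * op s c f
        antisymmetrizer-words f = trans (∑ᶜ-cong λ c → fermionic-word c f) (trans (antisymmetrizer f)
          (*-congˡ (∑ᶜ-cong λ c → trans (op-sgn-s c f) (*-congʳ (reflexive (cong ((- 1#) ^_) (≡.sym (ℓ-perm words c))))))))

-- Laurent polynomials regular at t½ = 1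

module Lattices {c c≈} (F : CommutativeRing c c≈) where
  open CommutativeRing F hiding (zero)
  open Operators setoid
  open CodeSum +-commutativeMonoid
  open Algebra.Properties.Ring ring using (-‿distribˡ-*)
  open IntegerRingSolver F
  open SetoidReasoning setoid
  open Symmetrizer F
  open Frames F
  open Algebra.Properties.Semiring.Sum semiring using (sum)

  -- In the application `O` holds of the scalars of K that are regular at t½ = 1, and `z` is t½.
  record LatticeData {m} (frame : Frame m) o : Set (c ⊔ c≈ ⊔ Level.suc o) where
    open Frame frame
    field
      O           : Carrier → Set o
      O-invariant : ∀ {a} → O a → ∀ i → s i a ≈ a
      O-1         : O 1#
      O--1        : O (- 1#)
      x⁻¹         : Fin (suc m) → Carrier
      x-inverse   : ∀ a → x a * x⁻¹ a ≈ 1#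
      z           : Carrier
      O-z         : O z
      zz≈t        : z * z ≈ t

  module Lattice {m o} {frame : Frame m} (data-of : LatticeData frame o) where
    open Frame frame
    open LatticeData data-of

    -- O[x₁^±1, …, xₙ^±1]
    data L : Carrier → Set (c ⊔ c≈ ⊔ o) where
      L-O   : ∀ {a} → O a → L a
      L-x   : ∀ a → L (x a)
      L-x⁻¹ : ∀ a → L (x⁻¹ a)
      L-+   : ∀ {f g} → L f → L g → L (f + g)
      L-*   : ∀ {f g} → L f → L g → L (f * g)
      L-≈   : ∀ {f g} → f ≈ g → L f → L g

    L-1 : L 1#
    L-1 = L-O O-1

    L-neg : ∀ {f} → L f → L (- f)
    L-neg {f} Lf = L-≈ (trans (sym (-‿distribˡ-* 1# f)) (-‿cong (*-identityˡ f))) (L-* (L-O O--1) Lf)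

    L-0 : L 0#
    L-0 = L-≈ (-‿inverseʳ 1#) (L-+ L-1 (L-neg L-1))

    s-x⁻¹ : ∀ i a → s i (x⁻¹ a) ≈ x⁻¹ (swap i a)
    s-x⁻¹ i a = begin
      s i (x⁻¹ a)                               ≈⟨ *-identityʳ _ ⟨
      s i (x⁻¹ a) * 1#                          ≈⟨ *-congˡ (x-inverse b) ⟨
      s i (x⁻¹ a) * (x b * x⁻¹ b)               ≈⟨ solve 3 (λ y x w → y :* (x :* w) := (x :* y) :* w) refl _ _ _ ⟩
      (x b * s i (x⁻¹ a)) * x⁻¹ b               ≈⟨ *-congʳ (*-congʳ (s-x i a)) ⟨
      (s i (x a) * s i (x⁻¹ a)) * x⁻¹ b         ≈⟨ *-congʳ (s-* i _ _) ⟨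
      s i (x a * x⁻¹ a) * x⁻¹ b                 ≈⟨ *-congʳ (trans (s-cong i (x-inverse a)) (s-1 i)) ⟩
      1# * x⁻¹ b                                ≈⟨ *-identityˡ _ ⟩
      x⁻¹ b                                     ∎
      where b = swap i a

    L-s : ∀ i {f} → L f → L (s i f)
    L-s i (L-O Oa)    = L-≈ (sym (O-invariant Oa i)) (L-O Oa)
    L-s i (L-x a)     = L-≈ (sym (s-x i a)) (L-x _)
    L-s i (L-x⁻¹ a)   = L-≈ (sym (s-x⁻¹ i a)) (L-x⁻¹ _)
    L-s i (L-+ p q)   = L-≈ (sym (s-+ i _ _)) (L-+ (L-s i p) (L-s i q))
    L-s i (L-* p q)   = L-≈ (sym (s-* i _ _)) (L-* (L-s i p) (L-s i q))
    L-s i (L-≈ f≈g p) = L-≈ (s-cong i f≈g) (L-s i p)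

    D : Fin m → Carrier → Carrier
    D i f = (f - s i f) * inv (inject₁ i) (suc i)

    D-cong : ∀ i {f g} → f ≈ g → D i f ≈ D i g
    D-cong i p = *-congʳ (+-cong p (-‿cong (s-cong i p)))

    D-invariant : ∀ i {f} → s i f ≈ f → D i f ≈ 0#
    D-invariant i {f} p = trans (*-congʳ (trans (+-congˡ (-‿cong p)) (-‿inverseʳ f))) (zeroˡ _)

    D-product : ∀ i f g → D i (f * g) ≈ D i f * g + s i f * D i g
    D-product i f g = trans (*-congʳ (+-congˡ (-‿cong (s-* i f g))))
      (solve 5 (λ f g f′ g′ v → (f :* g :- f′ :* g′) :* v := (f :- f′) :* v :* g :+ f′ :* ((g :- g′) :* v)) refl _ _ _ _ _)

    D-lo : ∀ i → D i (x (inject₁ i)) ≈ 1#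
    D-lo i = trans (*-congʳ (+-congˡ (-‿cong (trans (s-x i _) (reflexive (cong x (swap-lo i)))))))
      (inv-inv (lo≢hi i))

    L-Dx : ∀ i a → L (D i (x a))
    L-Dx i a with a Fin.≟ inject₁ i | a Fin.≟ suc i
    ... | yes ≡.refl | _          = L-≈ (sym (D-lo i)) L-1
    ... | no _       | yes ≡.refl = L-≈ (sym (begin
      (x (suc i) - s i (x (suc i))) * v         ≈⟨ *-congʳ (+-congˡ (-‿cong (trans (s-x i _) (reflexive (cong x (swap-hi i)))))) ⟩
      (x (suc i) - x (inject₁ i)) * v           ≈⟨ solve 3 (λ x y v → (y :- x) :* v := :- ((x :- y) :* v)) refl _ _ _ ⟩
      - ((x (inject₁ i) - x (suc i)) * v)       ≈⟨ -‿cong (inv-inv (lo≢hi i)) ⟩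
      - 1#                                      ∎)) (L-O O--1)
      where v = inv (inject₁ i) (suc i)
    ... | no a≢lo    | no a≢hi    = L-≈ (sym (D-invariant i (trans (s-x i a) (reflexive (cong x
      (swap-fixes i a (λ e → a≢lo (Fin.toℕ-injective (≡.trans e (≡.sym (Fin.toℕ-inject₁ i))))) (a≢hi ∘ Fin.toℕ-injective))))))) L-0

    -- By the twisted Leibniz rule the generators suffice, and the inverse variables follow from D_i
    -- (x x⁻¹) = 0. This is where the denominators x_i - x_{i+1} of (E2) and of the Hecke operators
    -- disappear.
    L-D : ∀ i {f} → L f → L (D i f)
    L-D i (L-O Oa)    = L-≈ (sym (D-invariant i (O-invariant Oa i))) L-0
    L-D i (L-x a)     = L-Dx i a
    L-D i (L-x⁻¹ a)   = L-≈ (sym derivative) (L-neg (L-* (L-* (L-s i (L-x⁻¹ a)) (L-x⁻¹ a)) (L-Dx i a)))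
      where
      y = x⁻¹ a
      derivative : D i y ≈ - (s i y * y * D i (x a))
      derivative = begin
        D i y                                             ≈⟨ *-identityˡ _ ⟨
        1# * D i y
          ≈⟨ *-congʳ (trans (sym (s-* i (x a) y)) (trans (s-cong i (x-inverse a)) (s-1 i))) ⟨
        s i (x a) * s i y * D i y
          ≈⟨ solve 5 (λ sx sy dy dx y → sx :* sy :* dy := sy :* (dx :* y :+ sx :* dy) :- sy :* y :* dx) refl _ _ _ (D i (x a)) y ⟩
        s i y * (D i (x a) * y + s i (x a) * D i y) - s i y * y * D i (x a)
          ≈⟨ +-congʳ (*-congˡ (trans (sym (D-product i (x a) y)) (trans (D-cong i (x-inverse a)) (D-invariant i (s-1 i))))) ⟩
        s i y * 0# - s i y * y * D i (x a)                ≈⟨ trans (+-congʳ (zeroʳ _)) (+-identityˡ _) ⟩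
        - (s i y * y * D i (x a))                         ∎
    L-D i {f} (L-+ {g} {h} p q) = L-≈ (sym (begin
      (g + h - s i (g + h)) * v               ≈⟨ *-congʳ (+-congˡ (-‿cong (s-+ i g h))) ⟩
      (g + h - (s i g + s i h)) * v
        ≈⟨ solve 5 (λ g h g′ h′ v → (g :+ h :- (g′ :+ h′)) :* v := (g :- g′) :* v :+ (h :- h′) :* v) refl _ _ _ _ _ ⟩
      D i g + D i h                           ∎)) (L-+ (L-D i p) (L-D i q))
      where v = inv (inject₁ i) (suc i)
    L-D i (L-* p q)   = L-≈ (sym (D-product i _ _)) (L-+ (L-* (L-D i p) q) (L-* (L-s i p) (L-D i q)))
    L-D i (L-≈ f≈g p) = L-≈ (D-cong i f≈g) (L-D i p)

    -- Equality at t½ = 1.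
    infix 4 _≡ᴸ_
    record _≡ᴸ_ (f g : Carrier) : Set (c ⊔ c≈ ⊔ o) where
      constructor congruent
      field
        {quotient} : Carrier
        L-quotient : L quotient
        difference : f ≈ g + (1# - z) * quotient
    open _≡ᴸ_ public

    L-1-z : L (1# - z)
    L-1-z = L-+ L-1 (L-neg (L-O O-z))

    ≡ᴸ-refl : ∀ {f} → f ≡ᴸ f
    ≡ᴸ-refl {f} = congruent L-0 (sym (trans (+-congˡ (zeroʳ _)) (+-identityʳ f)))

    ≡ᴸ-resp : ∀ {f f′ g g′} → f ≈ f′ → g ≈ g′ → f ≡ᴸ g → f′ ≡ᴸ g′
    ≡ᴸ-resp p q (congruent Ll d) = congruent Ll (trans (sym p) (trans d (+-congʳ q)))

    ≡ᴸ-trans : ∀ {f g h} → f ≡ᴸ g → g ≡ᴸ h → f ≡ᴸ h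
    ≡ᴸ-trans (congruent Lp p) (congruent Lq q) = congruent (L-+ Lq Lp)
      (trans p (trans (+-congʳ q) (trans (+-assoc _ _ _) (+-congˡ (sym (distribˡ _ _ _))))))

    ≡ᴸ-+ : ∀ {f f′ g g′} → f ≡ᴸ f′ → g ≡ᴸ g′ → f + g ≡ᴸ f′ + g′
    ≡ᴸ-+ (congruent Lp p) (congruent Lq q) = congruent (L-+ Lp Lq)
      (trans (+-cong p q) (solve 5 (λ f g z a b → (f :+ (𝟙 :- z) :* a) :+ (g :+ (𝟙 :- z) :* b) :=
        (f :+ g) :+ (𝟙 :- z) :* (a :+ b)) refl _ _ z _ _))

    ≡ᴸ-*ˡ : ∀ {h f g} → L h → f ≡ᴸ g → h * f ≡ᴸ h * g
    ≡ᴸ-*ˡ {h} {f} {g} Lh (congruent {l} Ll p) = congruent (L-* Lh Ll) (trans (*-congˡ p)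
      (solve 4 (λ h g z l → h :* (g :+ (𝟙 :- z) :* l) := h :* g :+ (𝟙 :- z) :* (h :* l)) refl h g z l))

    ≡ᴸ-s : ∀ i {f g} → f ≡ᴸ g → s i f ≡ᴸ s i g
    ≡ᴸ-s i {f} {g} (congruent {l} Ll p) = congruent (L-s i Ll) (begin
      s i f                                 ≈⟨ s-cong i p ⟩
      s i (g + (1# - z) * l)                ≈⟨ s-+ i _ _ ⟩
      s i g + s i ((1# - z) * l)            ≈⟨ +-congˡ (s-* i _ _) ⟩
      s i g + s i (1# - z) * s i l
        ≈⟨ +-congˡ (*-congʳ (trans (s-+ i _ _) (+-cong (s-1 i) (trans (s-neg i z) (-‿cong (O-invariant O-z i)))))) ⟩
      s i g + (1# - z) * s i l              ∎)

    L-≡ᴸ : ∀ {f g} → f ≡ᴸ g → L g → L f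
    L-≡ᴸ (congruent Ll p) Lg = L-≈ (sym p) (L-+ Lg (L-* L-1-z Ll))

    ≡ᴸ-sum : ∀ {m} {f g : Code m → Carrier} → (∀ c → f c ≡ᴸ g c) → ∑ᶜ f ≡ᴸ ∑ᶜ g
    ≡ᴸ-sum {zero}  p = p []
    ≡ᴸ-sum {suc m} p = fin-sum λ j → ≡ᴸ-sum λ c → p (j ∷ c)
      where
      fin-sum : ∀ {n} {f g : Fin n → Carrier} → (∀ j → f j ≡ᴸ g j) → sum f ≡ᴸ sum g
      fin-sum {zero}  p = ≡ᴸ-refl
      fin-sum {suc n} p = ≡ᴸ-+ (p zero) (fin-sum (p ∘ suc))

    -- With 1 − t = (1 − z)(1 + z), the intertwiner of (E2) is s_i up to a multiple of 1 − z.
    intertwiner : ∀ i {e κ κ′} → L e → L κ′ → κ ≈ (1# - t) * κ′ →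
                  D i (x (inject₁ i) * e) - t * x (inject₁ i) * D i e + κ * e ≡ᴸ s i e
    intertwiner i {e} {κ} {κ′} Le Lκ′ κ≈ = congruent
      (L-* (L-+ L-1 (L-O O-z)) (L-+ (L-* (L-x (inject₁ i)) (L-D i Le)) (L-* Lκ′ Le))) (begin
      D i (xₗ * e) - t * xₗ * d + κ * e
        ≈⟨ +-cong (+-congʳ (trans (D-product i xₗ e) (+-cong (trans (*-congʳ (D-lo i)) (*-identityˡ e))
             (*-congʳ (trans (s-x i _) (reflexive (cong x (swap-lo i)))))))) (*-congʳ κ≈) ⟩
      e + xₕ * d - t * xₗ * d + (1# - t) * κ′ * e
        ≈⟨ solve 6 (λ e xₗ xₕ d t κ → e :+ xₕ :* d :- t :* xₗ :* d :+ (𝟙 :- t) :* κ :* e :=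
             e :- (xₗ :- xₕ) :* d :+ (𝟙 :- t) :* (xₗ :* d :+ κ :* e)) refl e xₗ xₕ d t κ′ ⟩
      e - (xₗ - xₕ) * d + (1# - t) * (xₗ * d + κ′ * e)
        ≈⟨ +-cong undo (trans (*-congʳ (+-congˡ (-‿cong (sym zz≈t))))
             (solve 2 (λ z y → (𝟙 :- z :* z) :* y := (𝟙 :- z) :* ((𝟙 :+ z) :* y)) refl z _)) ⟩
      s i e + (1# - z) * ((1# + z) * (xₗ * d + κ′ * e)) ∎)
      where
      xₗ = x (inject₁ i)
      xₕ = x (suc i)
      v  = inv (inject₁ i) (suc i)
      d  = D i e
      undo : e - (xₗ - xₕ) * d ≈ s i e
      undo = begin
        e - (xₗ - xₕ) * ((e - s i e) * v)
          ≈⟨ solve 4 (λ e y f v → e :- y :* ((e :- f) :* v) := e :- (y :* v) :* (e :- f)) refl e (xₗ - xₕ) (s i e) v ⟩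
        e - (xₗ - xₕ) * v * (e - s i e)
          ≈⟨ +-congˡ (-‿cong (trans (*-congʳ (inv-inv (lo≢hi i))) (*-identityˡ _))) ⟩
        e - (e - s i e)
          ≈⟨ solve 2 (λ e f → e :- (e :- f) := f) refl e (s i e) ⟩
        s i e ∎

    -- τ_i f = s_i f + (1 - t)(x_i D_i f - f), and 1 - t = (1 - z)(1 + z).
    τ≡s : ∀ i {f} → L f → 𝔹.τ i f ≡ᴸ s i f
    τ≡s i {f} Lf = congruent
      (L-* (L-+ L-1 (L-O O-z)) (L-+ (L-* (L-x (inject₁ i)) (L-D i Lf)) (L-neg Lf))) (begin
      (1# - t) * (xₕ * v) * f + (1# + (1# - t) * (xₗ * inv (suc i) (inject₁ i))) * s i f
        ≈⟨ +-congˡ (*-congʳ (+-congˡ (*-congˡ (*-congˡ (inv-opposite (lo≢hi i)))))) ⟩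
      (1# - t) * (xₕ * v) * f + (1# + (1# - t) * (xₗ * - v)) * s i f
        ≈⟨ solve 6 (λ f g xₗ xₕ v t → (𝟙 :- t) :* (xₕ :* v) :* f :+ (𝟙 :+ (𝟙 :- t) :* (xₗ :* (:- v))) :* g :=
             g :+ (𝟙 :- t) :* (xₗ :* ((f :- g) :* v) :- ((xₗ :- xₕ) :* v) :* f)) refl f (s i f) xₗ xₕ v t ⟩
      s i f + (1# - t) * (xₗ * D i f - (xₗ - xₕ) * v * f)
        ≈⟨ +-congˡ (*-cong (+-congˡ (-‿cong (sym zz≈t))) (+-congˡ (-‿cong (trans (*-congʳ (inv-inv (lo≢hi i))) (*-identityˡ f))))) ⟩
      s i f + (1# - z * z) * (xₗ * D i f - f)
        ≈⟨ +-congˡ (solve 2 (λ z y → (𝟙 :- z :* z) :* y := (𝟙 :- z) :* ((𝟙 :+ z) :* y)) refl z _) ⟩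
      s i f + (1# - z) * ((1# + z) * (xₗ * D i f - f)) ∎)
      where
      xₗ = x (inject₁ i)
      xₕ = x (suc i)
      v  = inv (inject₁ i) (suc i)

    op-τ≡s : ∀ c {f g} → L g → f ≡ᴸ g → op 𝔹.τ c f ≡ᴸ op s c g
    op-τ≡s c Lg f≡g = ≡ᴸ-resp (reflexive (foldr-toWord 𝔹.τ c _)) (reflexive (foldr-toWord s c _)) (proj₂ (go (toWord c)))
      where
      -- Membership in `L` is carried along because `τ≡s` needs it for the argument at every letter.
      go : ∀ is → L (foldr s _ is) × foldr 𝔹.τ _ is ≡ᴸ foldr s _ is
      go []       = Lg , f≡g
      go (i ∷ is) with go is
      ... | Lh , p = L-s i Lh , ≡ᴸ-trans (τ≡s i (L-≡ᴸ p Lh)) (≡ᴸ-s i p)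

-- Fractions and Laurent polynomials

module FractionProperties {c ℓ} (R : CommutativeRing c ℓ) where
  open CommutativeRing R
  open TotalFractions R
  private module Q = CommutativeRing Frac-commutativeRing

  -- Abstract, since terms over K(X) grow out of hand when their fractions are unfolded.
  abstract
    fromR-cong : ∀ {a b} → a ≈ b → fromR a Q.≈ fromR b
    fromR-cong p = cross (*-congʳ p)

    fromR-injective : ∀ {a b} → fromR a Q.≈ fromR b → a ≈ b
    fromR-injective (cross p) = trans (sym (*-identityʳ _)) (trans p (*-identityʳ _))

    fromR-+ : ∀ a b → fromR (a + b) Q.≈ fromR a Q.+ fromR b
    fromR-+ a b = cross (trans (*-congˡ (*-identityˡ 1#))
      (*-congʳ (sym (+-cong (*-identityʳ a) (*-identityʳ b)))))

    fromR-* : ∀ a b → fromR (a * b) Q.≈ fromR a Q.* fromR b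
    fromR-* a b = cross (*-congˡ (*-identityˡ 1#))

    fromR-neg : ∀ a → fromR (- a) Q.≈ Q.- fromR a
    fromR-neg a = Q.refl

    fromR-minus : ∀ a b → fromR (a - b) Q.≈ fromR a Q.- fromR b
    fromR-minus a b = fromR-+ a (- b)

  reciprocal : ∀ d → Regular d → Frac
  reciprocal d rd = frac 1# d rd

  abstract
    reciprocal-inverse : ∀ d rd → fromR d Q.* reciprocal d rd Q.≈ Q.1#
    reciprocal-inverse d rd = cross (trans (*-identityʳ _) (trans (*-identityʳ d)
      (trans (sym (*-identityˡ d)) (sym (*-identityˡ _)))))

    ÷≈* : ∀ f d rd → f ÷ (d , rd) Q.≈ f Q.* reciprocal d rd
    ÷≈* f d rd = cross (*-congʳ (sym (*-identityʳ _)))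

    frac-≡ : ∀ {f g} → num f ≡ num g → den f ≡ den g → f Q.≈ g
    frac-≡ {frac a d _} {frac .a .d _} ≡.refl ≡.refl = cross refl

permuteExponent-cong : ∀ {n} {w w′ : Permutation′ n} → w ≈ₚ w′ → ∀ μ → permuteExponent w μ ≡ permuteExponent w′ μ
permuteExponent-cong {_} {w} {w′} p μ = Vec.tabulate-cong λ j → cong (lookup μ) (begin
  w ⟨$⟩ˡ j                          ≡⟨ inverseˡ w′ ⟨
  w′ ⟨$⟩ˡ (w′ ⟨$⟩ʳ (w ⟨$⟩ˡ j))      ≡⟨ cong (w′ ⟨$⟩ˡ_) (p (w ⟨$⟩ˡ j)) ⟨
  w′ ⟨$⟩ˡ (w ⟨$⟩ʳ (w ⟨$⟩ˡ j))       ≡⟨ cong (w′ ⟨$⟩ˡ_) (inverseʳ w) ⟩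
  w′ ⟨$⟩ˡ j                         ∎)
  where
  open ≡.≡-Reasoning

permuteExponent-∘ : ∀ {n} (w w′ : Permutation′ n) μ →
                    permuteExponent (w ∘ₚ w′) μ ≡ permuteExponent w′ (permuteExponent w μ)
permuteExponent-∘ w w′ μ = Vec.tabulate-cong λ j → ≡.sym (Vec.lookup∘tabulate _ (w′ ⟨$⟩ˡ j))

permuteExponent-id : ∀ {n} (μ : Exponent n) → permuteExponent idₚ μ ≡ μ
permuteExponent-id μ = Vec.tabulate∘lookup μ

permuteExponent-𝟎 : ∀ {n} (w : Permutation′ n) → permuteExponent w 𝟎 ≡ 𝟎
permuteExponent-𝟎 w = lookup-ext λ i → ≡.trans (Vec.lookup∘tabulate _ i)
  (≡.trans (Vec.lookup-replicate (w ⟨$⟩ˡ i) 0ℤ) (≡.sym (Vec.lookup-replicate i 0ℤ)))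

lookup-unit-≢ : ∀ {n} {a b : Fin n} → b ≢ a → lookup (unit a) b ≡ 0ℤ
lookup-unit-≢ {_} {a} {b} b≢a = ≡.trans (Vec.lookup∘update′ b≢a 𝟎 1ℤ) (Vec.lookup-replicate b 0ℤ)

lookup-unit : ∀ {n} (a : Fin n) → lookup (unit a) a ≡ 1ℤ
lookup-unit a = Vec.lookup∘update a 𝟎 1ℤ

permuteExponent-unit : ∀ {n} (w : Permutation′ n) a → permuteExponent w (unit a) ≡ unit (w ⟨$⟩ʳ a)
permuteExponent-unit w a = lookup-ext λ j → ≡.trans (Vec.lookup∘tabulate _ j) (entry j)
  where
  entry : ∀ j → lookup (unit a) (w ⟨$⟩ˡ j) ≡ lookup (unit (w ⟨$⟩ʳ a)) j
  entry j with w ⟨$⟩ˡ j Fin.≟ a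
  ... | yes ≡.refl = ≡.trans (lookup-unit (w ⟨$⟩ˡ j)) (≡.sym
    (≡.trans (cong (λ b → lookup (unit b) j) (inverseʳ w)) (lookup-unit j)))
  ... | no  p = ≡.trans (lookup-unit-≢ p) (≡.sym
    (lookup-unit-≢ λ q → p (≡.trans (cong (w ⟨$⟩ˡ_) q) (inverseˡ w))))

⊞-identityˡ : ∀ {n} (α : Exponent n) → 𝟎 ⊞ α ≡ α
⊞-identityˡ = Vec.zipWith-identityˡ ℤ.+-identityˡ

module LaurentProperties {n : ℕ} {c ℓ} (R : CommutativeRing c ℓ) where
  open CommutativeRing R
  open Laurent {n} R
  private
    module P = CommutativeRing Poly-commutativeRing
    module Q = CommutativeRing Frac-commutativeRing
  open FractionProperties Poly-commutativeRing public
  open IntegerRingSolver R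
  open SetoidReasoning setoid

  abstract
    ≡⇒≋ : ∀ {f g} → f ≡ g → f ≋ g
    ≡⇒≋ ≡.refl = ≋-refl

    select-cong : ∀ b {x y} → x ≈ y → (if b then x else 0#) ≈ (if b then y else 0#)
    select-cong true  p = p
    select-cong false p = refl

    select-+ : ∀ b x y → (if b then x + y else 0#) ≈ (if b then x else 0#) + (if b then y else 0#)
    select-+ true  x y = refl
    select-+ false x y = sym (+-identityˡ 0#)

    monomial-⊗ : ∀ α β → monomial α ⊗ monomial β ≋ monomial (α ⊞ β)
    monomial-⊗ α β = coeffwise λ ν → +-congʳ (select-cong (does (α ⊞ β ≟ᵉ ν)) (*-identityˡ 1#))

    term-split : ∀ a α → (a , α) ∷ [] ≋ constant a ⊗ monomial α
    term-split a α rewrite ⊞-identityˡ α =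
      coeffwise λ ν → +-congʳ (select-cong (does (α ≟ᵉ ν)) (sym (*-identityʳ a)))

    constant-cong : ∀ {a b} → a ≈ b → constant a ≋ constant b
    constant-cong p = coeffwise λ ν → +-congʳ (select-cong (does (𝟎 {n} ≟ᵉ ν)) p)

    constant-+ : ∀ a b → constant (a + b) ≋ constant a ++ constant b
    constant-+ a b = coeffwise λ ν →
      trans (+-congʳ (select-+ (does (𝟎 {n} ≟ᵉ ν)) a b)) (+-assoc _ _ 0#)

    constant-* : ∀ a b → constant (a * b) ≋ constant a ⊗ constant b
    constant-* a b rewrite ⊞-identityˡ {n} 𝟎 = ≋-refl

    constant-neg : ∀ a → constant (- a) ≋ ⊝ constant a
    constant-neg a = ≋-refl

    permute-∘ : ∀ w w′ f → permute (w ∘ₚ w′) f ≡ permute w′ (permute w f)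
    permute-∘ w w′ f = ≡.trans (List.map-cong (λ (a , μ) → cong (a ,_) (permuteExponent-∘ w w′ μ)) f) (List.map-∘ f)

    permute-≈ₚ : ∀ {w w′} → w ≈ₚ w′ → ∀ f → permute w f ≡ permute w′ f
    permute-≈ₚ {w} {w′} p f = List.map-cong (λ (a , μ) → cong (a ,_) (permuteExponent-cong {_} {w} {w′} p μ)) f

    permute-id : ∀ f → permute idₚ f ≡ f
    permute-id f = ≡.trans (List.map-cong (λ (a , μ) → cong (a ,_) (permuteExponent-id μ)) f) (List.map-id f)

    permute-constant : ∀ w a → permute w (constant a) ≡ constant a
    permute-constant w a = cong (λ μ → (a , μ) ∷ []) (permuteExponent-𝟎 w)

    permuteFrac-cong : ∀ w {f g} → f Q.≈ g → permuteFrac w f Q.≈ permuteFrac w g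
    permuteFrac-cong w {f} {g} (cross p) = cross (≋-trans (≡⇒≋ (≡.sym (permute-⊗ w (num f) (den g))))
      (≋-trans (permute-cong w p) (≡⇒≋ (permute-⊗ w (num g) (den f)))))

    permuteFrac-+ : ∀ w f g → permuteFrac w (f Q.+ g) Q.≈ permuteFrac w f Q.+ permuteFrac w g
    permuteFrac-+ w f g = frac-≡
      (≡.trans (List.map-++ _ (num f ⊗ den g) (num g ⊗ den f)) (cong₂ _++_ (permute-⊗ w (num f) (den g)) (permute-⊗ w (num g) (den f))))
      (permute-⊗ w (den f) (den g))

    permuteFrac-* : ∀ w f g → permuteFrac w (f Q.* g) Q.≈ permuteFrac w f Q.* permuteFrac w g
    permuteFrac-* w f g = frac-≡ (permute-⊗ w (num f) (num g)) (permute-⊗ w (den f) (den g))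

    permuteFrac-fromR : ∀ w p → permuteFrac w (fromR p) Q.≈ fromR (permute w p)
    permuteFrac-fromR w p = frac-≡ ≡.refl (permute-constant w 1#)

    permuteFrac-∘ : ∀ w w′ f → permuteFrac (w ∘ₚ w′) f Q.≈ permuteFrac w′ (permuteFrac w f)
    permuteFrac-∘ w w′ f = frac-≡ (permute-∘ w w′ (num f)) (permute-∘ w w′ (den f))

    permuteFrac-≈ₚ : ∀ {w w′} → w ≈ₚ w′ → ∀ f → permuteFrac w f Q.≈ permuteFrac w′ f
    permuteFrac-≈ₚ {w} {w′} p f = frac-≡ (permute-≈ₚ {w} {w′} p (num f)) (permute-≈ₚ {w} {w′} p (den f))

    permuteFrac-id : ∀ f → permuteFrac idₚ f Q.≈ f
    permuteFrac-id f = frac-≡ (permute-id (num f)) (permute-id (den f))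

  -- If h is killed by x^α − b x^β, then coeff κ h = b · coeff (κ + α − β) h, and
  -- the coefficients vanish far out along this ray.
  private
    vanishes : ∀ κ δ r → lookup δ r ≢ 0ℤ → ∀ h → ∃ λ B → ∀ N → B ℕ.< N → coeff (ray κ δ N) h ≈ 0#
    vanishes κ δ r δᵣ≢0 []            = 0 , λ _ _ → refl
    vanishes κ δ r δᵣ≢0 ((a , μ) ∷ h) = B₀ ℕ.⊔ B , λ N B<N →
      trans (+-cong (head N (ℕ.m⊔n<o⇒m<o B₀ B B<N)) (tail N (ℕ.m⊔n<o⇒n<o B₀ B B<N))) (+-identityˡ 0#)
      where
      B₀ = ℤ.∣ lookup μ r ℤ.- lookup κ r ∣
      B = proj₁ (vanishes κ δ r δᵣ≢0 h)
      tail = proj₂ (vanishes κ δ r δᵣ≢0 h)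
      head : ∀ N → B₀ ℕ.< N → (if does (μ ≟ᵉ ray κ δ N) then a else 0#) ≈ 0#
      head N B₀<N with μ ≟ᵉ ray κ δ N
      ... | yes p = contradiction p (ray-escapes κ δ r δᵣ≢0 N μ B₀<N)
      ... | no  _ = refl

  private
    scaled-binomial-regular′ : ∀ b {α β} → α ≢ β → Regular (monomial α P.- constant b ⊗ monomial β)
    scaled-binomial-regular′ b {α} {β} α≢β h bh≋0 = coeffwise λ κ →
      let r , δᵣ≢0 = differ α β α≢β
          B , zero-beyond = vanishes κ δ r δᵣ≢0 h
      in along κ (suc B) (zero-beyond (suc B) (ℕ.n<1+n B))
      where
      δ : Exponent n
      δ = α ⊟ β
      step : ∀ κ → coeff κ h ≈ b * coeff (κ ⊞ δ) h
      step κ = begin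
        u                                      ≈⟨ solve 3 (λ u v b → u := 𝟙 :* u :+ (:- (b :* 𝟙)) :* v :+ b :* v) refl u v b ⟩
        1# * u + - (b * 1#) * v + b * v        ≈⟨ +-congʳ killed ⟩
        0# + b * v                             ≈⟨ +-identityˡ _ ⟩
        b * v                                  ∎
        where
        u v : Carrier
        u = coeff κ h
        v = coeff (κ ⊞ δ) h
        ν : Exponent n
        ν = κ ⊞ α
        u-index : ν ⊟ α ≡ κ
        u-index = ≡.trans (cong (_⊟ α) (⊞-comm κ α)) (⊞⊟-cancel α κ)
        v-index : ν ⊟ (𝟎 ⊞ β) ≡ κ ⊞ δ
        v-index = ≡.trans (cong (ν ⊟_) (⊞-identityˡ β)) (shift-difference κ α β)
        killed : 1# * u + - (b * 1#) * v ≈ 0#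
        killed = begin
          1# * u + - (b * 1#) * v
            ≈⟨ +-cong (*-congˡ (reflexive (cong (λ μ → coeff μ h) (≡.sym u-index))))
                      (trans (sym (+-identityʳ _)) (+-congʳ (*-congˡ (reflexive (cong (λ μ → coeff μ h) (≡.sym v-index)))))) ⟩
          1# * coeff (ν ⊟ α) h + (- (b * 1#) * coeff (ν ⊟ (𝟎 ⊞ β)) h + 0#)
            ≈⟨ +-congˡ (coeff-∷⊗ ν (- (b * 1#)) (𝟎 ⊞ β) [] h) ⟨
          1# * coeff (ν ⊟ α) h + coeff ν ((⊝ (constant b ⊗ monomial β)) ⊗ h)
            ≈⟨ coeff-∷⊗ ν 1# α (⊝ (constant b ⊗ monomial β)) h ⟨
          coeff ν ((monomial α P.- constant b ⊗ monomial β) ⊗ h)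
            ≈⟨ coeff-≈ bh≋0 ν ⟩
          0# ∎
      along : ∀ κ N → coeff (ray κ δ N) h ≈ 0# → coeff κ h ≈ 0#
      along κ zero    p = p
      along κ (suc N) p = along κ N (trans (step (ray κ δ N)) (trans (*-congˡ p) (zeroʳ b)))

  abstract
    -- Makes x_a - t⁻¹ x_b invertible in K(X), as the division by `Δ⁻` requires.
    scaled-binomial-regular : ∀ b {α β} → α ≢ β → Regular (monomial α P.- constant b ⊗ monomial β)
    scaled-binomial-regular = scaled-binomial-regular′

-- The ring R[X] as an abstract ring: its operations unfold, which would defeat unification.
module RingLemmas {c ℓ} (A : CommutativeRing c ℓ) where
  open CommutativeRing A
  open IntegerRingSolver A
  open SetoidReasoning setoid

  telescope : ∀ y t₀ t t′ g → t ≈ t₀ + y * g → y * t ≈ t′ - t → t′ ≈ t₀ + y * (t + g)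
  telescope y t₀ t t′ g p q = begin
    t′                          ≈⟨ solve 2 (λ t t′ → t′ := (t′ :- t) :+ t) refl t t′ ⟩
    (t′ - t) + t                ≈⟨ +-cong (sym q) p ⟩
    y * t + (t₀ + y * g)        ≈⟨ solve 4 (λ y t t₀ g → y :* t :+ (t₀ :+ y :* g) := t₀ :+ y :* (t :+ g)) refl y t t₀ g ⟩
    t₀ + y * (t + g)            ∎

  add-remainders : ∀ y a a₀ g b b₀ h → a ≈ a₀ + y * g → b ≈ b₀ + y * h → a + b ≈ (a₀ + b₀) + y * (g + h)
  add-remainders y a a₀ g b b₀ h p q = trans (+-cong p q)
    (solve 5 (λ y a g b h → (a :+ y :* g) :+ (b :+ y :* h) := (a :+ b) :+ y :* (g :+ h)) refl y a₀ g b₀ h)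

  remainder-zero : ∀ y h h₀ g → h ≈ h₀ + y * g → h₀ ≈ 0# → h ≈ y * g
  remainder-zero y h h₀ g p q = trans p (trans (+-congʳ q) (+-identityˡ _))

  kill-quotient : ∀ n y h g → h ≈ y * g → n * h ≈ 0# → y * (n * g) ≈ 0#
  kill-quotient n y h g p q = trans (solve 3 (λ n y g → y :* (n :* g) := n :* (y :* g)) refl n y g)
    (trans (*-congˡ (sym p)) q)

  times-zero : ∀ y g → g ≈ 0# → y * g ≈ 0#
  times-zero y g p = trans (*-congˡ p) (zeroʳ y)

  kill-shift : ∀ n y h H → y * h ≈ H → n * h ≈ 0# → n * H ≈ 0#
  kill-shift n y h H p q = trans (*-congˡ (sym p))
    (trans (solve 3 (λ n y h → n :* (y :* h) := y :* (n :* h)) refl n y h) (times-zero y _ q))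

  regular-remainder : ∀ X N N⁻¹ d W n h → X ≈ N * d + W * n → W ≈ 0# → N * N⁻¹ ≈ 1# → X * h ≈ 0# → d * h ≈ 0#
  regular-remainder X N N⁻¹ d W n h X≈ W≈0 NN⁻¹≈1 Xh≈0 = begin
    d * h                              ≈⟨ *-identityˡ _ ⟨
    1# * (d * h)                       ≈⟨ *-congʳ NN⁻¹≈1 ⟨
    N * N⁻¹ * (d * h)                  ≈⟨ solve 4 (λ N M d h → N :* M :* (d :* h) := M :* ((N :* d) :* h)) refl N N⁻¹ d h ⟩
    N⁻¹ * (N * d * h)                  ≈⟨ *-congˡ (*-congʳ (trans (+-congˡ (trans (*-congʳ W≈0) (zeroˡ n))) (+-identityʳ _))) ⟨
    N⁻¹ * ((N * d + W * n) * h)        ≈⟨ *-congˡ (trans (*-congʳ (sym X≈)) Xh≈0) ⟩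
    N⁻¹ * 0#                           ≈⟨ zeroʳ N⁻¹ ⟩
    0#                                 ∎

  unshift : ∀ y y⁻¹ h H → y⁻¹ * y ≈ 1# → y * h ≈ H → H ≈ 0# → h ≈ 0#
  unshift y y⁻¹ h H p q r = begin
    h                  ≈⟨ *-identityˡ h ⟨
    1# * h             ≈⟨ *-congʳ p ⟨
    y⁻¹ * y * h        ≈⟨ *-assoc _ _ _ ⟩
    y⁻¹ * (y * h)      ≈⟨ *-congˡ (trans q r) ⟩
    y⁻¹ * 0#           ≈⟨ zeroʳ _ ⟩
    0#                 ∎

-- Maps given term by term on Laurent polynomials

module LinearMaps {n : ℕ} {c ℓ} (R : CommutativeRing c ℓ) where
  open CommutativeRing R
  open Laurent {n} R
  open LaurentProperties {n} R using (select-cong; select-+)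
  private module P = CommutativeRing Poly-commutativeRing
  open SetoidReasoning setoid

  remove : Exponent n → Poly → Poly
  remove α [] = []
  remove α ((a , β) ∷ f) = if does (β ≟ᵉ α) then remove α f else (a , β) ∷ remove α f

  coeff-remove-self : ∀ α f → coeff α (remove α f) ≈ 0#
  coeff-remove-self α [] = refl
  coeff-remove-self α ((a , β) ∷ f) with β ≟ᵉ α in eq
  ... | yes _ = coeff-remove-self α f
  ... | no  _ rewrite eq = trans (+-identityˡ _) (coeff-remove-self α f)

  coeff-remove-other : ∀ α ν f → ν ≢ α → coeff ν (remove α f) ≈ coeff ν f
  coeff-remove-other α ν [] ν≢α = refl
  coeff-remove-other α ν ((a , β) ∷ f) ν≢α with β ≟ᵉ α
  ... | no  _ = +-congˡ (coeff-remove-other α ν f ν≢α)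
  ... | yes ≡.refl with β ≟ᵉ ν
  ...   | yes β≡ν = contradiction (≡.sym β≡ν) ν≢α
  ...   | no  _   = trans (coeff-remove-other α ν f ν≢α) (sym (+-identityˡ _))

  length-remove : ∀ α f → length (remove α f) ℕ.≤ length f
  length-remove α [] = z≤n
  length-remove α ((a , β) ∷ f) with does (β ≟ᵉ α)
  ... | true  = ℕ.m≤n⇒m≤1+n (length-remove α f)
  ... | false = s≤s (length-remove α f)

  module _ (h : Carrier → Exponent n → Carrier) (e : Exponent n → Exponent n)
           (h-cong : ∀ {a b} α → a ≈ b → h a α ≈ h b α)
           (h-+ : ∀ a b α → h (a + b) α ≈ h a α + h b α) where
    mapTerms : Poly → Poly
    mapTerms = List.map λ (a , α) → h a α , e α

    private
      h-0 : ∀ α → h 0# α ≈ 0#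
      h-0 α = begin
        h 0# α                             ≈⟨ +-identityʳ _ ⟨
        h 0# α + 0#                        ≈⟨ +-congˡ (-‿inverseʳ (h 0# α)) ⟨
        h 0# α + (h 0# α - h 0# α)         ≈⟨ +-assoc _ _ _ ⟨
        h 0# α + h 0# α - h 0# α           ≈⟨ +-congʳ (trans (sym (h-+ 0# 0# α)) (h-cong α (+-identityˡ 0#))) ⟩
        h 0# α - h 0# α                    ≈⟨ -‿inverseʳ _ ⟩
        0#                                 ∎

      select : Exponent n → Exponent n → Carrier → Carrier
      select ν α a = if does (e α ≟ᵉ ν) then h a α else 0#

      select-additive : ∀ ν α a b → select ν α (a + b) ≈ select ν α a + select ν α b
      select-additive ν α a b = trans (select-cong (does (e α ≟ᵉ ν)) (h-+ a b α)) (select-+ (does (e α ≟ᵉ ν)) _ _)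

      -- All terms with exponent `α` are taken together: as `h` is additive, their joint image
      -- depends only on the coefficient at `α`.
      collect : ∀ ν α f → coeff ν (mapTerms f) ≈ select ν α (coeff α f) + coeff ν (mapTerms (remove α f))
      collect ν α [] = sym (trans (+-identityʳ _) (trans (select-cong (does (e α ≟ᵉ ν)) (h-0 α)) (zero-select (does (e α ≟ᵉ ν)))))
        where
        zero-select : ∀ b → (if b then 0# else 0#) ≈ 0#
        zero-select true  = refl
        zero-select false = refl
      collect ν α ((a , β) ∷ f) with β ≟ᵉ α
      ... | yes ≡.refl = trans (+-congˡ (collect ν α f))
        (trans (sym (+-assoc _ _ _)) (+-congʳ (sym (select-additive ν α a (coeff α f)))))
      ... | no  _      = begin
        select ν β a + coeff ν (mapTerms f)
          ≈⟨ +-congˡ (collect ν α f) ⟩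
        select ν β a + (select ν α (coeff α f) + rest)
          ≈⟨ trans (sym (+-assoc _ _ _)) (trans (+-congʳ (+-comm _ _)) (+-assoc _ _ _)) ⟩
        select ν α (coeff α f) + (select ν β a + rest)
          ≈⟨ +-congʳ (select-cong (does (e α ≟ᵉ ν)) (h-cong α (+-identityˡ _))) ⟨
        select ν α (0# + coeff α f) + (select ν β a + rest) ∎
        where rest = coeff ν (mapTerms (remove α f))

      -- Induction on the number of terms. The terms that share the exponent of the head have total
      -- coefficient 0; without them the list is shorter and still represents 0.
      kills : ∀ N f → length f ℕ.≤ N → f ≋ [] → ∀ ν → coeff ν (mapTerms f) ≈ 0#
      kills N       []            _       f≋0 ν = refl
      kills (suc N) ((a , α) ∷ f) (s≤s p) f≋0 ν = begin
        coeff ν (mapTerms f⁺)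
          ≈⟨ collect ν α f⁺ ⟩
        select ν α (coeff α f⁺) + coeff ν (mapTerms (remove α f⁺))
          ≈⟨ +-cong (trans (select-cong (does (e α ≟ᵉ ν)) (trans (h-cong α (coeff-≈ f≋0 α)) (h-0 α))) (zero-select (does (e α ≟ᵉ ν))))
                    (kills N (remove α f⁺) shorter (coeffwise vanish) ν) ⟩
        0# + 0#
          ≈⟨ +-identityˡ 0# ⟩
        0# ∎
        where
        f⁺ = (a , α) ∷ f
        zero-select : ∀ b → (if b then 0# else 0#) ≈ 0#
        zero-select true  = refl
        zero-select false = refl
        shorter : length (remove α f⁺) ℕ.≤ N
        shorter with α ≟ᵉ α
        ... | yes _  = ℕ.≤-trans (length-remove α f) p
        ... | no α≢α = contradiction ≡.refl α≢α
        vanish : ∀ κ → coeff κ (remove α f⁺) ≈ 0#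
        vanish κ with κ ≟ᵉ α
        ... | yes ≡.refl = coeff-remove-self κ f⁺
        ... | no  κ≢α    = trans (coeff-remove-other α κ f⁺ κ≢α) (coeff-≈ f≋0 κ)

      mapTerms-⊝ : ∀ f ν → coeff ν (mapTerms (⊝ f)) ≈ - coeff ν (mapTerms f)
      mapTerms-⊝ f ν = begin
        u                    ≈⟨ +-identityʳ u ⟨
        u + 0#               ≈⟨ +-congˡ (-‿inverseʳ v) ⟨
        u + (v - v)          ≈⟨ +-assoc u v (- v) ⟨
        u + v - v            ≈⟨ +-congʳ (coeff-++ ν (mapTerms (⊝ f)) (mapTerms f)) ⟨
        coeff ν (mapTerms (⊝ f) ++ mapTerms f) - v
          ≡⟨ cong (λ g → coeff ν g - v) (List.map-++ _ (⊝ f) f) ⟨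
        coeff ν (mapTerms (⊝ f ++ f)) - v
          ≈⟨ +-congʳ (kills (length (⊝ f ++ f)) (⊝ f ++ f) ℕ.≤-refl (P.-‿inverseˡ f) ν) ⟩
        0# - v               ≈⟨ +-identityˡ _ ⟩
        - v                  ∎
        where
        u = coeff ν (mapTerms (⊝ f))
        v = coeff ν (mapTerms f)

    -- Equal polynomials may be different lists of terms; linearity on terms makes
    -- the map independent of the list.
    mapTerms-cong : ∀ {f g} → f ≋ g → mapTerms f ≋ mapTerms g
    mapTerms-cong {f} {g} f≋g = coeffwise λ ν → begin
      coeff ν (mapTerms f)                                        ≈⟨ +-identityʳ _ ⟨
      coeff ν (mapTerms f) + 0#                                   ≈⟨ +-congˡ (-‿inverseˡ (coeff ν (mapTerms g))) ⟨
      coeff ν (mapTerms f) + (- coeff ν (mapTerms g) + coeff ν (mapTerms g))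
        ≈⟨ +-assoc _ _ _ ⟨
      coeff ν (mapTerms f) - coeff ν (mapTerms g) + coeff ν (mapTerms g)
        ≈⟨ +-congʳ (+-congˡ (mapTerms-⊝ g ν)) ⟨
      coeff ν (mapTerms f) + coeff ν (mapTerms (⊝ g)) + coeff ν (mapTerms g)
        ≈⟨ +-congʳ (coeff-++ ν (mapTerms f) (mapTerms (⊝ g))) ⟨
      coeff ν (mapTerms f ++ mapTerms (⊝ g)) + coeff ν (mapTerms g)
        ≡⟨ cong (λ h → coeff ν h + coeff ν (mapTerms g)) (List.map-++ _ f (⊝ g)) ⟨
      coeff ν (mapTerms (f ++ ⊝ g)) + coeff ν (mapTerms g)
        ≈⟨ +-congʳ (kills (length (f ++ ⊝ g)) (f ++ ⊝ g) ℕ.≤-refl difference ν) ⟩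
      0# + coeff ν (mapTerms g)                                   ≈⟨ +-identityˡ _ ⟩
      coeff ν (mapTerms g)                                        ∎
      where
      difference : f ++ ⊝ g ≋ []
      difference = coeffwise λ ν → trans (coeff-++ ν f (⊝ g))
        (trans (+-cong (coeff-≈ f≋g ν) (coeff-⊝ ν g)) (-‿inverseʳ _))

-- R[q^±1, z^±1] with z = t½, and its specialisation at z = 1.
module Specialisation {c ℓ} (R : CommutativeRing c ℓ) where
  open CommutativeRing R
  open Laurent {2} R
  open LaurentProperties {2} R using (≡⇒≋)
  open LinearMaps {2} R using (mapTerms-cong)
  open RingLemmas Poly-commutativeRing

  atOne : Exponent 2 → Exponent 2
  atOne (q ∷ _ ∷ []) = q ∷ 0ℤ ∷ []

  ev : Poly → Poly
  ev = List.map λ (a , α) → a , atOne α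

  ev-cong : ∀ {f g} → f ≋ g → ev f ≋ ev g
  ev-cong = mapTerms-cong (λ a _ → a) atOne (λ _ p → p) (λ _ _ _ → refl)

  ev-⊗ : ∀ f g → ev (f ⊗ g) ≡ ev f ⊗ ev g
  ev-⊗ []            g = ≡.refl
  ev-⊗ ((a , α) ∷ f) g = ≡.trans (List.map-++ _ (scaleTerm (a , α) g) (f ⊗ g))
    (cong₂ _++_ (ev-scale α g) (ev-⊗ f g))
    where
    ev-scale : ∀ α g → ev (scaleTerm (a , α) g) ≡ scaleTerm (a , atOne α) (ev g)
    ev-scale α              []                         = ≡.refl
    ev-scale (p ∷ q ∷ []) ((b , p′ ∷ q′ ∷ []) ∷ g) = cong (_ ∷_) (ev-scale (p ∷ q ∷ []) g)

  -- A triple (a , q , k) stands for a times the q-th power of the first variable times z^k.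
  PolyZ : Set c
  PolyZ = List (Carrier × ℤ × ℕ)

  ⌜_⌝ : PolyZ → Poly
  ⌜_⌝ = List.map λ (a , q , k) → a , q ∷ + k ∷ []

  z-1 : Poly
  z-1 = monomial (0ℤ ∷ 1ℤ ∷ []) ++ ⊝ monomial (0ℤ ∷ 0ℤ ∷ [])

  -- Stands for (z^k - 1) / (z - 1) times the monomial with coefficient `a` and exponent `q` of the
  -- first variable.
  geometric : Carrier → ℤ → ℕ → PolyZ
  geometric a q zero    = []
  geometric a q (suc k) = (a , q , k) ∷ geometric a q k

  quotient : PolyZ → PolyZ
  quotient []                = []
  quotient ((a , q , k) ∷ H) = geometric a q k ++ quotient H

  private
    raise : ∀ a q k → z-1 ⊗ ⌜ (a , q , k) ∷ [] ⌝ ≋ ⌜ (a , q , suc k) ∷ [] ⌝ ++ ⊝ ⌜ (a , q , k) ∷ [] ⌝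
    raise a q k rewrite ℤ.+-identityˡ q = coeffwise λ ν →
      +-cong (select-cong (does ((q ∷ + suc k ∷ []) ≟ᵉ ν)) (*-identityˡ a))
             (+-congʳ (select-cong (does ((q ∷ + k ∷ []) ≟ᵉ ν)) (-1*x≈-x a)))
      where
      open LaurentProperties {2} R using (select-cong)
      open Algebra.Properties.Ring ring using (-1*x≈-x)

    divide-term : ∀ a q k → ⌜ (a , q , k) ∷ [] ⌝ ≋ ⌜ (a , q , 0) ∷ [] ⌝ ++ z-1 ⊗ ⌜ geometric a q k ⌝
    divide-term a q zero    = ≋-refl
    divide-term a q (suc k) = telescope z-1 ⌜ (a , q , 0) ∷ [] ⌝ ⌜ (a , q , k) ∷ [] ⌝ ⌜ (a , q , suc k) ∷ [] ⌝ ⌜ geometric a q k ⌝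
      (divide-term a q k) (raise a q k)

    divide : ∀ H → ⌜ H ⌝ ≋ ev ⌜ H ⌝ ++ z-1 ⊗ ⌜ quotient H ⌝
    divide []                = ≋-refl
    divide ((a , q , k) ∷ H) = ≋-trans
      (add-remainders z-1 ⌜ (a , q , k) ∷ [] ⌝ ⌜ (a , q , 0) ∷ [] ⌝ ⌜ geometric a q k ⌝ ⌜ H ⌝ (ev ⌜ H ⌝) ⌜ quotient H ⌝
        (divide-term a q k) (divide H))
      (≡⇒≋ (cong (λ g → ev ⌜ (a , q , k) ∷ H ⌝ ++ z-1 ⊗ g) (≡.sym (List.map-++ _ (geometric a q k) (quotient H)))))

  Below : ℕ → PolyZ → Set c
  Below d = All λ (a , q , k) → k ℕ.< d

  private
    geometric-Below : ∀ {d} a q k → k ℕ.≤ d → Below d (geometric a q k)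
    geometric-Below a q zero    p = []
    geometric-Below a q (suc k) p = p ∷ geometric-Below a q k (ℕ.≤-trans (ℕ.n≤1+n k) p)

    quotient-Below : ∀ {d} H → Below (suc d) H → Below d (quotient H)
    quotient-Below []                []            = []
    quotient-Below ((a , q , k) ∷ H) (s≤s p ∷ ps) = All.++⁺ (geometric-Below a q k p) (quotient-Below H ps)

    z-1-regular : Regular z-1
    z-1-regular = binomial-regular (0ℤ ∷ 1ℤ ∷ []) (0ℤ ∷ 0ℤ ∷ []) λ ()

  -- If n h = 0 then h vanishes at z = 1, so h is divisible by z − 1; divide and repeat.
  module _ (n : Poly) (ev-regular : Regular (ev n)) where
    private
      ev-zero : ∀ h → n ⊗ h ≋ [] → ev h ≋ []
      ev-zero h nh≋0 = ev-regular (ev h) (≋-trans (≡⇒≋ (≡.sym (ev-⊗ n h))) (ev-cong nh≋0))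

      -- `d` bounds the degree in z and drops with each division by z - 1. As z - 1 is regular, `n`
      -- annihilates the quotient as well.
      descend : ∀ d H → Below d H → n ⊗ ⌜ H ⌝ ≋ [] → ⌜ H ⌝ ≋ []
      descend d       []      _     _    = ≋-refl
      descend zero    (_ ∷ _) (() ∷ _) _
      descend (suc d) H@(_ ∷ _) bounds nH≋0 = ≋-trans H≋ (times-zero z-1 ⌜ quotient H ⌝
        (descend d (quotient H) (quotient-Below H bounds)
          (z-1-regular (n ⊗ ⌜ quotient H ⌝) (kill-quotient n z-1 ⌜ H ⌝ ⌜ quotient H ⌝ H≋ nH≋0))))
        where
        H≋ : ⌜ H ⌝ ≋ z-1 ⊗ ⌜ quotient H ⌝
        H≋ = remainder-zero z-1 ⌜ H ⌝ (ev ⌜ H ⌝) ⌜ quotient H ⌝ (divide H) (ev-zero ⌜ H ⌝ nH≋0)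

      bounded : ∀ H → ∃ λ d → Below d H
      bounded []                = 0 , []
      bounded ((a , q , k) ∷ H) = let d , bounds = bounded H in
        suc k ℕ.+ d , ℕ.m≤m+n (suc k) d ∷ All.map (λ p → ℕ.≤-trans p (ℕ.m≤n+m d (suc k))) bounds

      z^ : ℤ → Poly
      z^ b = monomial (0ℤ ∷ b ∷ [])

      -- A crude bound: no exponent of z lies below -`span h`, so multiplication by this power of z
      -- leads to the nonnegative exponents of `PolyZ`.
      span : Poly → ℕ
      span []                       = 0
      span ((a , q ∷ b ∷ []) ∷ h) = ℤ.∣ b ∣ ℕ.+ span h

      shift : ℕ → Poly → PolyZ
      shift M = List.map λ { (a , q ∷ b ∷ []) → a , q , ℤ.∣ + M ℤ.+ b ∣ }

      shifted : ∀ M h → span h ℕ.≤ M → z^ (+ M) ⊗ h ≋ ⌜ shift M h ⌝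
      shifted M h p = ≋-trans (≡⇒≋ (List.++-identityʳ _)) (go h p)
        where
        open LaurentProperties {2} R using (select-cong)
        nonneg : ∀ b → ℤ.∣ b ∣ ℕ.≤ M → + ℤ.∣ + M ℤ.+ b ∣ ≡ + M ℤ.+ b
        nonneg (+ k)    _ = ≡.refl
        nonneg -[1+ k ] p = ℤ.0≤i⇒+∣i∣≡i (≡.subst (0ℤ ℤ.≤_) (≡.sym (ℤ.m-n≡m⊖n M (suc k)))
          (≡.subst (0ℤ ℤ.≤_) (≡.sym (ℤ.⊖-≥ p)) (ℤ.+≤+ z≤n)))
        go : ∀ h → span h ℕ.≤ M → scaleTerm (1# , 0ℤ ∷ + M ∷ []) h ≋ ⌜ shift M h ⌝
        go []                      _ = ≋-refl
        go ((a , q ∷ b ∷ []) ∷ h) p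
          rewrite ℤ.+-identityˡ q | nonneg b (ℕ.≤-trans (ℕ.m≤m+n _ _) p) = coeffwise λ ν →
          +-cong (select-cong (does ((q ∷ (+ M ℤ.+ b) ∷ []) ≟ᵉ ν)) (*-identityˡ a))
                 (coeff-≈ (go h (ℕ.≤-trans (ℕ.m≤n+m _ ℤ.∣ b ∣) p)) ν)

    regular-at-one : Regular n
    regular-at-one h nh≋0 = unshift (z^ (+ M)) (z^ (ℤ.- + M)) h ⌜ shift M h ⌝
      (≋-trans (monomial-⊗ (0ℤ ∷ ℤ.- + M ∷ []) (0ℤ ∷ + M ∷ [])) (≡⇒≋ (cong z^ (ℤ.+-inverseˡ (+ M)))))
      moved (descend (proj₁ (bounded (shift M h))) (shift M h) (proj₂ (bounded (shift M h)))
              (kill-shift n (z^ (+ M)) h ⌜ shift M h ⌝ moved nh≋0))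
      where
      open LaurentProperties {2} R using (monomial-⊗)
      M = span h
      moved : z^ (+ M) ⊗ h ≋ ⌜ shift M h ⌝
      moved = shifted M h ℕ.≤-refl

-- Sums of zeros and ones over permutations

module Counting {c c≈} (K : CommutativeRing c c≈) where
  open CommutativeRing K hiding (zero)
  open CodeSum +-commutativeMonoid
  open Algebra.Properties.Semiring.Sum semiring using (sum)
  open Algebra.Properties.Semiring.Mult semiring using (×-homo-+) renaming (_×_ to _·_)

  ∑ᶜ-count : ∀ {m} (G : Code m → Carrier) → (∀ c → ∃ λ n → G c ≈ n · 1#) → ∃ λ n → ∑ᶜ G ≈ n · 1#
  sum-count : ∀ {n} (G : Fin n → Carrier) → (∀ j → ∃ λ n → G j ≈ n · 1#) → ∃ λ n → sum G ≈ n · 1#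
  ∑ᶜ-count {zero}  G counts = counts []
  ∑ᶜ-count {suc m} G counts = sum-count (λ j → ∑ᶜ λ c → G (j ∷ c)) λ j → ∑ᶜ-count (λ c → G (j ∷ c)) λ c → counts (j ∷ c)
  sum-count {zero}  G counts = 0 , refl
  sum-count {suc n} G counts =
    let a , p = counts zero
        b , q = sum-count (G ∘ suc) (counts ∘ suc)
    in a ℕ.+ b , trans (+-cong p q) (sym (×-homo-+ 1# a b))

  -- The summand of the identity permutation is 1, so the integer obtained is positive, and
  -- invertible once the characteristic is 0.
  ∑ᶜ-positive : ∀ {m} (G : Code m → Carrier) → (∀ c → ∃ λ n → G c ≈ n · 1#) → G (identity m) ≈ 1# →
                ∃ λ n → ∑ᶜ G ≈ suc n · 1#
  ∑ᶜ-positive {zero}  G counts G-id = 0 , trans G-id (sym (+-identityʳ 1#))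
  ∑ᶜ-positive {suc m} G counts G-id =
    let a , p = ∑ᶜ-positive (λ c → G (zero ∷ c)) (λ c → counts (zero ∷ c)) G-id
        b , q = sum-count (λ j → ∑ᶜ λ c → G (suc j ∷ c)) λ j → ∑ᶜ-count (λ c → G (suc j ∷ c)) λ c → counts (suc j ∷ c)
    in a ℕ.+ b , trans (+-cong p q) (sym (×-homo-+ 1# (suc a) b))

-- Localisation at good denominators

record Denominators {a a≈ c c≈} (A : CommutativeRing a a≈) (K : CommutativeRing c c≈) g : Set (a ⊔ c ⊔ c≈ ⊔ Level.suc g) where
  private
    module A = CommutativeRing A
    module K = CommutativeRing K
  field
    ι      : A.Carrier → K.Carrier
    ι-+    : ∀ p q → ι (p A.+ q) K.≈ ι p K.+ ι q
    ι-*    : ∀ p q → ι (p A.* q) K.≈ ι p K.* ι q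
    ι-1    : ι A.1# K.≈ K.1#
    Good   : A.Carrier → Set g
    Good-1 : Good A.1#
    Good-* : ∀ d e → Good d → Good e → Good (d A.* e)

module Localisation {a a≈ c c≈ g} {A : CommutativeRing a a≈} {K : CommutativeRing c c≈} (denominators : Denominators A K g) where
  private module A = CommutativeRing A
  open CommutativeRing K
  open Denominators denominators
  open IntegerRingSolver K
  open SetoidReasoning setoid
  open Frames K using (Unit)

  -- It is enough that some presentation of `x` has a good denominator. The equation is multiplied
  -- out so that it respects equality in K, where a given representative may have a bad denominator.
  record O (x : Carrier) : Set (a ⊔ c≈ ⊔ g) where
    constructor fraction
    field
      numerator denominator : A.Carrier
      good                  : Good denominator
      equation              : ι denominator * x ≈ ι numerator

  O-ι : ∀ p → O (ι p)
  O-ι p = fraction p A.1# Good-1 (trans (*-congʳ ι-1) (*-identityˡ _))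

  O-≈ : ∀ {x y} → x ≈ y → O x → O y
  O-≈ p (fraction n d good eq) = fraction n d good (trans (*-congˡ (sym p)) eq)

  O-* : ∀ {x y} → O x → O y → O (x * y)
  O-* {x} {y} (fraction n d good eq) (fraction n′ d′ good′ eq′) = fraction (n A.* n′) (d A.* d′) (Good-* d d′ good good′) (begin
    ι (d A.* d′) * (x * y)      ≈⟨ *-congʳ (ι-* d d′) ⟩
    ι d * ι d′ * (x * y)        ≈⟨ solve 4 (λ d e x y → d :* e :* (x :* y) := (d :* x) :* (e :* y)) refl _ _ x y ⟩
    (ι d * x) * (ι d′ * y)      ≈⟨ *-cong eq eq′ ⟩
    ι n * ι n′                  ≈⟨ ι-* n n′ ⟨
    ι (n A.* n′)                ∎)

  O-+ : ∀ {x y} → O x → O y → O (x + y)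
  O-+ {x} {y} (fraction n d good eq) (fraction n′ d′ good′ eq′) =
    fraction (d′ A.* n A.+ d A.* n′) (d A.* d′) (Good-* d d′ good good′) (begin
    ι (d A.* d′) * (x + y)                  ≈⟨ *-congʳ (ι-* d d′) ⟩
    ι d * ι d′ * (x + y)
      ≈⟨ solve 4 (λ d e x y → d :* e :* (x :+ y) := e :* (d :* x) :+ d :* (e :* y)) refl _ _ x y ⟩
    ι d′ * (ι d * x) + ι d * (ι d′ * y)     ≈⟨ +-cong (*-congˡ eq) (*-congˡ eq′) ⟩
    ι d′ * ι n + ι d * ι n′                 ≈⟨ +-cong (sym (ι-* d′ n)) (sym (ι-* d n′)) ⟩
    ι (d′ A.* n) + ι (d A.* n′)             ≈⟨ ι-+ _ _ ⟨
    ι (d′ A.* n A.+ d A.* n′)               ∎)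

  O-divide : ∀ {x y} d → Good d → ι d * x ≈ y → O y → O x
  O-divide {x} {y} d good p (fraction n e good′ eq) = fraction n (e A.* d) (Good-* e d good′ good)
    (trans (*-congʳ (ι-* e d)) (trans (*-assoc _ _ _) (trans (*-congˡ p) eq)))

  -- Multiplication by the denominator d of `y` turns x into N d + w n, an element of A. In the
  -- application N is a positive integer and w vanishes at t½ = 1.
  unit-modulo : ∀ {x y} N w → O y → x ≈ ι N + ι w * y →
                (∀ d n → Good d → Unit (ι (N A.* d A.+ w A.* n))) → Unit x
  unit-modulo {x} {y} N w (fraction n d good eq) p units = let v , q = units d n good in
    ι d * v , (begin
      x * (ι d * v)                               ≈⟨ *-congʳ p ⟩
      (ι N + ι w * y) * (ι d * v)
        ≈⟨ solve 5 (λ N w y d v → (N :+ w :* y) :* (d :* v) := (N :* d :+ w :* (d :* y)) :* v) refl _ _ y _ v ⟩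
      (ι N * ι d + ι w * (ι d * y)) * v           ≈⟨ *-congʳ (+-cong (sym (ι-* N d)) (trans (*-congˡ eq) (sym (ι-* w n)))) ⟩
      (ι (N A.* d) + ι (w A.* n)) * v             ≈⟨ *-congʳ (ι-+ _ _) ⟨
      ι (N A.* d A.+ w A.* n) * v                 ≈⟨ q ⟩
      1#                                          ∎)

-- Induction on exponents

exponent-induction : ∀ {n p} (P : Exponent n → Set p) → P 𝟎 → (∀ {α β} → P α → P β → P (α ⊞ β)) →
                     (∀ a → P (unit a)) → (∀ a → P (𝟎 ⊟ unit a)) → ∀ α → P α
exponent-induction {zero}  P P-𝟎 P-⊞ P-unit P-neg []      = P-𝟎
exponent-induction {suc n} P P-𝟎 P-⊞ P-unit P-neg (k ∷ α) =
  ≡.subst P (cong₂ _∷_ (ℤ.+-identityʳ k) (⊞-identityˡ α)) (P-⊞ (head-only k) tail-only)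
  where
  tail-only : P (0ℤ ∷ α)
  tail-only = exponent-induction (λ β → P (0ℤ ∷ β)) P-𝟎 P-⊞ (P-unit ∘ suc) (P-neg ∘ suc) α
  head-only : ∀ k → P (k ∷ 𝟎)
  head-only (+ zero)       = P-𝟎
  head-only (+ suc k)      = ≡.subst P (cong (_ ∷_) (⊞-identityˡ 𝟎)) (P-⊞ (P-unit zero) (head-only (+ k)))
  head-only -[1+ zero ]    = ≡.subst P (cong (_ ∷_) (⊟𝟎 𝟎)) (P-neg zero)
  head-only -[1+ suc k ]   = ≡.subst P (cong (_ ∷_) (≡.trans (cong (_⊞ 𝟎) (⊟𝟎 𝟎)) (⊞-identityˡ 𝟎)))
    (P-⊞ (P-neg zero) (head-only -[1+ k ]))

module Weight where
  open Algebra.Properties.CommutativeMonoid.Sum ℕ.+-0-commutativeMonoid using (sum; sum-permute; sum-cong-≗)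

  -- With absolute values it also bounds the entries of signed exponents. It serves as induction
  -- parameter for nonnegative μ and as the shift that makes an arbitrary μ nonnegative.
  weight : ∀ {n} → Exponent n → ℕ
  weight μ = sum λ i → ℤ.∣ lookup μ i ∣

  weight-permute : ∀ {n} (w : Permutation′ n) μ → weight (permuteExponent w μ) ≡ weight μ
  weight-permute w μ = ≡.trans (sum-cong-≗ λ i → cong ℤ.∣_∣ (Vec.lookup∘tabulate (λ j → lookup μ (w ⟨$⟩ˡ j)) i))
    (≡.sym (sum-permute (λ i → ℤ.∣ lookup μ i ∣) (flip w)))

  weight-∷ʳ : ∀ {n} (v : Exponent n) a → weight (v Vec.∷ʳ a) ≡ ℤ.∣ a ∣ ℕ.+ weight v
  weight-∷ʳ []      a = ≡.refl
  weight-∷ʳ (b ∷ v) a = ≡.trans (cong (ℤ.∣ b ∣ ℕ.+_) (weight-∷ʳ v a))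
    (≡.trans (≡.sym (ℕ.+-assoc ℤ.∣ b ∣ _ _)) (≡.trans (cong (ℕ._+ weight v) (ℕ.+-comm ℤ.∣ b ∣ _)) (ℕ.+-assoc ℤ.∣ a ∣ _ _)))

  entry≤weight : ∀ {n} (μ : Exponent n) i → ℤ.∣ lookup μ i ∣ ℕ.≤ weight μ
  entry≤weight (a ∷ μ) zero    = ℕ.m≤m+n _ _
  entry≤weight (a ∷ μ) (suc i) = ℕ.≤-trans (entry≤weight μ i) (ℕ.m≤n+m _ ℤ.∣ a ∣)

  weight≡0 : ∀ {n} (μ : Exponent n) → weight μ ≡ 0 → μ ≡ 𝟎
  weight≡0 μ p = lookup-ext λ i → ≡.trans
    (ℤ.∣i∣≡0⇒i≡0 (ℕ.n≤0⇒n≡0 (ℕ.≤-trans (entry≤weight μ i) (ℕ.≤-reflexive p)))) (≡.sym (Vec.lookup-replicate i 0ℤ))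

  positive-entry : ∀ {n} (μ : Exponent n) → weight μ ≢ 0 → ∃ λ i → lookup μ i ≢ 0ℤ
  positive-entry {n} μ p = let i , q = differ μ 𝟎 (λ { ≡.refl → p (weight-𝟎 n) }) in
    i , λ r → q (≡.trans (Vec.lookup-zipWith ℤ._-_ i μ 𝟎) (cong₂ ℤ._-_ r (Vec.lookup-replicate i 0ℤ)))
    where
    weight-𝟎 : ∀ n → weight (𝟎 {n}) ≡ 0
    weight-𝟎 zero    = ≡.refl
    weight-𝟎 (suc n) = weight-𝟎 n

open Weight

permute-involution : ∀ {m} (i : Fin m) μ → permuteExponent (Coxeter.s m i) (permuteExponent (Coxeter.s m i) μ) ≡ μ
permute-involution {m} i μ = ≡.trans (≡.sym (permuteExponent-∘ s s μ))
  (≡.trans (permuteExponent-cong {w = s ∘ₚ s} {idₚ} square μ) (permuteExponent-id μ))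
  where
  s = Coxeter.s m i
  square : ∀ a → s ⟨$⟩ʳ (s ⟨$⟩ʳ a) ≡ a
  square a = ≡.trans (s≡swap i _) (≡.trans (cong (swap i) (s≡swap i a)) (swap-involutive i a))

lookup-permute-s : ∀ {m} (i : Fin m) μ a → lookup (permuteExponent (Coxeter.s m i) μ) (swap i a) ≡ lookup μ a
lookup-permute-s {m} i μ a = ≡.trans (Vec.lookup∘tabulate (λ j → lookup μ (s ⟨$⟩ˡ j)) (swap i a))
  (cong (lookup μ) (≡.trans (cong (s ⟨$⟩ˡ_) (≡.sym (s≡swap i a))) (inverseˡ s)))
  where
  s = Coxeter.s m i

lookup-∷ʳ : ∀ {n p} (P : ℤ → Set p) (v : Exponent n) {a} → (∀ j → P (lookup v j)) → P a → ∀ j → P (lookup (v Vec.∷ʳ a) j)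
lookup-∷ʳ P []      Pv Pa zero    = Pa
lookup-∷ʳ P (b ∷ v) Pv Pa zero    = Pv zero
lookup-∷ʳ P (b ∷ v) Pv Pa (suc j) = lookup-∷ʳ P v (Pv ∘ suc) Pa j

-- Macdonald polynomials

module MacdonaldIdentities {c ℓ₁ ℓ₂} (k : HeytingField c ℓ₁ ℓ₂) (m : ℕ) where
  open Macdonald k m
  module A-Props = LaurentProperties {2} (HeytingCommutativeRing.commutativeRing (HeytingField.heytingCommutativeRing k))
  module K[X]-Props = LaurentProperties {suc m} k[q,t½].Frac-commutativeRing
  F = K[X].Frac-commutativeRing
  module F = CommutativeRing F
  open K[X]-Props
  open Frames F
  open Operators F.setoid

  abstract
    q·t½-* : ∀ a b a′ b′ → (q^ a ·t½^ b) K.* (q^ a′ ·t½^ b′) K.≈ (q^ (a ℤ.+ a′) ·t½^ (b ℤ.+ b′))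
    q·t½-* a b a′ b′ = K.trans (K.sym (A-Props.fromR-* (k[q,t½].monomial (a ∷ b ∷ [])) (k[q,t½].monomial (a′ ∷ b′ ∷ []))))
      (A-Props.fromR-cong (A-Props.monomial-⊗ (a ∷ b ∷ []) (a′ ∷ b′ ∷ [])))

    t½*t½ : t½ K.* t½ K.≈ t
    t½*t½ = q·t½-* 0ℤ 1ℤ 0ℤ 1ℤ

    t½*t⁻½ : t½ K.* t⁻½ K.≈ K.1#
    t½*t⁻½ = q·t½-* 0ℤ 1ℤ 0ℤ -[1+ 0 ]

    scalar-cong : ∀ {a b} → a K.≈ b → scalar a ≈ scalar b
    scalar-cong p = fromR-cong (constant-cong p)

    scalar-* : ∀ a b → scalar (a K.* b) ≈ scalar a * scalar b
    scalar-* a b = F.trans (fromR-cong (constant-* a b)) (fromR-* (constant a) (constant b))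

    scalar-+ : ∀ a b → scalar (a K.+ b) ≈ scalar a + scalar b
    scalar-+ a b = F.trans (fromR-cong (constant-+ a b)) (fromR-+ (constant a) (constant b))

    scalar-neg : ∀ a → scalar (K.- a) ≈ - scalar a
    scalar-neg a = F.trans (fromR-cong (constant-neg a)) (fromR-neg (constant a))

    scalar-1 : scalar K.1# ≈ 1#
    scalar-1 = F.refl

  t⁻¹ : K.Carrier
  t⁻¹ = q^ 0ℤ ·t½^ -[1+ 1 ]

  𝔰 : Fin m → F.Carrier → F.Carrier
  𝔰 i = permuteFrac (s i)

  inv : Fin (suc m) → Fin (suc m) → F.Carrier
  inv a b with a Fin.≟ b
  ... | yes _   = 0#
  ... | no  a≢b = reciprocal (proj₁ (binomial (unit a) (unit b) (unit-≢ a≢b))) (proj₂ (binomial (unit a) (unit b) (unit-≢ a≢b)))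

  abstract
    permuteFrac-scalar : ∀ w a → permuteFrac w (scalar a) ≈ scalar a
    permuteFrac-scalar w a = F.trans (permuteFrac-fromR w (K[X].constant a)) (fromR-cong (≡⇒≋ (permute-constant w a)))

    permuteFrac-⟦⟧ : ∀ is f → permuteFrac ⟦ is ⟧ f ≈ foldr 𝔰 f is
    permuteFrac-⟦⟧ []       f = permuteFrac-id f
    permuteFrac-⟦⟧ (i ∷ is) f = F.trans (permuteFrac-∘ ⟦ is ⟧ (s i) f) (permuteFrac-cong (s i) (permuteFrac-⟦⟧ is f))

    permuteFrac-perm : ∀ c f → permuteFrac (perm c) f ≈ op 𝔰 c f
    permuteFrac-perm c f = F.trans (permuteFrac-≈ₚ {perm c} {⟦ toWord c ⟧} (perm-toWord c) f)
      (F.trans (permuteFrac-⟦⟧ (toWord c) f) (F.reflexive (foldr-toWord 𝔰 c f)))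

    𝔰-words : ∀ is js → (∀ x → foldr swap x is ≡ foldr swap x js) → ∀ f → foldr 𝔰 f is ≈ foldr 𝔰 f js
    𝔰-words is js p f = F.trans (F.sym (permuteFrac-⟦⟧ is f))
      (F.trans (permuteFrac-≈ₚ {⟦ is ⟧} {⟦ js ⟧} (λ x → ≡.trans (⟦⟧≡foldr is x) (≡.trans (p x) (≡.sym (⟦⟧≡foldr js x)))) f)
        (permuteFrac-⟦⟧ js f))

    𝔰-braided : Braided 𝔰
    𝔰-braided = record
      { τ-cong  = λ i → permuteFrac-cong (s i)
      ; commute = λ i j p → 𝔰-words (i ∷ j ∷ []) (j ∷ i ∷ []) (S.commute i j p)
      ; braid   = λ i j p → 𝔰-words (i ∷ j ∷ i ∷ []) (j ∷ i ∷ j ∷ []) (S.braid i j p)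
      }
      where module S = Operators.Braided (swap-Braided m)

    𝔰-involutive : Involutive 𝔰
    𝔰-involutive i = 𝔰-words (i ∷ i ∷ []) [] (swap-involutive i)

    permuteFrac-x^ : ∀ w α → permuteFrac w (x^ α) ≈ x^ permuteExponent w α
    permuteFrac-x^ w α = permuteFrac-fromR w (K[X].monomial α)

    𝔰-x : ∀ i a → 𝔰 i (x a) ≈ x (swap i a)
    𝔰-x i a = F.trans (permuteFrac-x^ (s i) (unit a)) (fromR-cong (≡⇒≋ (cong K[X].monomial
      (≡.trans (permuteExponent-unit (s i) a) (cong unit (s≡swap i a))))))

    inv-inv : ∀ {a b} → a ≢ b → (x a - x b) * inv a b ≈ 1#
    inv-inv {a} {b} a≢b with a Fin.≟ b
    ... | yes a≡b = contradiction a≡b a≢b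
    ... | no  p   = F.trans
      (times-congʳ (x a - x b) ⟨ proj₁ d ⟩ (reciprocal (proj₁ d) (proj₂ d)) (F.sym (fromR-minus (monomial (unit a)) (monomial (unit b)))))
      (reciprocal-inverse (proj₁ d) (proj₂ d))
      where
      d : ∃ K[X].Regular
      d = binomial (unit a) (unit b) (unit-≢ p)

    inv-diag : ∀ a → inv a a ≈ 0#
    inv-diag a with a Fin.≟ a
    ... | yes _ = F.refl
    ... | no  p = contradiction ≡.refl p

  scaled-difference : K.Carrier → (a b : Fin (suc m)) → Poly
  scaled-difference r a b = monomial (unit a) K[X]-Ring.- constant r K[X].⊗ monomial (unit b)

  abstract
    scaled-difference≈ : ∀ r a b → ⟨ scaled-difference r a b ⟩ ≈ x a - scalar r * x b
    scaled-difference≈ r a b = F.trans (fromR-minus (monomial (unit a)) (constant r K[X].⊗ monomial (unit b)))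
      (minus-congˡ (x a) ⟨ constant r K[X].⊗ monomial (unit b) ⟩ (scalar r * x b) (fromR-* (constant r) (monomial (unit b))))

    scaled-difference-unit : ∀ r {a b} → a ≢ b → Unit (x a - scalar r * x b)
    scaled-difference-unit r {a} {b} a≢b = Unit-resp ⟨ d ⟩ (x a - scalar r * x b) (scaled-difference≈ r a b)
      (reciprocal d (scaled-binomial-regular r (unit-≢ a≢b)) , reciprocal-inverse d (scaled-binomial-regular r (unit-≢ a≢b)))
      where
      d : Poly
      d = scaled-difference r a b

  frame : Frame m
  frame = record
    { s         = 𝔰
    ; s-+       = λ i → permuteFrac-+ (s i)
    ; s-*       = λ i → permuteFrac-* (s i)
    ; s-1       = λ i → permuteFrac-scalar (s i) K.1#
    ; s-braided = 𝔰-braided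
    ; s-invol   = 𝔰-involutive
    ; x         = x
    ; s-x       = 𝔰-x
    ; inv       = inv
    ; inv-inv   = inv-inv
    ; inv-diag  = inv-diag
    ; t         = scalar t
    ; t⁻¹       = scalar t⁻¹
    ; t-inverse = F.trans (F.sym (scalar-* t t⁻¹)) (scalar-cong (q·t½-* 0ℤ (+ 2) 0ℤ -[1+ 1 ]))
    ; s-t       = λ i → permuteFrac-scalar (s i) t
    ; s-t⁻¹     = λ i → permuteFrac-scalar (s i) t⁻¹
    ; diff-unit = scaled-difference-unit t⁻¹
    }

  open CodeSum F.+-commutativeMonoid
  open Symmetrizer F using (triangle; symmetrizer)
  open Frame frame hiding (s; t; t⁻¹; x; inv; inv-inv; lo≢hi)

  -- The local function inside `∏<` cannot be named: the left sides of the two auxiliary statements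
  -- are `_`, and their use in `∏<≈upper` determines them.
  mutual
    ∏<≈upper : ∀ (f : (i j : Fin (suc m)) → i < j → F.Carrier) g → (∀ i j i<j → f i j i<j ≈ g i j) → ∏< f ≈ upper g
    ∏<≈upper f g p = product-upper-blocks g F.refl (λ b → p zero (suc b) _) (λ _ → F.refl)
      (factor-above f g p) (factor-diagonal f)

    factor-above : ∀ f g → (∀ i j i<j → f i j i<j ≈ g i j) → ∀ i j → i < j → _ ≈ g (suc i) (suc j)
    factor-above f g p i j i<j with suc i Fin.<? suc j
    ... | yes i<j′ = p (suc i) (suc j) i<j′
    ... | no  i≮j  = contradiction (s≤s i<j) i≮j

    factor-diagonal : ∀ (f : (i j : Fin (suc m)) → i < j → F.Carrier) i j → ¬ i < j → _ ≈ 1#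
    factor-diagonal f i j i≮j with suc i Fin.<? suc j
    ... | yes (s≤s i<j) = contradiction i<j i≮j
    ... | no  _         = F.refl

  module F-Exp = Algebra.Properties.Semiring.Exp F.semiring

  module K-Frames = Frames k[q,t½].Frac-commutativeRing

  zpow-shift : ∀ x y → x K.* y K.≈ K.1# → ∀ N a → (x K-Exp.^ N) K.* zpow x y (+ a ℤ.- + N) K.≈ x K-Exp.^ a
  zpow-shift x y = K-Frames.integer-power-shift (zpow x y) (λ _ → ≡.refl) (λ _ → ≡.refl)

  abstract
    scalar-^ : ∀ a n → scalar (a K-Exp.^ n) ≈ scalar a F-Exp.^ n
    scalar-^ a zero    = scalar-1
    scalar-^ a (suc n) = F.trans (scalar-* a (a K-Exp.^ n))
      (times-congˡ (scalar a) (scalar (a K-Exp.^ n)) (scalar a F-Exp.^ n) (scalar-^ a n))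

    x-ratio : ∀ i → x (lo i) * x^ (unit (hi i) ⊟ unit (lo i)) ≈ x (hi i)
    x-ratio i = F.trans (F.sym (fromR-* (monomial (unit (lo i))) (monomial (unit (hi i) ⊟ unit (lo i)))))
      (fromR-cong (K[X].≋-trans (monomial-⊗ (unit (lo i)) (unit (hi i) ⊟ unit (lo i)))
        (≡⇒≋ (cong monomial (⊞⊟-cancel′ (unit (lo i)) (unit (hi i)))))))

    scalar-t½² : scalar t½ * scalar t½ ≈ scalar t
    scalar-t½² = F.trans (F.sym (scalar-* t½ t½)) (scalar-cong t½*t½)

    scalar-t½-inverse : scalar t½ * scalar t⁻½ ≈ 1#
    scalar-t½-inverse = F.trans (F.sym (scalar-* t½ t⁻½)) (scalar-cong t½*t⁻½)

    T-τ : ∀ i f → scalar t½ * T i f ≈ 𝔹.τ i f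
    T-τ i f = hecke-τ i {scalar t½} {scalar t⁻½} {Y} {reciprocal (proj₁ b) (proj₂ b)}
      scalar-t½² scalar-t½-inverse (λ j → permuteFrac-scalar (s j) t½)
      (x-ratio i)
      (F.trans (times-congʳ (1# - Y) ⟨ proj₁ b ⟩ (reciprocal (proj₁ b) (proj₂ b)) (F.sym (fromR-minus (monomial 𝟎) (monomial ratio))))
               (reciprocal-inverse (proj₁ b) (proj₂ b)))
      f (G ÷ b * f)
      (times-congʳ (G ÷ b) (G * reciprocal (proj₁ b) (proj₂ b)) f (÷≈* G (proj₁ b) (proj₂ b)))
      where
      ratio : Exponent (suc m)
      ratio = unit (hi i) ⊟ unit (lo i)
      b : ∃ K[X].Regular
      b = binomial 𝟎 ratio (𝟎≢ratio i)
      Y G : F.Carrier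
      Y = x^ ratio
      G = scalar t⁻½ - scalar t½ * Y

  open Hecke {scalar t½} {scalar t⁻½} scalar-t½² scalar-t½-inverse
    (λ i → permuteFrac-scalar (s i) t½) (λ i → permuteFrac-scalar (s i) t⁻½) T T-τ

  abstract
    inv-÷ : ∀ f {i j} (i≢j : i ≢ j) → f ÷ binomial (unit i) (unit j) (unit-≢ i≢j) ≈ f * inv i j
    inv-÷ f {i} {j} i≢j with i Fin.≟ j
    ... | yes i≡j = contradiction i≡j i≢j
    ... | no  p   = F.trans (÷≈* f (proj₁ b) (proj₂ b))
      (times-congˡ f (reciprocal (proj₁ b) (proj₂ b)) (reciprocal (proj₁ b) (proj₂ b′)) (frac-≡ ≡.refl ≡.refl))
      where
      b b′ : ∃ K[X].Regular
      b  = binomial (unit i) (unit j) (unit-≢ i≢j)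
      b′ = binomial (unit i) (unit j) (unit-≢ p)

    ∏-bosonic : ∏< (λ i j i<j → (x i - scalar t * x j) ÷[x i -x j ] i<j) ≈ triangle (α (scalar t))
    ∏-bosonic = F.trans (∏<≈upper _ (λ i j → (x i - scalar t * x j) * inv i j) (λ i j i<j → inv-÷ (x i - scalar t * x j) (Fin.<⇒≢ i<j)))
      upper-bosonic

    ∏-fermionic : ∏< (λ i j i<j → (x j - scalar t * x i) ÷[x i -x j ] i<j) ≈ (- scalar t) F-Exp.^ len (longest m) * Δ⁻
    ∏-fermionic = F.trans (∏<≈upper _ (λ i j → (x j - scalar t * x i) * inv i j) (λ i j i<j → inv-÷ (x j - scalar t * x i) (Fin.<⇒≢ i<j)))
      upper-fermionic

    ∑-permute : ∀ f → (∑ λ w → permuteFrac w f) ≈ ∑ᶜ λ c → op 𝔰 c f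
    ∑-permute f = F.trans (sum-permutations λ w → permuteFrac w f) (∑ᶜ-cong λ c → permuteFrac-perm c f)

    P-symmetrizes : ∀ E Λ W⁻¹ → P E W⁻¹ Λ ≈ scalar W⁻¹ * ∑ᶜ λ c → op 𝔰 c (triangle (α (scalar t)) * ⟨ E Λ ⟩)
    P-symmetrizes E Λ W⁻¹ =
      times-congˡ (scalar W⁻¹) (∑ λ w → permuteFrac w (⟨ E Λ ⟩ * Π)) (∑ᶜ λ c → op 𝔰 c (triangle (α (scalar t)) * ⟨ E Λ ⟩))
        (F.trans (∑-permute (⟨ E Λ ⟩ * Π)) (∑ᶜ-cong λ c → op-cong (λ i → permuteFrac-cong (s i)) c
          (F.trans (F.*-comm ⟨ E Λ ⟩ Π) (times-congʳ Π (triangle (α (scalar t))) ⟨ E Λ ⟩ ∏-bosonic))))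
      where
      Π : F.Carrier
      Π = ∏< λ i j i<j → (x i - scalar t * x j) ÷[x i -x j ] i<j

    -- The form of P used for the normalisation: the operators τ_i preserve `L`, whereas the single
    -- summands in the definition of P have denominators x_i - x_j.
    P-hecke : ∀ E Λ W⁻¹ → P E W⁻¹ Λ ≈ scalar W⁻¹ * ∑ᶜ λ c → op 𝔹.τ c ⟨ E Λ ⟩
    P-hecke E Λ W⁻¹ = F.trans (P-symmetrizes E Λ W⁻¹)
      (times-congˡ (scalar W⁻¹) (∑ᶜ λ c → op 𝔰 c (triangle (α (scalar t)) * ⟨ E Λ ⟩)) (∑ᶜ λ c → op 𝔹.τ c ⟨ E Λ ⟩)
        (F.sym (symmetrizer bosonic ⟨ E Λ ⟩)))

  -- The bosonic and the fermionic identity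

  module _ (words : ReducedWords) (w₀ : Permutation′ (suc m)) where
    open ReducedWords words
    private N = ℓ w₀

    abstract
      bosonic-identity : ∀ E Λ W⁻¹ → P E W⁻¹ Λ ≈ scalar (t^½ℓ words w₀ K.* W⁻¹) * 𝟏₀ words w₀ ⟨ E Λ ⟩
      bosonic-identity E Λ W⁻¹ = F.trans (P-symmetrizes E Λ W⁻¹) (F.sym right)
        where
        e S : F.Carrier
        e = ⟨ E Λ ⟩
        S = ∑ᶜ λ c → op 𝔰 c (triangle (α (scalar t)) * e)
        B C X : Code m → F.Carrier
        B c = scalar (zpow t½ t⁻½ (+ ℓ (perm c) ℤ.- + N))
        C c = scalar t½ F-Exp.^ ℓ (perm c)
        X c = Tʷ words (perm c) e
        coefficient : ∀ c → scalar (t½ K-Exp.^ N) * B c ≈ C c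
        coefficient c = F.trans (F.sym (scalar-* (t½ K-Exp.^ N) (zpow t½ t⁻½ (+ ℓ (perm c) ℤ.- + N))))
          (F.trans (scalar-cong (zpow-shift t½ t⁻½ t½*t⁻½ N (ℓ (perm c)))) (scalar-^ t½ (ℓ (perm c))))
        right : scalar ((t½ K-Exp.^ N) K.* W⁻¹) * 𝟏₀ words w₀ e ≈ scalar W⁻¹ * S
        right = F.trans
          (times-cong (scalar ((t½ K-Exp.^ N) K.* W⁻¹)) (scalar (t½ K-Exp.^ N) * scalar W⁻¹)
            (𝟏₀ words w₀ e) (∑ᶜ λ c → B c * X c)
            (scalar-* (t½ K-Exp.^ N) W⁻¹)
            (sum-permutations λ w → scalar (zpow t½ t⁻½ (+ ℓ w ℤ.- + N)) * Tʷ words w e))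
          (F.trans (pull-scalar (scalar (t½ K-Exp.^ N)) (scalar W⁻¹) B C X coefficient)
            (times-congˡ (scalar W⁻¹) (∑ᶜ λ c → C c * X c) S (symmetrizer-words words e)))

      fermionic-identity : IsLongest w₀ → ∀ E μ → A words E μ ≈ scalar (t^½ℓ words w₀) * ε₀ words w₀ ⟨ E μ ⟩
      fermionic-identity longest-w₀ E μ = F.trans left (F.sym right)
        where
        e Π S V : F.Carrier
        e = ⟨ E μ ⟩
        Π = ∏< λ i j i<j → (x j - scalar t * x i) ÷[x i -x j ] i<j
        S = ∑ᶜ λ c → (- 1#) F-Exp.^ ℓ (perm c) * op 𝔰 c e
        V = (- scalar t) F-Exp.^ len (longest m)
        sign : ∀ n → scalar ((K.- K.1#) K-Exp.^ n) ≈ (- 1#) F-Exp.^ n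
        sign n = F.trans (scalar-^ (K.- K.1#) n) (F-Exp.^-congˡ n (scalar-neg K.1#))
        left : Π * (∑ λ w → scalar ((K.- K.1#) K-Exp.^ ℓ w) * permuteFrac w e) ≈ V * (Δ⁻ * S)
        left = F.trans
          (times-cong Π (V * Δ⁻) (∑ λ w → scalar ((K.- K.1#) K-Exp.^ ℓ w) * permuteFrac w e) S ∏-fermionic
            (F.trans (sum-permutations λ w → scalar ((K.- K.1#) K-Exp.^ ℓ w) * permuteFrac w e)
              (∑ᶜ-cong λ c → times-cong (scalar ((K.- K.1#) K-Exp.^ ℓ (perm c))) ((- 1#) F-Exp.^ ℓ (perm c))
                (permuteFrac (perm c) e) (op 𝔰 c e) (sign (ℓ (perm c))) (permuteFrac-perm c e))))
          (F.*-assoc V Δ⁻ S)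
        B C X : Code m → F.Carrier
        B c = scalar (zpow (K.- t⁻½) (K.- t½) (+ ℓ (perm c) ℤ.- + N))
        C c = (- scalar t⁻½) F-Exp.^ ℓ (perm c)
        X c = Tʷ words (perm c) e
        coefficient : ∀ c → scalar ((K.- t⁻½) K-Exp.^ N) * B c ≈ C c
        coefficient c = F.trans (F.sym (scalar-* ((K.- t⁻½) K-Exp.^ N) (zpow (K.- t⁻½) (K.- t½) (+ ℓ (perm c) ℤ.- + N))))
          (F.trans (scalar-cong (zpow-shift (K.- t⁻½) (K.- t½) (K-Frames.negated-inverse t½ t⁻½ t½*t⁻½) N (ℓ (perm c))))
            (F.trans (scalar-^ (K.- t⁻½) (ℓ (perm c))) (F-Exp.^-congˡ (ℓ (perm c)) (scalar-neg t⁻½))))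
        -- Written t½ = (-t⁻½)(-t): the power of the first factor undoes the normalisation of ε₀ by
        -- ℓ(w₀), that of the second is the scalar by which the product in A differs from `Δ⁻`. The
        -- two exponents agree because w₀ is longest.
        prefactor : scalar (t½ K-Exp.^ N) ≈ scalar ((K.- t⁻½) K-Exp.^ N) * V
        prefactor = F.trans (scalar-cong t½-split) (F.trans (scalar-* ((K.- t⁻½) K-Exp.^ N) ((K.- t) K-Exp.^ N))
          (times-congˡ (scalar ((K.- t⁻½) K-Exp.^ N)) (scalar ((K.- t) K-Exp.^ N)) V
            (F.trans (scalar-^ (K.- t) N) (F.trans (F-Exp.^-congˡ N (scalar-neg t))
              (F.reflexive (cong ((- scalar t) F-Exp.^_) (ℓ-longest words w₀ longest-w₀)))))))
          where
          t½-split : t½ K-Exp.^ N K.≈ ((K.- t⁻½) K-Exp.^ N) K.* ((K.- t) K-Exp.^ N)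
          t½-split = K.trans (K-Frames.^-congˡ N (K-Frames.negated-root t½ t⁻½ t t½*t½ t½*t⁻½)) (K-Frames.^-distrib-* (K.- t⁻½) (K.- t) N)
        right : scalar (t½ K-Exp.^ N) * ε₀ words w₀ e ≈ V * (Δ⁻ * S)
        right = F.trans
          (times-cong (scalar (t½ K-Exp.^ N)) (scalar ((K.- t⁻½) K-Exp.^ N) * V)
            (ε₀ words w₀ e) (∑ᶜ λ c → B c * X c) prefactor
            (sum-permutations λ w → scalar (zpow (K.- t⁻½) (K.- t½) (+ ℓ w ℤ.- + N)) * Tʷ words w e))
          (F.trans (pull-scalar (scalar ((K.- t⁻½) K-Exp.^ N)) V B C X coefficient)
            (times-congˡ V (∑ᶜ λ c → C c * X c) (Δ⁻ * S) (antisymmetrizer-words words e)))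

  -- The polynomials E_μ at t½ = 1

  kᴿ = HeytingCommutativeRing.commutativeRing (HeytingField.heytingCommutativeRing k)
  open Specialisation kᴿ using (ev; ev-⊗; regular-at-one)
  module A = CommutativeRing k[q,t½].Poly-commutativeRing

  -- Denominators that survive at t½ = 1.
  Good : A.Carrier → Set (c ⊔ ℓ₁)
  Good d = k[q,t½].Regular (ev d)

  abstract
    Good-1 : Good A.1#
    Good-1 = k[q,t½].1-regular

    Good-* : ∀ d e → Good d → Good e → Good (d A.* e)
    Good-* d e good-d good-e =
      ≡.subst k[q,t½].Regular (≡.sym (ev-⊗ d e)) (k[q,t½].*-regular {ev d} {ev e} good-d good-e)

  denominators : Denominators k[q,t½].Poly-commutativeRing k[q,t½].Frac-commutativeRing (c ⊔ ℓ₁)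
  denominators = record
    { ι      = k[q,t½].fromR
    ; ι-+    = A-Props.fromR-+
    ; ι-*    = A-Props.fromR-*
    ; ι-1    = K.refl
    ; Good   = Good
    ; Good-1 = Good-1
    ; Good-* = Good-*
    }

  open Localisation denominators

  O-q·t½ : ∀ a b → O (q^ a ·t½^ b)
  O-q·t½ a b = O-ι (k[q,t½].monomial (a ∷ b ∷ []))

  O-1 : O K.1#
  O-1 = O-ι A.1#

  O--1 : O (K.- K.1#)
  O--1 = O-≈ (A-Props.fromR-neg A.1#) (O-ι (A.- A.1#))

  record Oᶠ (f : F.Carrier) : Set (c ⊔ ℓ₁) where
    constructor regular-scalar
    field
      {value}  : K.Carrier
      O-value  : O value
      is-value : f ≈ scalar value

  x⁻¹ : Fin (suc m) → F.Carrier
  x⁻¹ a = x^ (𝟎 ⊟ unit a)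

  abstract
    x^-⊞ : ∀ α β → x^ (α ⊞ β) ≈ x^ α * x^ β
    x^-⊞ α β = F.trans (fromR-cong (K[X].≋-sym (monomial-⊗ α β))) (fromR-* (monomial α) (monomial β))

    x-inverse : ∀ a → x a * x⁻¹ a ≈ 1#
    x-inverse a = F.trans (F.sym (x^-⊞ (unit a) (𝟎 ⊟ unit a)))
      (F.reflexive (cong x^_ (⊞⊟-cancel′ (unit a) 𝟎)))

    Oᶠ-invariant : ∀ {f} → Oᶠ f → ∀ i → 𝔰 i f ≈ f
    Oᶠ-invariant {f} (regular-scalar {a} _ f≈a) i =
      F.trans (permuteFrac-cong (s i) f≈a) (F.trans (permuteFrac-scalar (s i) a) (F.sym f≈a))

    Oᶠ-1 : Oᶠ 1#
    Oᶠ-1 = regular-scalar O-1 F.refl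

    Oᶠ--1 : Oᶠ (- 1#)
    Oᶠ--1 = regular-scalar O--1 (F.sym (scalar-neg K.1#))

    Oᶠ-t½ : Oᶠ (scalar t½)
    Oᶠ-t½ = regular-scalar (O-q·t½ 0ℤ 1ℤ) F.refl

  open Lattices F
  lattice : LatticeData frame (c ⊔ ℓ₁)
  lattice = record
    { O           = Oᶠ
    ; O-invariant = Oᶠ-invariant
    ; O-1         = Oᶠ-1
    ; O--1        = Oᶠ--1
    ; x⁻¹         = x⁻¹
    ; x-inverse   = x-inverse
    ; z           = scalar t½
    ; O-z         = Oᶠ-t½
    ; zz≈t        = scalar-t½²
    }

  open Lattice lattice

  AllO : Poly → Set (c ⊔ ℓ₁)
  AllO = All (O ∘ proj₁)

  abstract
    AllO-⊗ : ∀ {p q} → AllO p → AllO q → AllO (p K[X].⊗ q)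
    AllO-⊗                 []           Oq = []
    AllO-⊗ {(a , α) ∷ p} {q} (Oa ∷ Op) Oq = All.++⁺ (scale Oq) (AllO-⊗ Op Oq)
      where
      scale : ∀ {q} → AllO q → AllO (K[X].scaleTerm (a , α) q)
      scale []        = []
      scale (Ob ∷ Oq) = O-* Oa Ob ∷ scale Oq

    AllO-coeff : ∀ {p} → AllO p → ∀ ν → O (coeff ν p)
    AllO-coeff []                   ν = O-≈ (A-Props.fromR-cong A.refl) (O-ι A.0#)
    AllO-coeff {(a , α) ∷ p} (Oa ∷ Op) ν = O-+ (choose (does (α ≟ᵉ ν))) (AllO-coeff Op ν)
      where
      choose : ∀ b → O (if b then a else K.0#)
      choose true  = Oa
      choose false = O-ι A.0#

    -- In (E1) the map `cycle` acts on lists of terms and not on K(X), so elements of `L` have to be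
    -- written as lists with coefficients in `O`.
    toList : ∀ {f} → L f → ∃ λ p → AllO p × f ≈ ⟨ p ⟩
    toList (L-O (regular-scalar {a} Oa f≈a)) = constant a , Oa ∷ [] , f≈a
    toList (L-x a)     = monomial (unit a) , O-1 ∷ [] , F.refl
    toList (L-x⁻¹ a)   = monomial (𝟎 ⊟ unit a) , O-1 ∷ [] , F.refl
    toList (L-+ {f} {g} Lf Lg) = let p , Op , f≈p = toList Lf ; q , Oq , g≈q = toList Lg in
      p ++ q , All.++⁺ Op Oq , F.trans (plus-cong f ⟨ p ⟩ g ⟨ q ⟩ f≈p g≈q) (F.sym (fromR-+ p q))
    toList (L-* {f} {g} Lf Lg) = let p , Op , f≈p = toList Lf ; q , Oq , g≈q = toList Lg in
      p K[X].⊗ q , AllO-⊗ Op Oq , F.trans (times-cong f ⟨ p ⟩ g ⟨ q ⟩ f≈p g≈q) (F.sym (fromR-* p q))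
    toList (L-≈ f≈g Lf) = let p , Op , f≈p = toList Lf in p , Op , F.trans (F.sym f≈g) f≈p

    L-scalar : ∀ {a} → O a → L (scalar a)
    L-scalar Oa = L-O (regular-scalar Oa F.refl)

    L-x^ : ∀ α → L (x^ α)
    L-x^ = exponent-induction (L ∘ x^_) L-1 (λ {α} {β} Lα Lβ → L-≈ (F.sym (x^-⊞ α β)) (L-* Lα Lβ)) L-x L-x⁻¹

    ⟨∷⟩ : ∀ a α p → ⟨ (a , α) ∷ p ⟩ ≈ scalar a * x^ α + ⟨ p ⟩
    ⟨∷⟩ a α p = F.trans (fromR-+ ((a , α) ∷ []) p)
      (plus-cong ⟨ (a , α) ∷ [] ⟩ (scalar a * x^ α) ⟨ p ⟩ ⟨ p ⟩
        (F.trans (fromR-cong (term-split a α)) (fromR-* (constant a) (monomial α))) F.refl)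

    fromList : ∀ {p} → AllO p → L ⟨ p ⟩
    fromList []                        = L-0
    fromList {(a , α) ∷ p} (Oa ∷ Op) = L-≈ (F.sym (⟨∷⟩ a α p)) (L-+ (L-* (L-scalar Oa) (L-x^ α)) (fromList Op))

  w : K.Carrier
  w = K.1# K.- t½

  infix 5 _+w_
  _+w_ : Poly → Poly → Poly
  p +w l = p ++ constant w K[X].⊗ l

  abstract
    ⟨+w⟩ : ∀ p l → ⟨ p +w l ⟩ ≈ ⟨ p ⟩ + (1# - scalar t½) * ⟨ l ⟩
    ⟨+w⟩ p l = F.trans (fromR-+ p (constant w K[X].⊗ l))
      (plus-cong ⟨ p ⟩ ⟨ p ⟩ ⟨ constant w K[X].⊗ l ⟩ ((1# - scalar t½) * ⟨ l ⟩) F.refl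
        (F.trans (fromR-* (constant w) l)
          (times-congʳ (scalar w) (1# - scalar t½) ⟨ l ⟩
            (F.trans (scalar-+ K.1# (K.- t½)) (plus-cong (scalar K.1#) 1# (scalar (K.- t½)) (- scalar t½) scalar-1 (scalar-neg t½))))))

    as-list : ∀ {f p} → f ≡ᴸ ⟨ p ⟩ → ∃ λ l → AllO l × f ≈ ⟨ p +w l ⟩
    as-list {f} {p} (congruent {q} Lq d) = let l , Ol , q≈l = toList Lq in
      l , Ol , F.trans d (F.trans
        (plus-cong ⟨ p ⟩ ⟨ p ⟩ ((1# - scalar t½) * q) ((1# - scalar t½) * ⟨ l ⟩) F.refl (times-congˡ (1# - scalar t½) q ⟨ l ⟩ q≈l))
        (F.sym (⟨+w⟩ p l)))

    cycle-cong : ∀ {p q} → p K[X].≋ q → cycle p K[X].≋ cycle q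
    cycle-cong = LinearMaps.mapTerms-cong k[q,t½].Frac-commutativeRing
      (λ a ν → a K.* q^ (ℤ.- last ν) ·t½^ 0ℤ) rotate
      (λ {a} {b} ν p → K-Frames.times-congʳ a b (q^ (ℤ.- last ν) ·t½^ 0ℤ) p)
      (λ a b ν → K.distribʳ (q^ (ℤ.- last ν) ·t½^ 0ℤ) a b)

    cycle-scale : ∀ l → cycle (constant w K[X].⊗ l) K[X].≋ constant w K[X].⊗ cycle l
    cycle-scale []            = K[X].≋-refl
    cycle-scale ((b , β) ∷ l) rewrite ⊞-identityˡ β | ⊞-identityˡ (rotate β) = K[X].coeffwise λ ν →
      K-Frames.plus-cong _ _ _ _
        (select-cong (does (rotate β ≟ᵉ ν)) (K.*-assoc w b (q^ (ℤ.- last β) ·t½^ 0ℤ)))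
        (K[X].coeff-≈ (cycle-scale l) ν)

    AllO-cycle : ∀ {l} → AllO l → AllO (cycle l)
    AllO-cycle []        = []
    AllO-cycle {(b , β) ∷ l} (Ob ∷ Ol) = O-* Ob (O-q·t½ (ℤ.- last β) 0ℤ) ∷ AllO-cycle Ol

    cycle-+w : ∀ μ l → cycle (monomial μ +w l) K[X].≋ cycle (monomial μ) +w cycle l
    cycle-+w μ l = K[X]-Ring.+-congˡ {cycle (monomial μ)} {cycle (constant w K[X].⊗ l)} {constant w K[X].⊗ cycle l} (cycle-scale l)

    O-ratio : ∀ a d → Good d → (rd : k[q,t½].Regular d) → O (k[q,t½].fromR a k[q,t½].÷ (d , rd))
    O-ratio a d good rd = O-divide d good
      (K-Frames.divide-cancel (k[q,t½].fromR d) (k[q,t½].fromR a) (A-Props.reciprocal d rd) (k[q,t½].fromR a k[q,t½].÷ (d , rd))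
        (A-Props.÷≈* (k[q,t½].fromR a) d rd) (A-Props.reciprocal-inverse d rd))
      (O-ι a)

    ratio-factor : ∀ p a d (rd : k[q,t½].Regular d) →
                   p K.* a k[q,t½].÷ (d , rd) K.≈ p K.* (a k[q,t½].÷ (d , rd))
    ratio-factor p a d rd = K-Frames.factor-out p a (A-Props.reciprocal d rd)
      (p K.* a k[q,t½].÷ (d , rd)) (a k[q,t½].÷ (d , rd)) (A-Props.÷≈* (p K.* a) d rd) (A-Props.÷≈* a d rd)

  open Counting k[q,t½].Frac-commutativeRing using (∑ᶜ-positive)
  private
    module kᴿ = CommutativeRing kᴿ
    module AL = RingLemmas k[q,t½].Poly-commutativeRing
    module P-Sum = CodeSum K[X]-Ring.+-commutativeMonoid
  open Algebra.Definitions.RawMonoid kᴿ.+-rawMonoid using () renaming (_×_ to _·ᵏ_)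
  open Algebra.Definitions.RawMonoid K.+-rawMonoid using () renaming (_×_ to _·_)

  module _ (char-0 : CharacteristicZero k) {E : Exponent (suc m) → Poly} (electronic : IsElectronic E) where
    open IsElectronic electronic

    AtOne : Exponent (suc m) → Set (c ⊔ ℓ₁)
    AtOne μ = ⟨ E μ ⟩ ≡ᴸ x^ μ

    abstract
      zero-step : AtOne 𝟎
      zero-step = ≡ᴸ-resp (F.sym (fromR-cong E0)) F.refl ≡ᴸ-refl

      rotate-step : ∀ μ → AtOne μ → AtOne (rotate μ ⊞ unit zero)
      rotate-step μ Eμ = congruent (L-* (L-* (L-scalar (O-q·t½ (last μ) 0ℤ)) (L-x zero)) (fromList (AllO-cycle Ol)))
        (scaled-remainder ⟨ E (rotate μ ⊞ unit zero) ⟩ (scalar (q^ last μ ·t½^ 0ℤ)) (x zero) ⟨ cycle (E μ) ⟩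
          (scalar (K.1# K.* q^ (ℤ.- last μ) ·t½^ 0ℤ)) (x^ rotate μ) (1# - scalar t½) ⟨ cycle l ⟩ (x^ (rotate μ ⊞ unit zero))
          raised cycled scalars shifted)
        where
        l : Poly
        l = proj₁ (as-list {p = monomial μ} Eμ)
        Ol : AllO l
        Ol = proj₁ (proj₂ (as-list {p = monomial μ} Eμ))
        E≋ : E μ K[X].≋ monomial μ +w l
        E≋ = fromR-injective (proj₂ (proj₂ (as-list {p = monomial μ} Eμ)))
        raised : ⟨ E (rotate μ ⊞ unit zero) ⟩ ≈ scalar (q^ last μ ·t½^ 0ℤ) * x zero * ⟨ cycle (E μ) ⟩
        raised = F.trans (fromR-cong (E1 μ)) (F.trans (fromR-* (constant (q^ last μ ·t½^ 0ℤ) K[X].⊗ monomial (unit zero)) (cycle (E μ)))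
          (times-congʳ ⟨ constant (q^ last μ ·t½^ 0ℤ) K[X].⊗ monomial (unit zero) ⟩ (scalar (q^ last μ ·t½^ 0ℤ) * x zero) ⟨ cycle (E μ) ⟩
            (fromR-* (constant (q^ last μ ·t½^ 0ℤ)) (monomial (unit zero)))))
        cycled : ⟨ cycle (E μ) ⟩ ≈ scalar (K.1# K.* q^ (ℤ.- last μ) ·t½^ 0ℤ) * x^ rotate μ + (1# - scalar t½) * ⟨ cycle l ⟩
        cycled = F.trans (fromR-cong (K[X].≋-trans (cycle-cong E≋) (cycle-+w μ l)))
          (F.trans (⟨+w⟩ (cycle (monomial μ)) (cycle l))
            (plus-cong ⟨ cycle (monomial μ) ⟩ (scalar (K.1# K.* q^ (ℤ.- last μ) ·t½^ 0ℤ) * x^ rotate μ)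
              ((1# - scalar t½) * ⟨ cycle l ⟩) ((1# - scalar t½) * ⟨ cycle l ⟩)
              (F.trans (fromR-cong (term-split (K.1# K.* q^ (ℤ.- last μ) ·t½^ 0ℤ) (rotate μ)))
                (fromR-* (constant (K.1# K.* q^ (ℤ.- last μ) ·t½^ 0ℤ)) (monomial (rotate μ)))) F.refl))
        scalars : scalar (q^ last μ ·t½^ 0ℤ) * scalar (K.1# K.* q^ (ℤ.- last μ) ·t½^ 0ℤ) ≈ 1#
        scalars = F.trans (F.sym (scalar-* (q^ last μ ·t½^ 0ℤ) (K.1# K.* q^ (ℤ.- last μ) ·t½^ 0ℤ)))
          (scalar-cong (K.trans
            (K-Frames.times-congˡ (q^ last μ ·t½^ 0ℤ) (K.1# K.* q^ (ℤ.- last μ) ·t½^ 0ℤ) (q^ (ℤ.- last μ) ·t½^ 0ℤ) (K.*-identityˡ (q^ (ℤ.- last μ) ·t½^ 0ℤ)))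
            (K.trans (q·t½-* (last μ) 0ℤ (ℤ.- last μ) 0ℤ) (K.reflexive (cong (λ a → q^ a ·t½^ 0ℤ) (ℤ.+-inverseʳ (last μ)))))))
        shifted : x zero * x^ rotate μ ≈ x^ (rotate μ ⊞ unit zero)
        shifted = F.trans (F.sym (x^-⊞ (unit zero) (rotate μ))) (F.reflexive (cong x^_ (⊞-comm (unit zero) (rotate μ))))

      swap-step : ∀ μ → (∀ j → 0ℤ ℤ.≤ lookup μ j) → ∀ i → lookup μ (hi i) ℤ.< lookup μ (lo i) →
                  AtOne μ → AtOne (permuteExponent (s i) μ)
      swap-step μ nonneg i gt Eμ = ≡ᴸ-resp (F.sym E≈) (permuteFrac-x^ (s i) μ)
        (≡ᴸ-trans (intertwiner i {e} {scalar κ} {scalar κ′} Le (L-scalar (O-ratio _ (proj₁ b) good (proj₂ b))) κ≈) (≡ᴸ-s i Eμ))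
        where
        e : F.Carrier
        e = ⟨ E μ ⟩
        Le : L e
        Le = L-≡ᴸ Eμ (L-x^ μ)
        d e′ : ℤ
        d  = lookup μ (lo i) ℤ.- lookup μ (hi i)
        e′ = + 2 ℤ.* (+ v μ (lo i) ℤ.- + v μ (hi i))
        b : ∃ k[q,t½].Regular
        b = k[q,t½].binomial 𝟎 (d ∷ e′ ∷ []) (𝟎≢a e′ gt)
        good : Good (proj₁ b)
        -- At t½ = 1 the denominator 1 - a becomes 1 - q^d, which is regular because `gt` makes d
        -- positive.
        good = k[q,t½].binomial-regular 𝟎 (d ∷ 0ℤ ∷ []) (𝟎≢a 0ℤ gt)
        κ κ′ : K.Carrier
        κ  = (K.1# K.- t) K.* q^ d ·t½^ e′ k[q,t½].÷ b
        κ′ = q^ d ·t½^ e′ k[q,t½].÷ b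
        κ≈ : scalar κ ≈ (1# - scalar t) * scalar κ′
        κ≈ = F.trans (scalar-cong (ratio-factor (K.1# K.- t) (q^ d ·t½^ e′) (proj₁ b) (proj₂ b)))
          (F.trans (scalar-* (K.1# K.- t) κ′) (times-congʳ (scalar (K.1# K.- t)) (1# - scalar t) (scalar κ′)
            (F.trans (scalar-+ K.1# (K.- t)) (minus-hom (scalar K.1#) 1# (scalar (K.- t)) (scalar t) scalar-1 (scalar-neg t)))))
        E≈ : ⟨ E (permuteExponent (s i) μ) ⟩ ≈ D i (x (lo i) * e) - scalar t * x (lo i) * D i e + scalar κ * e
        E≈ = F.trans (E2 μ nonneg i gt)
          (plus-cong (∂ i (x (lo i) * e) - scalar t * x (lo i) * ∂ i e) (D i (x (lo i) * e) - scalar t * x (lo i) * D i e)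
            (scalar κ * e) (scalar κ * e)
            (plus-cong (∂ i (x (lo i) * e)) (D i (x (lo i) * e)) (- (scalar t * x (lo i) * ∂ i e)) (- (scalar t * x (lo i) * D i e))
              (inv-÷ (x (lo i) * e - 𝔰 i (x (lo i) * e)) (lo≢hi i))
              (F.-‿cong {scalar t * x (lo i) * ∂ i e} {scalar t * x (lo i) * D i e}
                (times-congˡ (scalar t * x (lo i)) (∂ i e) (D i e) (inv-÷ (e - 𝔰 i e) (lo≢hi i)))))
            F.refl)

      shift-step : ∀ μ → AtOne μ → AtOne (μ ⊟ replicate (suc m) 1ℤ)
      shift-step μ Eμ = ≡ᴸ-resp
        (F.sym (F.trans (fromR-cong (E3 μ)) (fromR-* (monomial (𝟎 ⊟ replicate (suc m) 1ℤ)) (E μ))))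
        (F.trans (F.sym (x^-⊞ (𝟎 ⊟ replicate (suc m) 1ℤ) μ)) (F.reflexive (cong x^_ exponents)))
        (≡ᴸ-*ˡ (L-x^ (𝟎 ⊟ replicate (suc m) 1ℤ)) Eμ)
        where
        exponents : 𝟎 ⊟ replicate (suc m) 1ℤ ⊞ μ ≡ μ ⊟ replicate (suc m) 1ℤ
        exponents = ≡.trans (⊞-comm (𝟎 ⊟ replicate (suc m) 1ℤ) μ)
          (≡.trans (≡.sym (shift-difference μ 𝟎 (replicate (suc m) 1ℤ)))
            (cong (_⊟ replicate (suc m) 1ℤ) (≡.trans (⊞-comm μ 𝟎) (⊞-identityˡ μ))))

    private
      Nonnegative : Exponent (suc m) → Set
      Nonnegative μ = ∀ j → 0ℤ ℤ.≤ lookup μ j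

      positive : ∀ {a} → 0ℤ ℤ.≤ a → a ≢ 0ℤ → 0ℤ ℤ.< a
      positive p q = ℤ.≤∧≢⇒< p (q ∘ ≡.sym)

    -- (E1) reaches every μ with μ₁ > 0; a positive entry is moved to the front by (E2).
    nonnegative-at-one : ∀ N μ → Nonnegative μ → weight μ ≡ N → AtOne μ
    bring-to-front : ∀ N n (j : Fin (suc m)) → toℕ j ≡ n → ∀ μ → Nonnegative μ → weight μ ≡ suc N → lookup μ j ≢ 0ℤ → AtOne μ
    nonnegative-at-one zero    μ nonneg p = ≡.subst AtOne (≡.sym (weight≡0 μ p)) zero-step
    nonnegative-at-one (suc N) μ nonneg p = let j , μⱼ≢0 = positive-entry μ λ q → contradiction (≡.trans (≡.sym p) q) λ () in
      bring-to-front N (toℕ j) j ≡.refl μ nonneg p μⱼ≢0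
    bring-to-front N zero    zero    _ (+ zero   ∷ v) nonneg p μ₀≢0 = contradiction ≡.refl μ₀≢0
    bring-to-front N zero    zero    _ (-[1+ a ] ∷ v) nonneg p μ₀≢0 = contradiction (nonneg zero) λ ()
    -- (a + 1, v) is what (E1) makes out of (v, a), whose weight is smaller by one.
    bring-to-front N zero    zero    _ (+ suc a  ∷ v) nonneg p μ₀≢0 =
      ≡.subst AtOne rotated (rotate-step ν
        (nonnegative-at-one N ν (lookup-∷ʳ (0ℤ ℤ.≤_) v (nonneg ∘ suc) (ℤ.+≤+ z≤n))
          (≡.trans (weight-∷ʳ v (+ a)) (ℕ.suc-injective p))))
      where
      ν : Exponent (suc m)
      ν = v Vec.∷ʳ + a
      rotated : rotate ν ⊞ unit zero ≡ + suc a ∷ v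
      rotated = cong₂ _∷_ (≡.trans (cong (ℤ._+ 1ℤ) (Vec.last-∷ʳ (+ a) v)) (cong +_ (ℕ.+-comm a 1)))
        (≡.trans (cong (_⊞ 𝟎) (Vec.init-∷ʳ (+ a) v)) (≡.trans (⊞-comm v 𝟎) (⊞-identityˡ v)))
    bring-to-front N (suc n) (suc i) q μ nonneg p μⱼ≢0 with lookup μ (inject₁ i) ℤ.≟ 0ℤ
    ... | no  μᵢ≢0 = bring-to-front N n (inject₁ i) (≡.trans (Fin.toℕ-inject₁ i) (ℕ.suc-injective q)) μ nonneg p μᵢ≢0
    -- (E2) is applied to s_i μ, where the positive entry precedes the 0 and the strict inequality
    -- holds; s_i then leads back to μ.
    ... | yes μᵢ≡0 = ≡.subst AtOne (permute-involution i μ)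
      (swap-step μ′ nonneg′ i (≡.subst₂ ℤ._<_ (≡.sym (≡.trans at-hi μᵢ≡0)) (≡.sym at-lo) (positive (nonneg (suc i)) μⱼ≢0))
        (bring-to-front N n (inject₁ i) (≡.trans (Fin.toℕ-inject₁ i) (ℕ.suc-injective q)) μ′ nonneg′
          (≡.trans (weight-permute (s i) μ) p) (μⱼ≢0 ∘ ≡.trans (≡.sym at-lo))))
      where
      μ′ : Exponent (suc m)
      μ′ = permuteExponent (s i) μ
      at-lo : lookup μ′ (lo i) ≡ lookup μ (hi i)
      at-lo = ≡.trans (cong (lookup μ′) (≡.sym (swap-hi i))) (lookup-permute-s i μ (suc i))
      at-hi : lookup μ′ (hi i) ≡ lookup μ (lo i)
      at-hi = ≡.trans (cong (lookup μ′) (≡.sym (swap-lo i))) (lookup-permute-s i μ (inject₁ i))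
      nonneg′ : Nonnegative μ′
      nonneg′ j = ≡.subst (0ℤ ℤ.≤_) (≡.sym (Vec.lookup∘tabulate (λ a → lookup μ (s i ⟨$⟩ˡ a)) j)) (nonneg (s i ⟨$⟩ˡ j))

    -- Adding `weight μ` to all entries makes them nonnegative, and (E3) takes the shift back one
    -- unit at a time.
    at-one : ∀ μ → AtOne μ
    at-one μ = descend (weight μ) (nonnegative-at-one _ _ raised ≡.refl)
      where
      raise : ℕ → Exponent (suc m)
      raise N = μ ⊞ replicate (suc m) (+ N)
      descend : ∀ N → AtOne (raise N) → AtOne μ
      descend zero    p = ≡.subst AtOne (≡.trans (⊞-comm μ 𝟎) (⊞-identityˡ μ)) p
      descend (suc N) p = descend N (≡.subst AtOne
        (≡.trans (shift-difference μ (replicate (suc m) (+ suc N)) (replicate (suc m) 1ℤ))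
          (cong (μ ⊞_) (Vec.zipWith-replicate ℤ._-_ (+ suc N) 1ℤ)))
        (shift-step (raise (suc N)) p))
      raised : Nonnegative (raise (weight μ))
      raised j = ≡.subst (0ℤ ℤ.≤_)
        (≡.sym (≡.trans (Vec.lookup-zipWith ℤ._+_ j μ _) (cong (λ a → lookup μ j ℤ.+ a) (Vec.lookup-replicate j (+ weight μ)))))
        (bound (lookup μ j) (entry≤weight μ j))
        where
        bound : ∀ a {N} → ℤ.∣ a ∣ ℕ.≤ N → 0ℤ ℤ.≤ a ℤ.+ + N
        bound (+ a)    p = ℤ.+≤+ z≤n
        bound -[1+ a ] {N} p = ≡.subst (0ℤ ℤ.≤_) (≡.sym (ℤ.⊖-≥ p)) (ℤ.+≤+ z≤n)

    -- Invertibility of the leading coefficient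

    private
      z̃ : A.Carrier
      z̃ = k[q,t½].monomial (0ℤ ∷ 1ℤ ∷ [])

      w̃ : A.Carrier
      w̃ = A.1# A.- z̃

      integer : kᴿ.Carrier → A.Carrier
      integer = k[q,t½].constant

      integer-· : ∀ n → k[q,t½].fromR (integer (suc n ·ᵏ kᴿ.1#)) K.≈ suc n · K.1#
      integer-· zero    = K.trans
        (A-Props.fromR-cong (A-Props.constant-cong (kᴿ.+-identityʳ kᴿ.1#)))
        (K.sym (K.+-identityʳ K.1#))
      integer-· (suc n) = K.trans (A-Props.fromR-cong (A-Props.constant-+ kᴿ.1# (suc n ·ᵏ kᴿ.1#)))
        (K.trans (A-Props.fromR-+ A.1# (integer (suc n ·ᵏ kᴿ.1#)))
          (K-Frames.plus-cong K.1# K.1# (k[q,t½].fromR (integer (suc n ·ᵏ kᴿ.1#))) (suc n · K.1#) K.refl (integer-· n)))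

      integer-invertible : ∀ n → ∃ λ y → integer (suc n ·ᵏ kᴿ.1#) A.* y A.≈ A.1#
      -- `#⇒invertible` inverts the difference of the two sides of the apartness, here the integer
      -- minus 0, which explains `-0≈0`.
      integer-invertible n = let y , _ , p = HeytingField.#⇒invertible k (char-0 n) in
        integer y , A.trans (A.sym (A-Props.constant-* N y))
          (A-Props.constant-cong (kᴿ.trans (kᴿ.*-congʳ (kᴿ.trans (kᴿ.sym (kᴿ.+-identityʳ N)) (kᴿ.+-congˡ (kᴿ.sym -0≈0)))) p))
        where
        N : kᴿ.Carrier
        N = suc n ·ᵏ kᴿ.1#
        -0≈0 : kᴿ.- kᴿ.0# kᴿ.≈ kᴿ.0#
        -0≈0 = kᴿ.trans (kᴿ.sym (kᴿ.+-identityˡ _)) (kᴿ.-‿inverseʳ kᴿ.0#)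

      -- At t½ = 1 the numerator is a positive integer times the denominator.
      numerator-regular : ∀ n d e → Good d → k[q,t½].Regular (integer (suc n ·ᵏ kᴿ.1#) A.* d A.+ w̃ A.* e)
      numerator-regular n d e good = regular-at-one X λ h Xh≈0 → good h
        (AL.regular-remainder (ev X) N (proj₁ (integer-invertible n)) (ev d) (ev w̃) (ev e) h
          (A.reflexive (≡.trans (List.map-++ _ (N A.* d) (w̃ A.* e)) (cong₂ _++_ (ev-⊗ N d) (ev-⊗ w̃ e))))
          (A.-‿inverseʳ A.1#) (proj₂ (integer-invertible n)) Xh≈0)
        where
        N X : A.Carrier
        N = integer (suc n ·ᵏ kᴿ.1#)
        X = N A.* d A.+ w̃ A.* e

      w≈w̃ : w K.≈ k[q,t½].fromR w̃
      w≈w̃ = K.sym (A-Props.fromR-minus A.1# z̃)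

    module _ (Λ : Exponent (suc m)) where
      private
        orbit : Code m → Exponent (suc m)
        orbit c = permuteExponent (perm c) Λ

        -- The value of `U` at t½ = 1. Each monomial in the orbit of Λ occurs as often as the
        -- stabiliser of Λ has elements.
        M : Poly
        M = P-Sum.∑ᶜ λ c → monomial (orbit c)

        U : F.Carrier
        U = ∑ᶜ λ c → op 𝔹.τ c ⟨ E Λ ⟩

        abstract
          U≡M : U ≡ᴸ ⟨ M ⟩
          U≡M = ≡ᴸ-resp F.refl
            (F.trans (∑ᶜ-cong λ c → F.trans (F.sym (permuteFrac-perm c (x^ Λ))) (permuteFrac-x^ (perm c) Λ))
              (F.sym (∑ᶜ-homo K[X]-Ring.+-commutativeMonoid F.+-commutativeMonoid ⟨_⟩ F.refl fromR-+ (λ c → monomial (orbit c)))))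
            (≡ᴸ-sum λ c → op-τ≡s c (L-x^ Λ) (at-one Λ))

          U-list : ∃ λ l → AllO l × U ≈ ⟨ M +w l ⟩
          U-list = as-list {p = M} U≡M

        l p₀ : Poly
        l  = proj₁ U-list
        p₀ = M +w l

        C : K.Carrier
        C = coeff Λ p₀

        δ : Code m → K.Carrier
        δ c = coeff Λ (monomial (orbit c))

        abstract
          δ-count : ∀ c → ∃ λ n → δ c K.≈ n · K.1#
          δ-count c = choose (does (orbit c ≟ᵉ Λ))
            where
            choose : ∀ b → ∃ λ n → (if b then K.1# else K.0#) K.+ K.0# K.≈ n · K.1#
            choose true  = 1 , K.refl
            choose false = 0 , K.+-identityʳ K.0#

          orbit-identity : orbit (identity m) ≡ Λ
          orbit-identity = ≡.trans (permuteExponent-cong {w = perm (identity m)} {idₚ} (λ a →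
              ≡.trans (perm≡op (identity m) a) (Operators.op-identity (≡.setoid (Fin (suc m))) swap a)) Λ) (permuteExponent-id Λ)

          δ-identity : δ (identity m) K.≈ K.1#
          δ-identity = select-self (orbit (identity m) ≟ᵉ Λ)
            where
            select-self : (d : Dec (orbit (identity m) ≡ Λ)) → (if does d then K.1# else K.0#) K.+ K.0# K.≈ K.1#
            select-self (yes _) = K.+-identityʳ K.1#
            select-self (no  p) = contradiction orbit-identity p

          stabiliser : ∃ λ n → coeff Λ M K.≈ suc n · K.1#
          stabiliser = let n , p = ∑ᶜ-positive δ δ-count δ-identity in
            n , K.trans (∑ᶜ-homo K[X]-Ring.+-commutativeMonoid K.+-commutativeMonoid (coeff Λ) K.refl (K[X].coeff-++ Λ) (λ c → monomial (orbit c))) p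

          coeff-constant : ∀ a p → coeff Λ (constant a K[X].⊗ p) K.≈ a K.* coeff Λ p
          coeff-constant a p = K.trans (K[X].coeff-∷⊗ Λ a 𝟎 [] p) (K.trans (K.+-identityʳ (a K.* coeff (Λ ⊟ 𝟎) p))
            (K.reflexive (cong (λ ν → a K.* coeff ν p) (⊟𝟎 Λ))))

          C≈ : C K.≈ k[q,t½].fromR (integer (suc (proj₁ stabiliser) ·ᵏ kᴿ.1#)) K.+ k[q,t½].fromR w̃ K.* coeff Λ l
          C≈ = K.trans (K[X].coeff-++ Λ M (constant w K[X].⊗ l))
            (K-Frames.plus-cong (coeff Λ M) (k[q,t½].fromR (integer (suc (proj₁ stabiliser) ·ᵏ kᴿ.1#)))
              (coeff Λ (constant w K[X].⊗ l)) (k[q,t½].fromR w̃ K.* coeff Λ l)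
              (K.trans (proj₂ stabiliser) (K.sym (integer-· (proj₁ stabiliser))))
              (K.trans (coeff-constant w l) (K-Frames.times-congʳ w (k[q,t½].fromR w̃) (coeff Λ l) w≈w̃)))

          C-unit : K-Frames.Unit C
          C-unit = unit-modulo (integer (suc (proj₁ stabiliser) ·ᵏ kᴿ.1#)) w̃
            (AllO-coeff (proj₁ (proj₂ U-list)) Λ) C≈
            λ d e good → let X = integer (suc (proj₁ stabiliser) ·ᵏ kᴿ.1#) A.* d A.+ w̃ A.* e
                             X-regular = numerator-regular (proj₁ stabiliser) d e good
                         in A-Props.reciprocal X X-regular , A-Props.reciprocal-inverse X X-regular

      normalizing : ∃ (IsNormalizing E Λ)
      normalizing = C , record
        { W⁻¹     = C⁻¹
        ; inverse = proj₂ C-unit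
        ; p       = constant C⁻¹ K[X].⊗ p₀
        ; P≈p     = F.trans (P-hecke E Λ C⁻¹) (F.trans
            (times-congˡ (scalar C⁻¹) U ⟨ p₀ ⟩ (proj₂ (proj₂ U-list))) (F.sym (fromR-* (constant C⁻¹) p₀)))
        ; leading = K.trans (coeff-constant C⁻¹ p₀) (K.trans (K.*-comm C⁻¹ C) (proj₂ C-unit))
        }
        where
        C⁻¹ : K.Carrier
        C⁻¹ = proj₁ C-unit

theorem4p3 : ∀ {c ℓ₁ ℓ₂} (k : HeytingField c ℓ₁ ℓ₂) → CharacteristicZero k → (m : ℕ) →
    let open Macdonald k m in
    (E : Exponent (suc m) → Poly) → IsElectronic E →
    (words : ReducedWords) (w₀ : Permutation′ (suc m)) → ReducedWords.IsLongest words w₀ →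
    (Λ : Exponent (suc m)) → Dominant Λ →
    ∃ (IsNormalizing E Λ)
    × (∀ W (N : IsNormalizing E Λ W) → let open IsNormalizing N using (W⁻¹) in
    P E W⁻¹ Λ ≈ scalar (t^½ℓ words w₀ K.* W⁻¹) * 𝟏₀ words w₀ ⟨ E Λ ⟩)
    × A words E (Λ ⊞ ρ) ≈ scalar (t^½ℓ words w₀) * ε₀ words w₀ ⟨ E (Λ ⊞ ρ) ⟩
theorem4p3 k char-0 m E electronic words w₀ longest Λ _ =
  MacdonaldIdentities.normalizing k m char-0 electronic Λ ,
  (λ W N → MacdonaldIdentities.bosonic-identity k m words w₀ E Λ (Macdonald.IsNormalizing.W⁻¹ N)) ,
  MacdonaldIdentities.fermionic-identity k m words w₀ longest E (Λ ⊞ Macdonald.ρ k m)
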